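{- Let $G$ be a flow-critical graph. If $G$ has at most one vertex of degree at least $7$, then $|E(G)|\le 3|V(G)|-5$.
   Context: Graphs are finite, loopless, and may have parallel edges. A nowhere-zero $3$-flow of a graph $G$ is an orientation of $G$ such that $\deg^+(v)-\deg^-(v)\equiv 0\pmod 3$ for every vertex $v$. For a partition $\mathcal P$ of $V(G)$, $G/\mathcal P$ denotes the graph obtained by identifying the vertices of each part into a single vertex and deleting all loops; $\mathcal P$ is non-trivial if some part has at least two vertices. A graph $G$ is flow-critical if $G$ has no nowhere-zero $3$-flow, but $G/\mathcal P$ has a nowhere-zero $3$-flow for every non-trivial partition $\mathcal P$ of $V(G)$ (parts need not induce connected subgraphs). -}

module Defs where

open import Data.Nat using (ℕ; _%_)
open import Data.Fin using (Fin; _≟_)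
open import Data.Product using (_×_; _,_; proj₁; proj₂; Σ; ∃; ∃-syntax)
import Data.Product as P
open import Data.Sum using (_⊎_)
open import Data.List using (List; length; filter; map)
open import Data.List.Relation.Unary.All using (All)
open import Data.List.Relation.Binary.Pointwise using (Pointwise)
open import Relation.Binary.PropositionalEquality using (_≡_; _≢_)
open import Relation.Nullary using (¬_; ¬?)
open import Function using (Surjective)

-- A finite loopless multigraph on vertex set Fin n; the edges are a list of
-- (unordered) edges, each recorded by its two ends (the order in the pair is
-- irrelevant for all notions below). Parallel edges = repeated list entries.
record Graph : Set where
  field
    n        : ℕ
    edges    : List (Fin n × Fin n)
    loopless : All (λ e → proj₁ e ≢ proj₂ e) edges
open Graph public

Orientation : {n : ℕ} → List (Fin n × Fin n) → List (Fin n × Fin n) → Set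
Orientation E D = Pointwise (λ e d → d ≡ e ⊎ d ≡ P.swap e) E D

outdeg : {n : ℕ} → List (Fin n × Fin n) → Fin n → ℕ
outdeg D v = length (filter (λ a → proj₁ a ≟ v) D)

indeg : {n : ℕ} → List (Fin n × Fin n) → Fin n → ℕ
indeg D v = length (filter (λ a → proj₂ a ≟ v) D)

HasNZ3Flow : (n : ℕ) → List (Fin n × Fin n) → Set
HasNZ3Flow n E = Σ (List (Fin n × Fin n)) λ D →
  Orientation E D × (∀ (v : Fin n) → outdeg D v % 3 ≡ indeg D v % 3)

deg : (G : Graph) → Fin (n G) → ℕ
deg G v = outdeg (edges G) v + indeg (edges G) v
  where open import Data.Nat using (_+_)

-- A partition of V(G) into k (nonempty) parts, given by a surjection onto Fin k.
-- G/P: identify vertices in the same part and delete the resulting loops.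
quotientEdges : {n k : ℕ} → (Fin n → Fin k) → List (Fin n × Fin n) → List (Fin k × Fin k)
quotientEdges p E =
  filter (λ e → ¬? (proj₁ e ≟ proj₂ e)) (map (λ e → p (proj₁ e) , p (proj₂ e)) E)

NonTrivial : {n k : ℕ} → (Fin n → Fin k) → Set
NonTrivial {n} p = ∃[ u ] ∃[ v ] (u ≢ v × p u ≡ p v)

FlowCritical : Graph → Set
FlowCritical G =
  ¬ HasNZ3Flow (n G) (edges G) ×
  (∀ (k : ℕ) (p : Fin (n G) → Fin k) → Surjective _≡_ _≡_ p → NonTrivial p →
     HasNZ3Flow k (quotientEdges p (edges G)))

{-# OPTIONS --safe #-}

-- Let B be a smallest vertex set with |B| ≥ 2 that spans at least 3|B| − 4 edges. Every proper subset X
-- spans at most 3|X| − 3 edges. A flow of G/B, which exists by criticality, prescribes boundaries at the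
-- vertices of B, and it remains to orient the edges inside B accordingly. Take as root z the vertex of
-- degree at least 7, if it lies in B; the boundary at z comes for free. Such orientations exist by induction
-- for all prescriptions that vanish at the vertices of degree 6. A vertex of degree d ≠ 5, or of degree 5
-- with nonzero prescription, is deleted after lifting d − 3 pairs of its edges (d ≥ 3); lifts that keep the graph
-- sparse exist by uncrossing tight sets, as in Tay's construction of the graphs with three edge-disjoint
-- spanning trees. If all vertices but z have degree 5 and prescription 0, then counting shows that all
-- but two of them are adjacent to z, and two parallel edges or a suitable triangle through z can be
-- removed together with two vertices.
module Submission where

open import Defs
open import Data.Nat using (_≤_; _+_; _*_)
open import Data.Fin using (Fin)
open import Data.List using (length)
open import Relation.Binary.PropositionalEquality using (_≡_)

open import Data.Bool using (Bool; true; false; _∧_; _∨_; not; T; if_then_else_)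
import Data.Bool.Properties as Bool
open import Data.Empty using (⊥; ⊥-elim)
open import Data.Fin using (zero; suc) renaming (_≟_ to _≟ᶠ_)
open import Data.List using (List; []; _∷_; _++_; map; allFin; replicate; filter; tabulate)
import Data.List as List
import Data.List.Properties as List
open import Data.List.Membership.Propositional using (_∈_; _∉_)
open import Data.List.Membership.Propositional.Properties using (∈-allFin; ∈-filter⁺; ∈-filter⁻; ∈-lookup)
open import Data.List.Relation.Binary.Permutation.Propositional as ↭ using (_↭_; ↭-sym; ↭-trans; prep; swap)
open import Data.List.Relation.Binary.Permutation.Propositional.Properties
  using (map⁺; ↭-length; shift; ++⁺ʳ; ++-comm; All-resp-↭; ∈-resp-↭)
open import Data.List.Relation.Binary.Pointwise using ([]; _∷_)
open import Data.List.Relation.Unary.All using (All; []; _∷_)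
import Data.List.Relation.Unary.All as All
import Data.List.Relation.Unary.All.Properties as All
open import Data.List.Relation.Unary.AllPairs using ([]; _∷_)
open import Data.List.Relation.Unary.Any using (here; there)
import Data.List.Relation.Unary.Any as Any
open import Data.List.Relation.Unary.Any.Properties using (lookup-index)
open import Data.List.Relation.Unary.Unique.Propositional using (Unique)
import Data.List.Relation.Unary.Unique.Propositional.Properties as Unique
open import Data.Nat using (ℕ; zero; suc; _%_; _<_; s≤s; z≤n; _≤ᵇ_; _≟_; _≤?_)
open import Data.Nat.ListAction using (sum)
open import Data.Nat.ListAction.Properties using (sum-++; sum-↭)
open import Data.Nat.Properties
open import Algebra.Properties.CommutativeSemigroup +-commutativeSemigroup using (interchange)
open import Data.Product using (_×_; _,_; proj₁; proj₂; ∃; ∃₂; Σ-syntax)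
import Data.Product as Prod
open import Data.Sum using (_⊎_; inj₁; inj₂; [_,_]′)
open import Data.Unit using (⊤; tt)
open import Data.Vec using (Vec; []; _∷_)
import Data.Vec as Vec
import Data.Vec.N-ary as NAry
import Data.Vec.Properties as Vec
open import Function using (_∘_; id; case_of_; Surjective)
open import Relation.Binary.PropositionalEquality
open import Relation.Nullary using (Dec; yes; no; ¬_; does; contradiction)
open import Relation.Nullary.Decidable
  using (dec-true; dec-false; decidable-stable; toWitness; _→-dec_; _×-dec_)

-- Lifting d - 3 pairs at a vertex of degree d ≥ 3 and deleting it costs exactly three edges, so the
-- count 3|W| - 4 survives. The pairs use 2d - 6 of the d edges, which requires d ≤ 6: a vertex of
-- higher degree cannot be treated and has to be the root, and there is a single root because only
-- one boundary comes for free. The 6 - d edges that are not lifted must produce the prescription.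
-- Two or more produce everything, one produces 1 and 2 but not 0, none produces only 0; hence the
-- exceptions at degrees 5 and 6. The restriction at degree 6 reproduces itself: a vertex at an edge
-- that has received its direction has lost degree, and every other vertex keeps its prescription.
-- The same reason provides it at the start, where the vertices of `B` other than the root have
-- degree at most 6 in the whole graph. Zero prescriptions at degree 5 cannot be excluded in this
-- way, hence the separate reductions that remove two vertices. Extremal vertex sets are only shown
-- to exist under double negation; this suffices, as solvability serves to reach a contradiction and
-- the final inequality is decidable.

private variable
  A A′ : Set
  ν : ℕ

-- Linear arithmetic

-- By reflection: a sequent is accepted when its goal follows, by comparing coefficients, from the sum
-- of its hypotheses; c ⨾ h counts h with multiplicity c. An equation used as :≡ bounds its left side by
-- its right side, and one used as :≡˘ conversely.

data Lin (k : ℕ) : Set where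
  con  : ℕ → Lin k
  var  : Fin k → Lin k
  _:+_ : Lin k → Lin k → Lin k
  _:*_ : ℕ → Lin k → Lin k

infixl 7 _:*_
infixl 6 _:+_
infix  4 _:≤_ _:≡_ _:≡˘_
infixr 8 _⨾_
infix  3 _⊢_

data Hyp (k : ℕ) : Set where
  _:≤_ _:≡_ _:≡˘_ : Lin k → Lin k → Hyp k
  _⨾_             : ℕ → Hyp k → Hyp k

data Sequent (k : ℕ) : Set where
  _⊢_ : List (Hyp k) → Hyp k → Sequent k

module _ {k : ℕ} where

  eval : Vec ℕ k → Lin k → ℕ
  eval ρ (con c)  = c
  eval ρ (var i)  = Vec.lookup ρ i
  eval ρ (l :+ r) = eval ρ l + eval ρ r
  eval ρ (c :* l) = c * eval ρ l

  Holds : Vec ℕ k → Hyp k → Set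
  Holds ρ (l :≤ r)  = eval ρ l ≤ eval ρ r
  Holds ρ (l :≡ r)  = eval ρ l ≡ eval ρ r
  Holds ρ (l :≡˘ r) = eval ρ l ≡ eval ρ r
  Holds ρ (c ⨾ h)   = Holds ρ h

  HoldAll : Vec ℕ k → List (Hyp k) → Set
  HoldAll ρ []       = ⊤
  HoldAll ρ (h ∷ []) = Holds ρ h
  HoldAll ρ (h ∷ hs@(_ ∷ _)) = Holds ρ h × HoldAll ρ hs

  sides : Hyp k → Lin k × Lin k
  sides (l :≤ r)  = l , r
  sides (l :≡ r)  = l , r
  sides (l :≡˘ r) = r , l
  sides (c ⨾ h)   = let l , r = sides h in c :* l , c :* r

  sides-≤ : ∀ ρ h → Holds ρ h → eval ρ (proj₁ (sides h)) ≤ eval ρ (proj₂ (sides h))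
  sides-≤ ρ (l :≤ r)  p = p
  sides-≤ ρ (l :≡ r)  p = ≤-reflexive p
  sides-≤ ρ (l :≡˘ r) p = ≤-reflexive (sym p)
  sides-≤ ρ (c ⨾ h)   p = *-monoʳ-≤ c (sides-≤ ρ h p)

  total : List (Hyp k) → Lin k × Lin k
  total []       = con 0 , con 0
  total (h ∷ hs) = let l , r = sides h ; L , R = total hs in l :+ L , r :+ R

  total-≤ : ∀ ρ hs → HoldAll ρ hs → eval ρ (proj₁ (total hs)) ≤ eval ρ (proj₂ (total hs))
  total-≤ ρ []                _        = z≤n
  total-≤ ρ (h ∷ [])          p        = +-mono-≤ (sides-≤ ρ h p) z≤n
  total-≤ ρ (h ∷ hs@(_ ∷ _)) (p , ps) = +-mono-≤ (sides-≤ ρ h p) (total-≤ ρ hs ps)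

  Coeffs : Set
  Coeffs = ℕ × Vec ℕ k

  dot : ∀ {m} → Vec ℕ m → Vec ℕ m → ℕ
  dot []       []       = 0
  dot (c ∷ cs) (x ∷ xs) = c * x + dot cs xs

  unit : ∀ {m} → Fin m → Vec ℕ m
  unit zero    = 1 ∷ Vec.replicate _ 0
  unit (suc i) = 0 ∷ unit i

  coeffs : Lin k → Coeffs
  coeffs (con c)  = c , Vec.replicate _ 0
  coeffs (var i)  = 0 , unit i
  coeffs (l :+ r) = let a , as = coeffs l ; b , bs = coeffs r in a + b , Vec.zipWith _+_ as bs
  coeffs (c :* l) = let a , as = coeffs l in c * a , Vec.map (c *_) as

  dot-0 : ∀ {m} (xs : Vec ℕ m) → dot (Vec.replicate _ 0) xs ≡ 0
  dot-0 []       = refl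
  dot-0 (x ∷ xs) = dot-0 xs

  dot-unit : ∀ {m} (i : Fin m) xs → dot (unit i) xs ≡ Vec.lookup xs i
  dot-unit zero    (x ∷ xs) = trans (cong₂ _+_ (+-identityʳ x) (dot-0 xs)) (+-identityʳ x)
  dot-unit (suc i) (x ∷ xs) = dot-unit i xs

  dot-+ : ∀ {m} (as bs xs : Vec ℕ m) → dot (Vec.zipWith _+_ as bs) xs ≡ dot as xs + dot bs xs
  dot-+ []       []       []       = refl
  dot-+ (a ∷ as) (b ∷ bs) (x ∷ xs) =
    trans (cong₂ _+_ (*-distribʳ-+ x a b) (dot-+ as bs xs)) (interchange (a * x) (b * x) _ _)

  dot-* : ∀ {m} c (as xs : Vec ℕ m) → dot (Vec.map (c *_) as) xs ≡ c * dot as xs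
  dot-* c []       []       = sym (*-zeroʳ c)
  dot-* c (a ∷ as) (x ∷ xs) =
    trans (cong₂ _+_ (*-assoc c a x) (dot-* c as xs)) (sym (*-distribˡ-+ c (a * x) _))

  value : Vec ℕ k → Coeffs → ℕ
  value ρ (c , cs) = c + dot cs ρ

  coeffs-correct : ∀ ρ l → value ρ (coeffs l) ≡ eval ρ l
  coeffs-correct ρ (con c)  = trans (cong (c +_) (dot-0 ρ)) (+-identityʳ c)
  coeffs-correct ρ (var i)  = dot-unit i ρ
  coeffs-correct ρ (l :+ r) = let a , as = coeffs l ; b , bs = coeffs r in
    trans (cong (a + b +_) (dot-+ as bs ρ))
      (trans (interchange a b _ _) (cong₂ _+_ (coeffs-correct ρ l) (coeffs-correct ρ r)))
  coeffs-correct ρ (c :* l) = let a , as = coeffs l in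
    trans (cong (c * a +_) (dot-* c as ρ))
      (trans (sym (*-distribˡ-+ c a _)) (cong (c *_) (coeffs-correct ρ l)))

  leq : ∀ {m} → Vec ℕ m → Vec ℕ m → Bool
  leq []       []       = true
  leq (a ∷ as) (b ∷ bs) = (a ≤ᵇ b) ∧ leq as bs

  leqᶜ : Coeffs → Coeffs → Bool
  leqᶜ (a , as) (b , bs) = (a ≤ᵇ b) ∧ leq as bs

  T-∧ˡ : ∀ {a b} → T (a ∧ b) → T a
  T-∧ˡ {true} _ = tt

  T-∧ʳ : ∀ {a b} → T (a ∧ b) → T b
  T-∧ʳ {true} p = p

  leq-dot : ∀ {m} (as bs xs : Vec ℕ m) → T (leq as bs) → dot as xs ≤ dot bs xs
  leq-dot []       []       []       _ = z≤n
  leq-dot (a ∷ as) (b ∷ bs) (x ∷ xs) t = +-mono-≤ (*-monoˡ-≤ x (≤ᵇ⇒≤ a b (T-∧ˡ t)))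
    (leq-dot as bs xs (T-∧ʳ {a = a ≤ᵇ b} t))

  leqᶜ-value : ∀ ρ a b → T (leqᶜ a b) → value ρ a ≤ value ρ b
  leqᶜ-value ρ (a , as) (b , bs) t =
    +-mono-≤ (≤ᵇ⇒≤ a b (T-∧ˡ t)) (leq-dot as bs ρ (T-∧ʳ {a = a ≤ᵇ b} t))

  -- With `L` ≤ `R` the sum of the hypotheses, l + R ≤ r + L gives the goal by cancellation. Adding
  -- on both sides avoids subtraction, which would truncate in `ℕ`.
  follows : List (Hyp k) → Lin k → Lin k → Bool
  follows hs l r = let L , R = total hs in leqᶜ (coeffs (l :+ R)) (coeffs (r :+ L))

  follows-≤ : ∀ ρ hs l r → T (follows hs l r) → HoldAll ρ hs → eval ρ l ≤ eval ρ r
  follows-≤ ρ hs l r t ps = +-cancelʳ-≤ (eval ρ R) _ _ (begin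
    eval ρ l + eval ρ R          ≡⟨ coeffs-correct ρ (l :+ R) ⟨
    value ρ (coeffs (l :+ R))    ≤⟨ leqᶜ-value ρ (coeffs (l :+ R)) (coeffs (r :+ L)) t ⟩
    value ρ (coeffs (r :+ L))    ≡⟨ coeffs-correct ρ (r :+ L) ⟩
    eval ρ r + eval ρ L          ≤⟨ +-monoʳ-≤ (eval ρ r) (total-≤ ρ hs ps) ⟩
    eval ρ r + eval ρ R          ∎)
    where open ≤-Reasoning
          L = proj₁ (total hs)
          R = proj₂ (total hs)

  -- An equational goal is proved as two inequalities, and the second one needs every equation among
  -- the hypotheses in the opposite direction.
  flip : Hyp k → Hyp k
  flip (l :≤ r)  = l :≤ r
  flip (l :≡ r)  = l :≡˘ r
  flip (l :≡˘ r) = l :≡ r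
  flip (c ⨾ h)   = c ⨾ flip h

  flip-holds : ∀ ρ h → Holds ρ h → Holds ρ (flip h)
  flip-holds ρ (l :≤ r)  p = p
  flip-holds ρ (l :≡ r)  p = p
  flip-holds ρ (l :≡˘ r) p = p
  flip-holds ρ (c ⨾ h)   p = flip-holds ρ h p

  flip-holdAll : ∀ ρ hs → HoldAll ρ hs → HoldAll ρ (List.map flip hs)
  flip-holdAll ρ []                _        = tt
  flip-holdAll ρ (h ∷ [])          p        = flip-holds ρ h p
  flip-holdAll ρ (h ∷ hs@(_ ∷ _)) (p , ps) = flip-holds ρ h p , flip-holdAll ρ hs ps

  check : Sequent k → Bool
  check (hs ⊢ l :≤ r)   = follows hs l r
  check (hs ⊢ l :≡ r)   = follows hs l r ∧ follows (List.map flip hs) r l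
  check (hs ⊢ _)        = false

  Valid : Vec ℕ k → Sequent k → Set
  Valid ρ (hs ⊢ h) = HoldAll ρ hs → Holds ρ h

  check-valid : ∀ ρ s → T (check s) → Valid ρ s
  check-valid ρ (hs ⊢ l :≤ r) t ps = follows-≤ ρ hs l r t ps
  check-valid ρ (hs ⊢ l :≡ r) t ps = ≤-antisym (follows-≤ ρ hs l r (T-∧ˡ t) ps)
    (follows-≤ ρ (List.map flip hs) r l (T-∧ʳ {a = follows hs l r} t) (flip-holdAll ρ hs ps))

-- Lets a sequent be written as a function whose arguments name the entries of `ρ`; applying it to
-- the variables yields the syntax to be checked.
close : ∀ {k} {A : Set} → NAry.N-ary k (Lin k) A → A
close {k} f = f NAry.$ⁿ Vec.map var (Vec.allFin k)

lin : ∀ {k} (ρ : Vec ℕ k) (f : NAry.N-ary k (Lin k) (Sequent k)) →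
      {T (check (close f))} → Valid ρ (close f)
lin ρ f {t} = check-valid ρ (close f) t

lin⊥ : ∀ {k} (ρ : Vec ℕ k) (f : NAry.N-ary k (Lin k) (List (Hyp k))) →
       {T (check (close f ⊢ con 1 :≤ con 0))} → HoldAll ρ (close f) → ⊥
lin⊥ ρ f {t} ps with () ← check-valid ρ (close f ⊢ con 1 :≤ con 0) t ps

-- Finite sums and linear relations between them

∑ : (A → ℕ) → List A → ℕ
∑ f l = sum (map f l)

∑-mono : ∀ {f g : A → ℕ} l → (∀ x → x ∈ l → f x ≤ g x) → ∑ f l ≤ ∑ g l
∑-mono []      h = z≤n
∑-mono (x ∷ l) h = +-mono-≤ (h x (here refl)) (∑-mono l λ y → h y ∘ there)

∑-cong : ∀ {f g : A → ℕ} l → (∀ x → x ∈ l → f x ≡ g x) → ∑ f l ≡ ∑ g l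
∑-cong l h = ≤-antisym (∑-mono l λ x i → ≤-reflexive (h x i)) (∑-mono l λ x i → ≤-reflexive (sym (h x i)))

∑-++ : ∀ (f : A → ℕ) l m → ∑ f (l ++ m) ≡ ∑ f l + ∑ f m
∑-++ f l m = trans (cong sum (List.map-++ f l m)) (sum-++ (map f l) (map f m))

∑-↭ : ∀ (f : A → ℕ) {l m} → l ↭ m → ∑ f l ≡ ∑ f m
∑-↭ f p = sum-↭ (map⁺ f p)

∑-map : ∀ (f : A′ → ℕ) (g : A → A′) l → ∑ f (map g l) ≡ ∑ (f ∘ g) l
∑-map f g l = cong sum (sym (List.map-∘ l))

∑-+ : ∀ (f g : A → ℕ) l → ∑ (λ x → f x + g x) l ≡ ∑ f l + ∑ g l
∑-+ f g []      = refl
∑-+ f g (x ∷ l) = lin (f x ∷ g x ∷ ∑ f l ∷ ∑ g l ∷ ∑ (λ x → f x + g x) l ∷ [])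
  (λ a b c d e → (e :≡ c :+ d) ∷ [] ⊢ (a :+ b) :+ e :≡ (a :+ c) :+ (b :+ d)) (∑-+ f g l)

∑-* : ∀ c (f : A → ℕ) l → ∑ (λ x → c * f x) l ≡ c * ∑ f l
∑-* c f []      = sym (*-zeroʳ c)
∑-* c f (x ∷ l) = trans (cong (c * f x +_) (∑-* c f l)) (sym (*-distribˡ-+ c (f x) _))

∑-0 : ∀ (l : List A) → ∑ (λ _ → 0) l ≡ 0
∑-0 []      = refl
∑-0 (x ∷ l) = ∑-0 l

∑-1 : ∀ (l : List A) → ∑ (λ _ → 1) l ≡ length l
∑-1 []      = refl
∑-1 (x ∷ l) = cong suc (∑-1 l)

∑-swap : ∀ (f : A → A′ → ℕ) l m → ∑ (λ x → ∑ (f x) m) l ≡ ∑ (λ y → ∑ (λ x → f x y) l) m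
∑-swap f []      m = sym (∑-0 m)
∑-swap f (x ∷ l) m = trans (cong (∑ (f x) m +_) (∑-swap f l m)) (sym (∑-+ (f x) _ m))

module _ {k : ℕ} where

  -- Summation multiplies a constant by the length of the list, so only relations free of constants
  -- pass from the summands to the sums.
  Homogeneous : Lin k → Set
  Homogeneous (con c)  = ⊥
  Homogeneous (var i)  = ⊤
  Homogeneous (l :+ r) = Homogeneous l × Homogeneous r
  Homogeneous (c :* l) = Homogeneous l

  Homogeneousʰ : Hyp k → Set
  Homogeneousʰ (l :≤ r) = Homogeneous l × Homogeneous r
  Homogeneousʰ (l :≡ r) = Homogeneous l × Homogeneous r
  Homogeneousʰ _        = ⊥

  at : Vec (A → ℕ) k → A → Vec ℕ k
  at fs x = Vec.map (λ f → f x) fs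

  sums : Vec (A → ℕ) k → List A → Vec ℕ k
  sums fs l = Vec.map (λ f → ∑ f l) fs

  eval-∑ : ∀ (fs : Vec (A → ℕ) k) l e → Homogeneous e → eval (sums fs l) e ≡ ∑ (λ x → eval (at fs x) e) l
  eval-∑ fs l (var i) _ = trans (Vec.lookup-map i _ fs)
    (∑-cong l λ x _ → sym (Vec.lookup-map i _ fs))
  eval-∑ fs l (e :+ e′) (h , h′) =
    trans (cong₂ _+_ (eval-∑ fs l e h) (eval-∑ fs l e′ h′)) (sym (∑-+ _ _ l))
  eval-∑ fs l (c :* e) h = trans (cong (c *_) (eval-∑ fs l e h)) (sym (∑-* c _ l))

  ∑-holds : ∀ (fs : Vec (A → ℕ) k) l h → Homogeneousʰ h →
            (∀ x → x ∈ l → Holds (at fs x) h) → Holds (sums fs l) h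
  ∑-holds fs l (a :≤ b) (ha , hb) p =
    subst₂ _≤_ (sym (eval-∑ fs l a ha)) (sym (eval-∑ fs l b hb)) (∑-mono l p)
  ∑-holds fs l (a :≡ b) (ha , hb) p =
    trans (eval-∑ fs l a ha) (trans (∑-cong l p) (sym (eval-∑ fs l b hb)))

  ∑-lin : ∀ (fs : Vec (A → ℕ) k) (f : NAry.N-ary k (Lin k) (Hyp k)) l → {Homogeneousʰ (close f)} →
          (∀ x → x ∈ l → Holds (at fs x) (close f)) → Holds (sums fs l) (close f)
  ∑-lin fs f l {h} = ∑-holds fs l (close f) h

-- Booleans as indicators

⟦_⟧ : Bool → ℕ
⟦ true ⟧  = 1
⟦ false ⟧ = 0

-- Makes statements about finitely many Booleans provable by evaluation. Most of the local facts
-- called `taut` are inequalities for a single edge or vertex proved like this and then summed by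
-- `∑-lin`.
∀ᵇ : ∀ {P : Bool → Set} → (∀ b → Dec (P b)) → Dec (∀ b → P b)
∀ᵇ P? with P? true | P? false
... | yes p | yes q = yes λ { true → p ; false → q }
... | no ¬p | _     = no λ h → ¬p (h true)
... | _     | no ¬q = no λ h → ¬q (h false)

∧-trueˡ : ∀ {a b} → a ∧ b ≡ true → a ≡ true
∧-trueˡ {true} _ = refl

∧-trueʳ : ∀ {a b} → a ∧ b ≡ true → b ≡ true
∧-trueʳ {true} p = p

true≢false : ∀ {b} → b ≡ true → b ≡ false → ⊥
true≢false refl ()

_==_ : Fin ν → Fin ν → Bool
a == b = does (a ≟ᶠ b)

==-refl : ∀ (a : Fin ν) → (a == a) ≡ true
==-refl a = dec-true (a ≟ᶠ a) refl

==⇒≡ : ∀ {a b : Fin ν} → (a == b) ≡ true → a ≡ b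
==⇒≡ {a = a} {b} p with a ≟ᶠ b
... | yes q = q

≢⇒== : ∀ {a b : Fin ν} → a ≢ b → (a == b) ≡ false
≢⇒== {a = a} {b} = dec-false (a ≟ᶠ b)

==-sym : ∀ (a b : Fin ν) → (a == b) ≡ (b == a)
==-sym a b with a ≟ᶠ b
... | yes refl = sym (==-refl a)
... | no a≢b   = sym (≢⇒== (a≢b ∘ sym))

-- Sets of vertices

VSet : ℕ → Set
VSet ν = Fin ν → Bool

∁ : VSet ν → VSet ν
∁ X v = not (X v)

infixl 6 _∪_ _∖_
infixl 7 _∩_

_∩_ _∪_ _∖_ : VSet ν → VSet ν → VSet ν
(X ∩ Y) v = X v ∧ Y v
(X ∪ Y) v = X v ∨ Y v
(X ∖ Y) v = X v ∧ not (Y v)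

⁅_⁆ : Fin ν → VSet ν
⁅ a ⁆ v = a == v

card : VSet ν → ℕ
card {ν} X = ∑ (λ v → ⟦ X v ⟧) (allFin ν)

∑-tabulate : ∀ (f : A → ℕ) (g : Fin ν → A) → ∑ f (tabulate g) ≡ ∑ (f ∘ g) (allFin ν)
∑-tabulate f g = trans (cong (∑ f) (sym (List.map-tabulate id g))) (∑-map f g (allFin _))

∑-δ : ∀ (a : Fin ν) (f : Fin ν → ℕ) → ∑ (λ v → ⟦ a == v ⟧ * f v) (allFin ν) ≡ f a
∑-δ {suc ν} zero    f = begin
  f zero + 0 + ∑ F (tabulate suc) ≡⟨ cong (f zero + 0 +_) (trans (∑-tabulate F suc) (∑-0 (allFin ν))) ⟩
  f zero + 0 + 0                  ≡⟨ trans (+-identityʳ _) (+-identityʳ _) ⟩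
  f zero                          ∎
  where open ≡-Reasoning
        F : Fin (suc ν) → ℕ
        F v = ⟦ zero == v ⟧ * f v
∑-δ {suc ν} (suc a) f = trans (∑-tabulate (λ v → ⟦ suc a == v ⟧ * f v) suc) (∑-δ a (f ∘ suc))

card-⁅⁆ : ∀ (a : Fin ν) → card ⁅ a ⁆ ≡ 1
card-⁅⁆ {ν} a = trans (∑-cong (allFin ν) λ v _ → sym (*-identityʳ _)) (∑-δ a (λ _ → 1))

-- Edge lists up to reordering and reversing edges

Edge : ℕ → Set
Edge ν = Fin ν × Fin ν

data _≋_ {ν} : List (Edge ν) → List (Edge ν) → Set where
  ≋-refl  : ∀ {E} → E ≋ E
  ≋-prep  : ∀ e {E F} → E ≋ F → (e ∷ E) ≋ (e ∷ F)
  ≋-rev   : ∀ {a b E} → ((a , b) ∷ E) ≋ ((b , a) ∷ E)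
  ≋-swap  : ∀ {e f E} → (e ∷ f ∷ E) ≋ (f ∷ e ∷ E)
  ≋-trans : ∀ {E F G} → E ≋ F → F ≋ G → E ≋ G

infix 4 _≋_

≋-sym : ∀ {E F : List (Edge ν)} → E ≋ F → F ≋ E
≋-sym ≋-refl        = ≋-refl
≋-sym (≋-prep e p)  = ≋-prep e (≋-sym p)
≋-sym ≋-rev         = ≋-rev
≋-sym ≋-swap        = ≋-swap
≋-sym (≋-trans p q) = ≋-trans (≋-sym q) (≋-sym p)

≡⇒≋ : ∀ {E F : List (Edge ν)} → E ≡ F → E ≋ F
≡⇒≋ refl = ≋-refl

↭⇒≋ : ∀ {E F : List (Edge ν)} → E ↭ F → E ≋ F
↭⇒≋ ↭.refl        = ≋-refl
↭⇒≋ (prep e p)    = ≋-prep e (↭⇒≋ p)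
↭⇒≋ (swap e f p)  = ≋-trans ≋-swap (≋-prep f (≋-prep e (↭⇒≋ p)))
↭⇒≋ (↭.trans p q) = ≋-trans (↭⇒≋ p) (↭⇒≋ q)

∑ᵉ : (Fin ν → Fin ν → ℕ) → List (Edge ν) → ℕ
∑ᵉ w = ∑ λ e → w (proj₁ e) (proj₂ e)

Symmetric : (Fin ν → Fin ν → ℕ) → Set
Symmetric w = ∀ a b → w a b ≡ w b a

∑ᵉ-≋ : ∀ {w : Fin ν → Fin ν → ℕ} → Symmetric w → ∀ {E F} → E ≋ F → ∑ᵉ w E ≡ ∑ᵉ w F
∑ᵉ-≋ sy ≋-refl = refl
∑ᵉ-≋ {w = w} sy (≋-prep (a , b) p) = cong (w a b +_) (∑ᵉ-≋ sy p)
∑ᵉ-≋ {w = w} sy (≋-rev {a} {b} {E}) = cong (_+ ∑ᵉ w E) (sy a b)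
∑ᵉ-≋ {w = w} sy (≋-swap {a , b} {c , d} {E}) = lin (w a b ∷ w c d ∷ ∑ᵉ w E ∷ [])
  (λ x y s → [] ⊢ x :+ (y :+ s) :≡ y :+ (x :+ s)) tt
∑ᵉ-≋ sy (≋-trans p q) = trans (∑ᵉ-≋ sy p) (∑ᵉ-≋ sy q)

length-≋ : ∀ {E F : List (Edge ν)} → E ≋ F → length E ≡ length F
length-≋ {E = E} {F} p = trans (sym (∑-1 E)) (trans (∑ᵉ-≋ (λ _ _ → refl) p) (∑-1 F))

star : Fin ν → List (Fin ν) → List (Edge ν)
star v C = map (v ,_) C

∑ᵉ-star : ∀ (w : Fin ν → Fin ν → ℕ) v C → ∑ᵉ w (star v C) ≡ ∑ (w v) C
∑ᵉ-star w v C = ∑-map (λ e → w (proj₁ e) (proj₂ e)) (v ,_) C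

Avoids : Fin ν → Edge ν → Set
Avoids v (a , b) = a ≢ v × b ≢ v

++⁺ʳ-≋ : ∀ (G : List (Edge ν)) {E F} → E ≋ F → G ++ E ≋ G ++ F
++⁺ʳ-≋ []      p = p
++⁺ʳ-≋ (e ∷ G) p = ≋-prep e (++⁺ʳ-≋ G p)

shift-≋ : ∀ (e : Edge ν) G {E} → e ∷ (G ++ E) ≋ G ++ e ∷ E
shift-≋ e []      = ≋-refl
shift-≋ e (f ∷ G) = ≋-trans ≋-swap (≋-prep f (shift-≋ e G))

star-↭ : ∀ (v : Fin ν) {C C′} R → C ↭ C′ → star v C ++ R ≋ star v C′ ++ R
star-↭ v R ↭.refl = ≋-refl
star-↭ v R (prep c p) = ≋-prep (v , c) (star-↭ v R p)
star-↭ v R (swap c d p) = ≋-trans ≋-swap (≋-prep (v , d) (≋-prep (v , c) (star-↭ v R p)))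
star-↭ v R (↭.trans p q) = ≋-trans (star-↭ v R p) (star-↭ v R q)

extract : ∀ (v : Fin ν) E → ∃₂ λ C R → E ≋ star v C ++ R × All (Avoids v) R
extract v [] = [] , [] , ≋-refl , []
extract v ((a , b) ∷ E) with extract v E | a ≟ᶠ v | b ≟ᶠ v
... | C , R , p , av | yes refl | _        = b ∷ C , R , ≋-prep _ p , av
... | C , R , p , av | no _     | yes refl = a ∷ C , R , ≋-trans ≋-rev (≋-prep _ p) , av
... | C , R , p , av | no a≢v   | no b≢v   =
  C , (a , b) ∷ R , ≋-trans (≋-prep _ p) (shift-≋ _ (star v C)) , (a≢v , b≢v) ∷ av

inside : VSet ν → Fin ν → Fin ν → ℕ
inside X a b = ⟦ X a ∧ X b ⟧

touching : Fin ν → Fin ν → Fin ν → ℕ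
touching v a b = ⟦ v == a ⟧ + ⟦ v == b ⟧

joining : Fin ν → Fin ν → Fin ν → Fin ν → ℕ
joining x y a b = ⟦ ((x == a) ∧ (y == b)) ∨ ((y == a) ∧ (x == b)) ⟧

e[_] : VSet ν → List (Edge ν) → ℕ
e[ X ] = ∑ᵉ (inside X)

degree : Fin ν → List (Edge ν) → ℕ
degree v = ∑ᵉ (touching v)

mult : Fin ν → Fin ν → List (Edge ν) → ℕ
mult x y = ∑ᵉ (joining x y)

inside-sym : ∀ (X : VSet ν) → Symmetric (inside X)
inside-sym X a b = cong ⟦_⟧ (Bool.∧-comm (X a) (X b))

touching-sym : ∀ (v : Fin ν) → Symmetric (touching v)
touching-sym v a b = +-comm ⟦ v == a ⟧ ⟦ v == b ⟧

joining-sym : ∀ (x y : Fin ν) → Symmetric (joining x y)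
joining-sym x y a b = cong ⟦_⟧ (trans (Bool.∨-comm ((x == a) ∧ (y == b)) _)
  (cong₂ _∨_ (Bool.∧-comm (y == a) (x == b)) (Bool.∧-comm (x == a) (y == b))))

-- The difference of the two sides is the number of edges between `X ∖ Y` and `Y ∖ X`.
supermodular : ∀ (X Y : VSet ν) E → e[ X ] E + e[ Y ] E ≤ e[ X ∪ Y ] E + e[ X ∩ Y ] E
supermodular X Y E = ∑-lin
  (on X ∷ on Y ∷ on (X ∪ Y) ∷ on (X ∩ Y) ∷ [])
  (λ a b c d → a :+ b :≤ c :+ d) E λ (a , b) _ → taut (X a) (Y a) (X b) (Y b)
  where
  on : VSet _ → Edge _ → ℕ
  on X (a , b) = inside X a b
  taut : ∀ x y x′ y′ → ⟦ x ∧ x′ ⟧ + ⟦ y ∧ y′ ⟧ ≤ ⟦ (x ∨ y) ∧ (x′ ∨ y′) ⟧ + ⟦ (x ∧ y) ∧ (x′ ∧ y′) ⟧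
  taut = toWitness {a? = ∀ᵇ λ x → ∀ᵇ λ y → ∀ᵇ λ x′ → ∀ᵇ λ y′ → _ ≤? _} tt

modular : ∀ (X Y : VSet ν) (C : List (Fin ν)) →
  ∑ (⟦_⟧ ∘ X) C + ∑ (⟦_⟧ ∘ Y) C ≡ ∑ (⟦_⟧ ∘ (X ∪ Y)) C + ∑ (⟦_⟧ ∘ (X ∩ Y)) C
modular X Y C = ∑-lin (⟦_⟧ ∘ X ∷ ⟦_⟧ ∘ Y ∷ ⟦_⟧ ∘ (X ∪ Y) ∷ ⟦_⟧ ∘ (X ∩ Y) ∷ [])
  (λ a b c d → a :+ b :≡ c :+ d) C λ v _ → taut (X v) (Y v)
  where
  taut : ∀ x y → ⟦ x ⟧ + ⟦ y ⟧ ≡ ⟦ x ∨ y ⟧ + ⟦ x ∧ y ⟧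
  taut = toWitness {a? = ∀ᵇ λ x → ∀ᵇ λ y → _ ≟ _} tt

-- Arithmetic modulo 3

data ℤ₃ : Set where
  𝟘 𝟙 𝟚 : ℤ₃

infixl 6 _⊕_ _⊖_

_⊕_ : ℤ₃ → ℤ₃ → ℤ₃
𝟘 ⊕ y = y
x ⊕ 𝟘 = x
𝟙 ⊕ 𝟙 = 𝟚
𝟙 ⊕ 𝟚 = 𝟘
𝟚 ⊕ 𝟙 = 𝟘
𝟚 ⊕ 𝟚 = 𝟙

neg : ℤ₃ → ℤ₃
neg 𝟘 = 𝟘
neg 𝟙 = 𝟚
neg 𝟚 = 𝟙

_⊖_ : ℤ₃ → ℤ₃ → ℤ₃
x ⊖ y = x ⊕ neg y

_≟₃_ : (x y : ℤ₃) → Dec (x ≡ y)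
𝟘 ≟₃ 𝟘 = yes refl
𝟘 ≟₃ 𝟙 = no λ ()
𝟘 ≟₃ 𝟚 = no λ ()
𝟙 ≟₃ 𝟘 = no λ ()
𝟙 ≟₃ 𝟙 = yes refl
𝟙 ≟₃ 𝟚 = no λ ()
𝟚 ≟₃ 𝟘 = no λ ()
𝟚 ≟₃ 𝟙 = no λ ()
𝟚 ≟₃ 𝟚 = yes refl

∀₃ : ∀ {P : ℤ₃ → Set} → (∀ x → Dec (P x)) → Dec (∀ x → P x)
∀₃ P? with P? 𝟘 | P? 𝟙 | P? 𝟚
... | yes p | yes q | yes r = yes λ { 𝟘 → p ; 𝟙 → q ; 𝟚 → r }
... | no ¬p | _     | _     = no λ h → ¬p (h 𝟘)
... | _     | no ¬q | _     = no λ h → ¬q (h 𝟙)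
... | _     | _     | no ¬r = no λ h → ¬r (h 𝟚)

⊖-swap : ∀ x y z → x ⊖ y ⊖ z ≡ x ⊖ z ⊖ y
⊖-swap = toWitness {a? = ∀₃ λ x → ∀₃ λ y → ∀₃ λ z → _ ≟₃ _} tt

⊕-identityʳ : ∀ x → x ⊕ 𝟘 ≡ x
⊕-identityʳ = toWitness {a? = ∀₃ λ x → _ ≟₃ _} tt

⊖-⊕ : ∀ x y → x ⊖ y ⊕ y ≡ x
⊖-⊕ = toWitness {a? = ∀₃ λ x → ∀₃ λ y → _ ≟₃ _} tt

⊕-⊖ : ∀ x y → x ⊕ y ⊖ y ≡ x
⊕-⊖ = toWitness {a? = ∀₃ λ x → ∀₃ λ y → _ ≟₃ _} tt

⊕-assoc : ∀ x y z → x ⊕ (y ⊕ z) ≡ x ⊕ y ⊕ z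
⊕-assoc = toWitness {a? = ∀₃ λ x → ∀₃ λ y → ∀₃ λ z → _ ≟₃ _} tt

-- Boundaries of orientations

δ : Fin ν → Fin ν → ℤ₃
δ a v = if a == v then 𝟙 else 𝟘

δ-refl : ∀ (v : Fin ν) → δ v v ≡ 𝟙
δ-refl v rewrite ==-refl v = refl

δ-≢ : ∀ {a v : Fin ν} → a ≢ v → δ a v ≡ 𝟘
δ-≢ a≢v rewrite ≢⇒== a≢v = refl

-- Out minus in, for the edge ab directed from a to b (true) or from b to a (false).
χ : Bool → Edge ν → Fin ν → ℤ₃
χ true  (a , b) v = δ a v ⊖ δ b v
χ false (a , b) v = δ b v ⊖ δ a v

-- The boundary of the orientation is never formed: each edge takes its contribution away from `f`,
-- and nothing may be left. Edges can thus be added, moved and reversed one at a time.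
Attains : List (Edge ν) → (Fin ν → ℤ₃) → Set
Attains []      f = ∀ v → f v ≡ 𝟘
Attains (e ∷ E) f = Σ[ s ∈ Bool ] Attains E (λ v → f v ⊖ χ s e v)

attains-cong : ∀ (E : List (Edge ν)) {f g} → (∀ v → f v ≡ g v) → Attains E f → Attains E g
attains-cong []      h p       = λ v → trans (sym (h v)) (p v)
attains-cong (e ∷ E) h (s , p) = s , attains-cong E (λ v → cong (_⊖ χ s e v) (h v)) p

attains-≋ : ∀ {E F : List (Edge ν)} → E ≋ F → ∀ {f} → Attains F f → Attains E f
attains-≋ ≋-refl p = p
attains-≋ (≋-prep e q) (s , p) = s , attains-≋ q p
attains-≋ ≋-rev (true , p) = false , p
attains-≋ ≋-rev (false , p) = true , p
attains-≋ (≋-swap {E = E}) {f} (s , t , p) =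
  t , s , attains-cong E (λ v → ⊖-swap (f v) _ _) p
attains-≋ (≋-trans p q) r = attains-≋ p (attains-≋ q r)

attains-some : ∀ (E : List (Edge ν)) → ∃ (Attains E)
attains-some []      = (λ _ → 𝟘) , λ _ → refl
attains-some (e ∷ E) = let f , p = attains-some E in
  (λ v → f v ⊕ χ true e v) , true , attains-cong E (λ v → sym (⊕-⊖ (f v) _)) p

attains-avoids : ∀ {E : List (Edge ν)} {v} → All (Avoids v) E → ∀ {f} → Attains E f → f v ≡ 𝟘
attains-avoids {v = v} [] p = p v
attains-avoids {E = (a , b) ∷ E} {v} ((a≢v , b≢v) ∷ av) {f} (s , p) = begin
  f v                  ≡⟨ trans (cong (f v ⊖_) (χ≡𝟘 s)) (⊕-identityʳ (f v)) ⟨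
  f v ⊖ χ s (a , b) v  ≡⟨ attains-avoids av p ⟩
  𝟘                    ∎
  where
  open ≡-Reasoning
  χ≡𝟘 : ∀ s → χ s (a , b) v ≡ 𝟘
  χ≡𝟘 true  = cong₂ _⊖_ (δ-≢ a≢v) (δ-≢ b≢v)
  χ≡𝟘 false = cong₂ _⊖_ (δ-≢ b≢v) (δ-≢ a≢v)

attains-∷ : ∀ s (e : Edge ν) {F f} → Attains F f → Attains (e ∷ F) (λ v → f v ⊕ χ s e v)
attains-∷ s e {F} {f} p = s , attains-cong F (λ v → sym (⊕-⊖ (f v) _)) p

-- The lifted edge is replaced by the path through `v` in the same direction; its two contributions
-- at `v` cancel.
attains-lift : ∀ (v c c′ : Fin ν) {F f} → Attains ((c , c′) ∷ F) f → Attains ((v , c) ∷ (v , c′) ∷ F) f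
attains-lift v c c′ {F} {f} (true , p) =
  false , true , attains-cong F (λ w → through (f w) (δ c w) (δ c′ w) (δ v w)) p
  where
  through : ∀ x y z t → x ⊖ (y ⊖ z) ≡ x ⊖ (y ⊖ t) ⊖ (t ⊖ z)
  through = toWitness {a? = ∀₃ λ x → ∀₃ λ y → ∀₃ λ z → ∀₃ λ t → _ ≟₃ _} tt
attains-lift v c c′ {F} {f} (false , p) =
  true , false , attains-cong F (λ w → through (f w) (δ c w) (δ c′ w) (δ v w)) p
  where
  through : ∀ x y z t → x ⊖ (z ⊖ y) ≡ x ⊖ (t ⊖ y) ⊖ (z ⊖ t)
  through = toWitness {a? = ∀₃ λ x → ∀₃ λ y → ∀₃ λ z → ∀₃ λ t → _ ≟₃ _} tt

-- t is a sum of k signs ±1.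

data Reachable : ℕ → ℤ₃ → Set where
  reach₀ : Reachable 0 𝟘
  reach₁⁺ : Reachable 1 𝟙
  reach₁⁻ : Reachable 1 𝟚
  reach₂₊ : ∀ {k t} → Reachable (2 + k) t

-- Of an oriented star only its effect is kept: `t` at the centre and nothing away from centre and
-- ends. The effect at the ends is unspecified, since it is subtracted from their prescriptions
-- beforehand.
record StarBoundary (v : Fin ν) (L : List (Fin ν)) (t : ℤ₃) : Set where
  constructor starBoundary
  field
    boundary  : Fin ν → ℤ₃
    attaining : ∀ {F f} → Attains F f → Attains (star v L ++ F) (λ w → f w ⊕ boundary w)
    at-centre : boundary v ≡ t
    elsewhere : ∀ w → w ≢ v → w ∉ L → boundary w ≡ 𝟘

open StarBoundary public

star-∷ : ∀ {v c : Fin ν} {L t} s → c ≢ v → StarBoundary v L t →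
         StarBoundary v (c ∷ L) (t ⊕ (if s then 𝟙 else 𝟚))
star-∷ {v = v} {c} {L} s c≢v B = starBoundary
  (λ w → boundary B w ⊕ χ s (v , c) w)
  (λ {F} {f} p → attains-cong (star v (c ∷ L) ++ F) (λ w → sym (⊕-assoc (f w) _ _))
    (attains-∷ s (v , c) (attaining B p)))
  (cong₂ _⊕_ (at-centre B) (χ-centre s))
  (λ w w≢v w∉ → trans (cong₂ _⊕_ (elsewhere B w w≢v (w∉ ∘ there))
      (χ-else s (w≢v ∘ sym) (w∉ ∘ here ∘ sym))) refl)
  where
  χ-centre : ∀ s → χ s (v , c) v ≡ (if s then 𝟙 else 𝟚)
  χ-centre true  rewrite δ-refl v | δ-≢ c≢v = refl
  χ-centre false rewrite δ-refl v | δ-≢ c≢v = refl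
  χ-else : ∀ s {w} → v ≢ w → c ≢ w → χ s (v , c) w ≡ 𝟘
  χ-else true  v≢w c≢w rewrite δ-≢ v≢w | δ-≢ c≢w = refl
  χ-else false v≢w c≢w rewrite δ-≢ v≢w | δ-≢ c≢w = refl

-- Two signs already sum to every residue modulo 3, so each edge beyond two may have an arbitrary
-- direction.
star-boundary : ∀ {v : Fin ν} L {t} → All (_≢ v) L → Reachable (length L) t → StarBoundary v L t
star-boundary [] [] reach₀ = starBoundary (λ _ → 𝟘)
  (λ {F} {f} → attains-cong F λ w → sym (⊕-identityʳ (f w))) refl (λ _ _ _ → refl)
star-boundary (c ∷ []) (c≢v ∷ []) reach₁⁺ = star-∷ true  c≢v (star-boundary [] [] reach₀)
star-boundary (c ∷ []) (c≢v ∷ []) reach₁⁻ = star-∷ false c≢v (star-boundary [] [] reach₀)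
star-boundary (c ∷ d ∷ []) {𝟘} (c≢v ∷ h) reach₂₊ = star-∷ true  c≢v (star-boundary (d ∷ []) h reach₁⁻)
star-boundary (c ∷ d ∷ []) {𝟙} (c≢v ∷ h) reach₂₊ = star-∷ false c≢v (star-boundary (d ∷ []) h reach₁⁻)
star-boundary (c ∷ d ∷ []) {𝟚} (c≢v ∷ h) reach₂₊ = star-∷ true  c≢v (star-boundary (d ∷ []) h reach₁⁺)
star-boundary (c ∷ L@(_ ∷ _ ∷ _)) {t} (c≢v ∷ h) reach₂₊ =
  subst (StarBoundary _ _) (⊖-⊕ t 𝟙) (star-∷ true c≢v (star-boundary L {t ⊖ 𝟙} h reach₂₊))

-- Passing from `f` to `g` only transfers boundary between `x` and `y`. Such transfers arise from
-- changing edges between the two vertices and from moving an end from one to the other.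
record Shifted (x y : Fin ν) (E : List (Edge ν)) (f : Fin ν → ℤ₃) (g : Fin ν → ℤ₃) : Set where
  constructor shifted
  field
    attains  : Attains E g
    balanced : g x ⊕ g y ≡ f x ⊕ f y
    off      : ∀ w → w ≢ x → w ≢ y → g w ≡ f w

open Shifted public

χ-pair : ∀ {x y : Fin ν} s → x ≢ y → χ s (x , y) x ⊕ χ s (x , y) y ≡ 𝟘
χ-pair {x = x} {y} true  x≢y rewrite δ-refl x | δ-refl y | δ-≢ x≢y | δ-≢ (x≢y ∘ sym) = refl
χ-pair {x = x} {y} false x≢y rewrite δ-refl x | δ-refl y | δ-≢ x≢y | δ-≢ (x≢y ∘ sym) = refl

χ-off : ∀ {x y w : Fin ν} s → w ≢ x → w ≢ y → χ s (x , y) w ≡ 𝟘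
χ-off true  w≢x w≢y rewrite δ-≢ (w≢x ∘ sym) | δ-≢ (w≢y ∘ sym) = refl
χ-off false w≢x w≢y rewrite δ-≢ (w≢x ∘ sym) | δ-≢ (w≢y ∘ sym) = refl

χ-tail : ∀ s {a b : Fin ν} → a ≢ b → χ s (a , b) a ≡ (if s then 𝟙 else 𝟚)
χ-tail true  {a} {b} a≢b rewrite δ-refl a | δ-≢ (a≢b ∘ sym) = refl
χ-tail false {a} {b} a≢b rewrite δ-refl a | δ-≢ (a≢b ∘ sym) = refl

χ-head : ∀ s {a b : Fin ν} → a ≢ b → χ s (a , b) b ≡ neg (if s then 𝟙 else 𝟚)
χ-head true  {a} {b} a≢b rewrite δ-refl b | δ-≢ a≢b = refl
χ-head false {a} {b} a≢b rewrite δ-refl b | δ-≢ a≢b = refl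

-- The signs of two parallel edges can be chosen to sum to any residue. Once their old contributions
-- are taken away, giving `f₀`, they can supply the missing amount `t ⊖ f₀ x`.
parallel-shift : ∀ {x y : Fin ν} {F f} → x ≢ y → Attains ((x , y) ∷ (x , y) ∷ F) f → ∀ t →
  ∃ λ g → Shifted x y ((x , y) ∷ (x , y) ∷ F) f g × g x ≡ t
parallel-shift {x = x} {y} {F} {f} x≢y (s , s′ , p) t =
  g , shifted attained bal offs , centre
  where
  f₀ : _ → ℤ₃
  f₀ w = f w ⊖ χ s (x , y) w ⊖ χ s′ (x , y) w
  pick : ∀ t → Σ[ r ∈ Bool × Bool ] (if proj₁ r then 𝟙 else 𝟚) ⊕ (if proj₂ r then 𝟙 else 𝟚) ≡ t
  pick 𝟘 = (true , false) , refl
  pick 𝟙 = (false , false) , refl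
  pick 𝟚 = (true , true) , refl
  r r′ : Bool
  r  = proj₁ (proj₁ (pick (t ⊖ f₀ x)))
  r′ = proj₂ (proj₁ (pick (t ⊖ f₀ x)))
  g : _ → ℤ₃
  g w = f₀ w ⊕ χ r (x , y) w ⊕ χ r′ (x , y) w
  attained : Attains ((x , y) ∷ (x , y) ∷ F) g
  attained = attains-∷ r′ (x , y) {f = λ w → f₀ w ⊕ χ r (x , y) w} (attains-∷ r (x , y) {f = f₀} p)
  opp : ∀ b b′ → b ⊕ b′ ≡ 𝟘 → b ≡ neg b′
  opp = toWitness {a? = ∀₃ λ x → ∀₃ λ y → (_ ≟₃ _) →-dec (_ ≟₃ _)} tt
  regroup : ∀ a a′ b b′ c c′ d d′ e e′ → b ⊕ b′ ≡ 𝟘 → c ⊕ c′ ≡ 𝟘 → d ⊕ d′ ≡ 𝟘 → e ⊕ e′ ≡ 𝟘 →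
    (a ⊖ b ⊖ c ⊕ d ⊕ e) ⊕ (a′ ⊖ b′ ⊖ c′ ⊕ d′ ⊕ e′) ≡ a ⊕ a′
  regroup a a′ b b′ c c′ d d′ e e′ hb hc hd he
    rewrite opp b b′ hb | opp c c′ hc | opp d d′ hd | opp e e′ he = cancel a a′ b′ c′ d′ e′
    where
    cancel : ∀ a a′ b c d e →
      (a ⊖ neg b ⊖ neg c ⊕ neg d ⊕ neg e) ⊕ (a′ ⊖ b ⊖ c ⊕ d ⊕ e) ≡ a ⊕ a′
    cancel = toWitness {a? = ∀₃ λ a → ∀₃ λ a′ → ∀₃ λ b → ∀₃ λ c → ∀₃ λ d → ∀₃ λ e → _ ≟₃ _} tt
  bal : g x ⊕ g y ≡ f x ⊕ f y
  bal = regroup (f x) (f y) (χ s (x , y) x) _ (χ s′ (x , y) x) _ (χ r (x , y) x) _ (χ r′ (x , y) x) _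
    (χ-pair s x≢y) (χ-pair s′ x≢y) (χ-pair r x≢y) (χ-pair r′ x≢y)
  offs : ∀ w → w ≢ x → w ≢ y → g w ≡ f w
  offs w w≢x w≢y rewrite χ-off s w≢x w≢y | χ-off s′ w≢x w≢y | χ-off r w≢x w≢y | χ-off r′ w≢x w≢y =
    zeros (f w)
    where
    zeros : ∀ a → a ⊕ 𝟘 ⊕ 𝟘 ⊕ 𝟘 ⊕ 𝟘 ≡ a
    zeros = toWitness {a? = ∀₃ λ a → _ ≟₃ _} tt
  centre : g x ≡ t
  centre = begin
    f₀ x ⊕ χ r (x , y) x ⊕ χ r′ (x , y) x   ≡⟨ ⊕-assoc (f₀ x) _ _ ⟨
    f₀ x ⊕ (χ r (x , y) x ⊕ χ r′ (x , y) x) ≡⟨ cong (f₀ x ⊕_) (trans (cong₂ _⊕_ (χ-tail r x≢y) (χ-tail r′ x≢y)) (proj₂ (pick (t ⊖ f₀ x)))) ⟩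
    f₀ x ⊕ (t ⊖ f₀ x)                       ≡⟨ fill (f₀ x) t ⟩
    t                                       ∎
    where
    open ≡-Reasoning
    fill : ∀ a t → a ⊕ (t ⊖ a) ≡ t
    fill = toWitness {a? = ∀₃ λ a → ∀₃ λ t → _ ≟₃ _} tt

-- An edge `(x , c)` contributes as much as `(x , y)` and `(y , c)` together, so moving it while
-- keeping its direction changes the boundary by that of an edge `(x , y)`.
move-edge : ∀ {x y c : Fin ν} {F f} → x ≢ y → Attains ((x , c) ∷ F) f → ∃ (Shifted x y ((y , c) ∷ F) f)
move-edge {x = x} {y} {c} {F} {f} x≢y (s , p) =
  (λ w → f w ⊖ χ s (x , y) w) , shifted
    (s , attains-cong F (λ w → sym (through s w)) p)
    (bal (f x) (f y) _ _ (χ-pair s x≢y))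
    (λ w w≢x w≢y → trans (cong (f w ⊖_) (χ-off s w≢x w≢y)) (⊕-identityʳ (f w)))
  where
  tel : ∀ a b c d → a ⊖ (b ⊖ c) ⊖ (c ⊖ d) ≡ a ⊖ (b ⊖ d)
  tel = toWitness {a? = ∀₃ λ a → ∀₃ λ b → ∀₃ λ c → ∀₃ λ d → _ ≟₃ _} tt
  tel′ : ∀ a b c d → a ⊖ (c ⊖ b) ⊖ (d ⊖ c) ≡ a ⊖ (d ⊖ b)
  tel′ = toWitness {a? = ∀₃ λ a → ∀₃ λ b → ∀₃ λ c → ∀₃ λ d → _ ≟₃ _} tt
  through : ∀ s w → f w ⊖ χ s (x , y) w ⊖ χ s (y , c) w ≡ f w ⊖ χ s (x , c) w
  through true  w = tel  (f w) (δ x w) (δ y w) (δ c w)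
  through false w = tel′ (f w) (δ x w) (δ y w) (δ c w)
  bal : ∀ a b c d → c ⊕ d ≡ 𝟘 → a ⊖ c ⊕ (b ⊖ d) ≡ a ⊕ b
  bal = toWitness {a? = ∀₃ λ a → ∀₃ λ b → ∀₃ λ c → ∀₃ λ d → (_ ≟₃ _) →-dec (_ ≟₃ _)} tt

shifted-refl : ∀ {x y : Fin ν} {E f} → Attains E f → Shifted x y E f f
shifted-refl p = shifted p refl (λ _ _ _ → refl)

shifted-trans : ∀ {x y : Fin ν} {E F f g h} → Shifted x y E f g → Shifted x y F g h → Shifted x y F f h
shifted-trans p q = shifted (attains q) (trans (balanced q) (balanced p))
  (λ w w≢x w≢y → trans (off q w w≢x w≢y) (off p w w≢x w≢y))

move-star : ∀ {x y : Fin ν} C {F f} → x ≢ y → Attains (star x C ++ F) f → ∃ (Shifted x y (star y C ++ F) f)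
move-star []      x≢y p = _ , shifted-refl p
move-star {x = x} {y} (c ∷ C) {F} {f} x≢y (s , p) =
  let g , q  = move-star C x≢y p
      h , q′ = move-edge {f = λ w → g w ⊕ χ s (x , c) w} x≢y (attains-∷ s (x , c) {f = g} (attains q))
  in h , shifted (attains q′)
     (trans (balanced q′) (cancel (g x) (g y) (f x) (f y) (χ s (x , c) x) (χ s (x , c) y) (balanced q)))
     (λ w w≢x w≢y → trans (off q′ w w≢x w≢y) (trans (cong (_⊕ _) (off q w w≢x w≢y)) (⊖-⊕ _ _)))
  where
  cancel : ∀ g g′ f f′ a b → g ⊕ g′ ≡ f ⊖ a ⊕ (f′ ⊖ b) → g ⊕ a ⊕ (g′ ⊕ b) ≡ f ⊕ f′
  cancel = toWitness {a? = ∀₃ λ g → ∀₃ λ g′ → ∀₃ λ f → ∀₃ λ f′ → ∀₃ λ a → ∀₃ λ b → (_ ≟₃ _) →-dec (_ ≟₃ _)} tt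

-- Extremal vertex sets and lists of ends

em : ∀ {P : Set} → ¬ ¬ (P ⊎ ¬ P)
em k = k (inj₂ (k ∘ inj₁))

bool : ∀ b → b ≡ true ⊎ b ≡ false
bool true  = inj₁ refl
bool false = inj₂ refl

Nonempty : VSet ν → Set
Nonempty X = ∃ λ v → X v ≡ true

hits : VSet ν → List (Fin ν) → ℕ
hits X = ∑ (⟦_⟧ ∘ X)

⟦true⟧ : ∀ {b} → b ≡ true → ⟦ b ⟧ ≡ 1
⟦true⟧ refl = refl

⟦false⟧ : ∀ {b} → b ≡ false → ⟦ b ⟧ ≡ 0
⟦false⟧ refl = refl

⟦⟧≤1 : ∀ b → ⟦ b ⟧ ≤ 1
⟦⟧≤1 true  = ≤-refl
⟦⟧≤1 false = z≤n

_⊆_ : VSet ν → VSet ν → Set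
X ⊆ Y = ∀ v → X v ≡ true → Y v ≡ true

⊆-⟦⟧ : ∀ {a b} → (a ≡ true → b ≡ true) → ⟦ a ⟧ ≤ ⟦ b ⟧
⊆-⟦⟧ {true}  h rewrite h refl = ≤-refl
⊆-⟦⟧ {false} h = z≤n

card-mono : ∀ {X Y : VSet ν} → X ⊆ Y → card X ≤ card Y
card-mono X⊆Y = ∑-mono (allFin _) λ v _ → ⊆-⟦⟧ (X⊆Y v)

card-strict : ∀ {X Y : VSet ν} → X ⊆ Y → ∀ v → X v ≡ false → Y v ≡ true → card X < card Y
card-strict {ν} {X} {Y} X⊆Y v v∉X v∈Y = lin (card X ∷ card ⁅ v ⁆ ∷ card Y ∷ [])
  (λ x a y → (x :+ a :≤ y) ∷ (a :≡˘ con 1) ∷ [] ⊢ con 1 :+ x :≤ y)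
  (∑-lin (⟦_⟧ ∘ X ∷ ⟦_⟧ ∘ ⁅ v ⁆ ∷ ⟦_⟧ ∘ Y ∷ []) (λ x a y → x :+ a :≤ y) (allFin ν) (λ w _ → step w) , card-⁅⁆ v)
  where
  step : ∀ w → ⟦ X w ⟧ + ⟦ v == w ⟧ ≤ ⟦ Y w ⟧
  step w with v ≟ᶠ w
  ... | yes refl rewrite v∉X | v∈Y = ≤-refl
  ... | no _ rewrite +-identityʳ ⟦ X w ⟧ = ⊆-⟦⟧ (X⊆Y w)

minimal : ∀ (P : VSet ν → Set) X → P X → ¬ ¬ (∃ λ X₀ → P X₀ × (∀ Y → P Y → card X₀ ≤ card Y))
minimal P X pX k = go (suc (card X)) X ≤-refl pX
  where
  go : ∀ m X → card X < m → P X → ⊥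
  go (suc m) X (s≤s lt) pX = em {∃ λ Y → P Y × card Y < card X} λ where
    (inj₁ (Y , pY , smaller)) → go m Y (<-≤-trans smaller lt) pY
    (inj₂ none) → k (X , pX , λ Y pY → ≮⇒≥ λ smaller → none (Y , pY , smaller))

pull : ∀ (X : VSet ν) C → 1 ≤ hits X C → ∃₂ λ c C′ → C ↭ c ∷ C′ × X c ≡ true
pull X (c ∷ C) h with bool (X c)
... | inj₁ c∈X = c , C , ↭.refl , c∈X
... | inj₂ c∉X rewrite c∉X =
  let d , C′ , p , d∈X = pull X C h in d , c ∷ C′ , ↭-trans (prep c p) (swap c d ↭.refl) , d∈X

uncons : ∀ (C : List A) {m} → m < length C → ∃₂ λ c D → C ↭ c ∷ D
uncons (c ∷ D) _ = c , D , ↭.refl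

hits-all : ∀ {X : VSet ν} {C} → All (λ c → X c ≡ true) C → hits X C ≡ length C
hits-all {C = C} h = trans (∑-cong C λ c i → ⟦true⟧ (All.lookup h i)) (∑-1 C)

Disjoint : VSet ν → VSet ν → Set
Disjoint X Y = ∀ v → X v ≡ true → Y v ≡ false

hits-disjoint : ∀ {X Y : VSet ν} C → Disjoint X Y → hits X C + hits Y C ≤ length C
hits-disjoint {X = X} {Y} C dis = subst (hits X C + hits Y C ≤_) (∑-1 C)
  (∑-lin (⟦_⟧ ∘ X ∷ ⟦_⟧ ∘ Y ∷ (λ _ → 1) ∷ []) (λ x y z → x :+ y :≤ z) C λ v _ → step v)
  where
  step : ∀ v → ⟦ X v ⟧ + ⟦ Y v ⟧ ≤ 1
  step v with bool (X v)
  ... | inj₁ v∈X rewrite v∈X | dis v v∈X = ≤-refl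
  ... | inj₂ v∉X rewrite v∉X = ⟦⟧≤1 (Y v)

-- Sparse edge lists and lifting

Sparse : List (Edge ν) → Set
Sparse E = ∀ X → Nonempty X → e[ X ] E + 3 ≤ 3 * card X

-- A star with end list C may be replaced by edges joining its ends in pairs; j is the
-- number of edges by which every vertex set may exceed sparsity before that is done.
Bounded : ℕ → List (Edge ν) → List (Fin ν) → Set
Bounded j R C = ∀ X → Nonempty X → e[ X ] R + hits X C + 3 ≤ 3 * card X + j

record Lift (j : ℕ) (R : List (Edge ν)) (C : List (Fin ν)) : Set where
  constructor lifted
  field
    {c c′}  : Fin ν
    {C′}    : List (Fin ν)
    split   : C ↭ c ∷ c′ ∷ C′
    sparse  : Sparse ((c , c′) ∷ R)
    bounded : Bounded j ((c , c′) ∷ R) C′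

module _ {ν} (j : ℕ) (R : List (Edge ν)) (C : List (Fin ν)) (sp : Sparse R) (bd : Bounded (suc j) R C) where

  -- No two ends in a common tight set may be joined by lifting, and of any two lifted ends one must
  -- lie in each critical set.
  Tight : VSet ν → Set
  Tight X = 3 * card X ≤ e[ X ] R + 3

  Critical : VSet ν → Set
  Critical X = 3 * card X + suc j ≤ e[ X ] R + hits X C + 3

  -- The common vertex `c` makes the intersection subject to sparsity; by supermodularity the union
  -- then has no slack.
  tight-∪ : ∀ {X Y c} → X c ≡ true → Y c ≡ true → Tight X → Tight Y → Tight (X ∪ Y)
  tight-∪ {X} {Y} {c} c∈X c∈Y tX tY =
    lin (card X ∷ card Y ∷ card (X ∪ Y) ∷ card (X ∩ Y) ∷
         e[ X ] R ∷ e[ Y ] R ∷ e[ X ∪ Y ] R ∷ e[ X ∩ Y ] R ∷ [])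
      (λ x y u i ex ey eu ei →
        (3 :* x :≤ ex :+ con 3) ∷ (3 :* y :≤ ey :+ con 3) ∷ (ex :+ ey :≤ eu :+ ei) ∷
        (ei :+ con 3 :≤ 3 :* i) ∷ 3 ⨾ (x :+ y :≡˘ u :+ i) ∷ [] ⊢ 3 :* u :≤ eu :+ con 3)
      (tX , tY , supermodular X Y R , sp (X ∩ Y) (c , cong₂ _∧_ c∈X c∈Y) , modular X Y (allFin ν))

  -- Here the upper bound is applied to the union, which forces the excess onto the intersection. A
  -- least critical set is therefore contained in every critical set that it meets.
  critical-∩ : ∀ {X Y v} → X v ≡ true → Y v ≡ true → Critical X → Critical Y → Critical (X ∩ Y)
  critical-∩ {X} {Y} {v} v∈X v∈Y cX cY =
    lin (card X ∷ card Y ∷ card (X ∪ Y) ∷ card (X ∩ Y) ∷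
         e[ X ] R ∷ e[ Y ] R ∷ e[ X ∪ Y ] R ∷ e[ X ∩ Y ] R ∷
         hits X C ∷ hits Y C ∷ hits (X ∪ Y) C ∷ hits (X ∩ Y) C ∷ j ∷ [])
      (λ x y u i ex ey eu ei hx hy hu hi j →
        (3 :* x :+ (con 1 :+ j) :≤ ex :+ hx :+ con 3) ∷
        (3 :* y :+ (con 1 :+ j) :≤ ey :+ hy :+ con 3) ∷
        (ex :+ ey :≤ eu :+ ei) ∷ (eu :+ hu :+ con 3 :≤ 3 :* u :+ (con 1 :+ j)) ∷
        3 ⨾ (x :+ y :≡˘ u :+ i) ∷ (hx :+ hy :≡ hu :+ hi) ∷ [] ⊢
        3 :* i :+ (con 1 :+ j) :≤ ei :+ hi :+ con 3)
      (cX , cY , supermodular X Y R ,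
       bd (X ∪ Y) (v , trans (cong (_∨ Y v) v∈X) refl) , modular X Y (allFin ν) , modular X Y C)

  critical-hits : ∀ {X} → Nonempty X → Critical X → suc j ≤ hits X C
  critical-hits {X} ne cX = lin (card X ∷ e[ X ] R ∷ hits X C ∷ j ∷ [])
    (λ x e h j → (3 :* x :+ (con 1 :+ j) :≤ e :+ h :+ con 3) ∷ (e :+ con 3 :≤ 3 :* x) ∷ [] ⊢ con 1 :+ j :≤ h)
    (cX , sp X ne)

  Separated : Fin ν → Fin ν → Set
  Separated c c′ = ∀ X → Tight X → X c ≡ true → X c′ ≡ true → ⊥

  -- If no end can be joined to `c`, each of them shares a tight set with `c`, and the union of
  -- these sets is tight because all contain `c`.
  separate : ∀ c D → ¬ ¬ ((∃ λ X → Tight X × X c ≡ true × All (λ d → X d ≡ true) D) ⊎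
                          (∃₂ λ c′ D′ → D ↭ c′ ∷ D′ × Separated c c′))
  separate c [] k = k (inj₁ (⁅ c ⁆ , single , ==-refl c , []))
    where
    single : Tight ⁅ c ⁆
    single = lin (card ⁅ c ⁆ ∷ e[ ⁅ c ⁆ ] R ∷ [])
      (λ x e → 3 ⨾ (x :≡ con 1) ∷ [] ⊢ 3 :* x :≤ e :+ con 3) (card-⁅⁆ c)
  separate c (d ∷ D) k = separate c D λ where
    (inj₂ (c′ , D′ , p , sep)) → k (inj₂ (c′ , d ∷ D′ , ↭-trans (prep d p) (swap d c′ ↭.refl) , sep))
    (inj₁ (X , tX , c∈X , D⊆X)) → em {∃ λ Y → Tight Y × Y c ≡ true × Y d ≡ true} λ where
      (inj₂ none) → k (inj₂ (d , D , ↭.refl , λ Y tY c∈Y d∈Y → none (Y , tY , c∈Y , d∈Y)))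
      (inj₁ (Y , tY , c∈Y , d∈Y)) → k (inj₁ (Y ∪ X , tight-∪ c∈Y c∈X tY tX , cong (_∨ X c) c∈Y ,
        cong (_∨ X d) d∈Y ∷ All.map (λ {w} w∈X → trans (cong (Y w ∨_) w∈X) (Bool.∨-zeroʳ (Y w))) D⊆X))

  -- A set containing both ends loses two hits and gains one edge, a set containing exactly one
  -- loses one hit. So the sharper bound can fail only at a critical set that misses both, and
  -- sparsity only at a tight set containing both.
  pair : ∀ {c c′ C′} → C ↭ c ∷ c′ ∷ C′ → Separated c c′ →
         (∀ X → Nonempty X → Critical X → X c ≡ false → X c′ ≡ false → ⊥) → Lift j R C
  pair {c} {c′} {C′} p sep crit = lifted p sp′ bd′
    where
    sp′ : Sparse ((c , c′) ∷ R)
    sp′ X ne with bool (X c) | bool (X c′)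
    ... | inj₁ q | inj₁ q′ rewrite q | q′ = ≰⇒> λ t → sep X (subst (3 * card X ≤_) refl t) q q′
    ... | inj₁ q | inj₂ q′ rewrite q | q′ = sp X ne
    ... | inj₂ q | _       rewrite q      = sp X ne
    hits-split : ∀ X → hits X C ≡ ⟦ X c ⟧ + (⟦ X c′ ⟧ + hits X C′)
    hits-split X = ∑-↭ (⟦_⟧ ∘ X) p
    bd′ : Bounded j ((c , c′) ∷ R) C′
    bd′ X ne with bool (X c) | bool (X c′) | hits-split X | bd X ne
    ... | inj₁ q | inj₁ q′ | hs | b rewrite q | q′ =
      lin (card X ∷ e[ X ] R ∷ hits X C ∷ hits X C′ ∷ j ∷ [])
        (λ x e h h′ j → (e :+ h :+ con 3 :≤ 3 :* x :+ (con 1 :+ j)) ∷ (h :≡˘ con 1 :+ (con 1 :+ h′)) ∷ [] ⊢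
          (con 1 :+ e) :+ h′ :+ con 3 :≤ 3 :* x :+ j) (b , hs)
    ... | inj₁ q | inj₂ q′ | hs | b rewrite q | q′ =
      lin (card X ∷ e[ X ] R ∷ hits X C ∷ hits X C′ ∷ j ∷ [])
        (λ x e h h′ j → (e :+ h :+ con 3 :≤ 3 :* x :+ (con 1 :+ j)) ∷ (h :≡˘ con 1 :+ h′) ∷ [] ⊢
          e :+ h′ :+ con 3 :≤ 3 :* x :+ j) (b , hs)
    ... | inj₂ q | inj₁ q′ | hs | b rewrite q | q′ =
      lin (card X ∷ e[ X ] R ∷ hits X C ∷ hits X C′ ∷ j ∷ [])
        (λ x e h h′ j → (e :+ h :+ con 3 :≤ 3 :* x :+ (con 1 :+ j)) ∷ (h :≡˘ con 1 :+ h′) ∷ [] ⊢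
          e :+ h′ :+ con 3 :≤ 3 :* x :+ j) (b , hs)
    ... | inj₂ q | inj₂ q′ | hs | b =
      lin (card X ∷ e[ X ] R ∷ hits X C ∷ hits X C′ ∷ ⟦ X c ∧ X c′ ⟧ ∷ ⟦ X c ⟧ ∷ ⟦ X c′ ⟧ ∷ j ∷ [])
        (λ x e h h′ i a a′ j → (con 1 :+ (e :+ h :+ con 3) :≤ 3 :* x :+ (con 1 :+ j)) ∷
          (h :≡˘ a :+ (a′ :+ h′)) ∷ (i :≡ con 0) ∷ [] ⊢
          (i :+ e) :+ h′ :+ con 3 :≤ 3 :* x :+ j)
        (≰⇒> (λ c≤ → crit X ne c≤ q q′) , hs , ⟦false⟧ (cong (_∧ X c′) q))

  -- The lower bound on the number of ends prevents them from all lying in one tight set. The upper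
  -- bound makes two disjoint critical sets divide the ends evenly between them.
  lift : length C ≤ 2 * suc j → suc j < length C → ¬ ¬ Lift j R C
  lift short long k = em {∃ λ X → Nonempty X × Critical X} λ where
      (inj₂ none) → let c , D , p = uncons C long in by-separation c D p λ X ne cX _ → none (X , ne , cX)
      (inj₁ (X , ne , cX)) → minimal (λ X → Nonempty X × Critical X) X (ne , cX) λ where
        (X₀ , (ne₀ , c₀) , least) → from-least X₀ ne₀ c₀ (λ Y neY cY → least Y (neY , cY))
    where
    by-separation : ∀ c D → C ↭ c ∷ D → (∀ X → Nonempty X → Critical X → X c ≡ false → ⊥) → ⊥
    by-separation c D p crit = separate c D λ where
      (inj₂ (c′ , D′ , q , sep)) →
        k (pair (↭-trans p (prep c q)) sep λ X ne cX c∉X _ → crit X ne cX c∉X)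
      (inj₁ (X , tX , c∈X , D⊆X)) →
        lin⊥ (card X ∷ e[ X ] R ∷ hits X C ∷ length C ∷ j ∷ [])
          (λ x e h l j → (3 :* x :≤ e :+ con 3) ∷ (e :+ h :+ con 3 :≤ 3 :* x :+ (con 1 :+ j)) ∷
            (h :≡˘ l) ∷ (con 1 :+ (con 1 :+ j) :≤ l) ∷ [])
          (tX , bd X (c , c∈X) ,
           trans (∑-↭ (⟦_⟧ ∘ X) p) (trans (hits-all {X = X} (c∈X ∷ D⊆X)) (sym (↭-length p))) , long)

    from-least : ∀ X₀ → Nonempty X₀ → Critical X₀ →
                 (∀ Y → Nonempty Y → Critical Y → card X₀ ≤ card Y) → ⊥
    from-least X₀ ne₀ c₀ least with pull X₀ C (≤-trans (s≤s z≤n) (critical-hits ne₀ c₀))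
    ... | c , D , p , c∈X₀ = em {∃ λ Y → Nonempty Y × Critical Y × Disjoint X₀ Y} λ where
        (inj₂ none) → by-separation c D p λ Y ne cY c∉Y → none (Y , ne , cY , disjoint cY c∉Y)
        (inj₁ (Y , ne , cY , dis)) → two-parts Y ne cY dis
      where
      -- Otherwise `X₀ ∩ Y` would be a critical set without `c`, hence smaller than `X₀`.
      disjoint : ∀ {Y} → Critical Y → Y c ≡ false → Disjoint X₀ Y
      disjoint {Y} cY c∉Y v v∈X₀ with bool (Y v)
      ... | inj₂ v∉Y = v∉Y
      ... | inj₁ v∈Y = contradiction
        (least (X₀ ∩ Y) (v , cong₂ _∧_ v∈X₀ v∈Y) (critical-∩ v∈X₀ v∈Y c₀ cY))
        (<⇒≱ (card-strict {X = X₀ ∩ Y} (λ w → ∧-trueˡ) c (trans (cong (X₀ c ∧_) c∉Y) (Bool.∧-zeroʳ _)) c∈X₀))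

      two-parts : ∀ Y → Nonempty Y → Critical Y → Disjoint X₀ Y → ⊥
      two-parts Y ne cY dis
        with pull Y D (subst (1 ≤_)
          (trans (∑-↭ (⟦_⟧ ∘ Y) p) (cong (_+ hits Y D) (⟦false⟧ (dis c c∈X₀))))
          (≤-trans (s≤s z≤n) (critical-hits ne cY)))
      ... | c′ , D′ , q , c′∈Y = k (pair p′ sep crit)
        where
        p′ : C ↭ c ∷ c′ ∷ D′
        p′ = ↭-trans p (prep c q)

        c′∉X₀ : X₀ c′ ≡ false
        c′∉X₀ with bool (X₀ c′)
        ... | inj₂ h = h
        ... | inj₁ h = ⊥-elim (true≢false c′∈Y (dis c′ h))

        -- Both critical sets contain at least j + 1 of the at most 2(j + 1) ends. So `X₀` contains
        -- exactly j + 1, which is its whole excess.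
        tX₀ : Tight X₀
        tX₀ = lin (card X₀ ∷ e[ X₀ ] R ∷ hits X₀ C ∷ hits Y C ∷ length C ∷ j ∷ [])
          (λ x e h h′ l j → (3 :* x :+ (con 1 :+ j) :≤ e :+ h :+ con 3) ∷ (h :+ h′ :≤ l) ∷
            (l :≤ 2 :* (con 1 :+ j)) ∷ (con 1 :+ j :≤ h′) ∷ [] ⊢ 3 :* x :≤ e :+ con 3)
          (c₀ , hits-disjoint C dis , short , critical-hits ne cY)

        -- The tight set `X ∪ X₀` would contain the j + 1 ends in `X₀` and also `c′`, one end more
        -- than its bound permits.
        sep : Separated c c′
        sep X tX c∈X c′∈X =
          lin⊥ (card U ∷ e[ U ] R ∷ hits U C ∷ hits U D′ ∷ hits X₀ C ∷ hits X₀ D′ ∷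
                ⟦ U c ⟧ ∷ ⟦ U c′ ⟧ ∷ ⟦ X₀ c ⟧ ∷ ⟦ X₀ c′ ⟧ ∷ j ∷ [])
            (λ u e h d h₀ d₀ a a′ b b′ j →
              (3 :* u :≤ e :+ con 3) ∷ (e :+ h :+ con 3 :≤ 3 :* u :+ (con 1 :+ j)) ∷
              (h :≡˘ a :+ (a′ :+ d)) ∷ (h₀ :≡ b :+ (b′ :+ d₀)) ∷ (d₀ :≤ d) ∷
              (a :≡˘ con 1) ∷ (a′ :≡˘ con 1) ∷ (b :≡ con 1) ∷ (b′ :≡ con 0) ∷ (con 1 :+ j :≤ h₀) ∷ [])
            (tight-∪ c∈X c∈X₀ tX tX₀ , bd U (c , c∈U) , ∑-↭ (⟦_⟧ ∘ U) p′ , ∑-↭ (⟦_⟧ ∘ X₀) p′ ,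
             ∑-mono D′ (λ v _ → ⊆-⟦⟧ λ v∈X₀ → trans (cong (X v ∨_) v∈X₀) (Bool.∨-zeroʳ (X v))) ,
             ⟦true⟧ c∈U , ⟦true⟧ (cong (_∨ X₀ c′) c′∈X) , ⟦true⟧ c∈X₀ , ⟦false⟧ c′∉X₀ ,
             critical-hits ne₀ c₀)
          where
          U : VSet ν
          U = X ∪ X₀
          c∈U : U c ≡ true
          c∈U = cong (_∨ X₀ c) c∈X

        -- `W` and `X₀` are disjoint and both miss `c′`, so they share at most 2j + 1 ends, while
        -- each needs j + 1.
        crit : ∀ W → Nonempty W → Critical W → W c ≡ false → W c′ ≡ false → ⊥
        crit W neW cW c∉W c′∉W =
          lin⊥ (hits X₀ C ∷ hits W C ∷ ⟦ X₀ c ⟧ ∷ ⟦ W c ⟧ ∷ ⟦ X₀ c′ ⟧ ∷ ⟦ W c′ ⟧ ∷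
                hits X₀ D′ ∷ hits W D′ ∷ length C ∷ length D′ ∷ j ∷ [])
            (λ h w a a′ b b′ d d′ l l′ j →
              (h :≡ a :+ (b :+ d)) ∷ (w :≡ a′ :+ (b′ :+ d′)) ∷ ((a :+ d) :+ (a′ :+ d′) :≤ con 1 :+ l′) ∷
              (b :≡ con 0) ∷ (b′ :≡ con 0) ∷ (l :≡˘ con 1 :+ (con 1 :+ l′)) ∷
              (l :≤ 2 :* (con 1 :+ j)) ∷ (con 1 :+ j :≤ h) ∷ (con 1 :+ j :≤ w) ∷ [])
            (∑-↭ (⟦_⟧ ∘ X₀) p′ , ∑-↭ (⟦_⟧ ∘ W) p′ , hits-disjoint (c ∷ D′) (disjoint cW c∉W) ,
             ⟦false⟧ c′∉X₀ , ⟦false⟧ c′∉W , ↭-length p′ , short ,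
             critical-hits ne₀ c₀ , critical-hits neW cW)

-- Lifting several pairs and splitting off stars

stable-≤ : ∀ {a b} → ¬ ¬ (a ≤ b) → a ≤ b
stable-≤ {a} {b} = decidable-stable (a ≤? b)

sparse-≋ : ∀ {E F : List (Edge ν)} → E ≋ F → Sparse E → Sparse F
sparse-≋ p sp X ne = subst (λ e → e + 3 ≤ 3 * card X) (∑ᵉ-≋ (inside-sym X) p) (sp X ne)

ends : List (Edge ν) → List (Fin ν)
ends []            = []
ends ((a , b) ∷ P) = a ∷ b ∷ ends P

length-ends : ∀ (P : List (Edge ν)) → length (ends P) ≡ length P + length P
length-ends []      = refl
length-ends (e ∷ P) = cong suc (trans (cong suc (length-ends P)) (sym (+-suc _ _)))

attains-lifts : ∀ (v : Fin ν) P {F f} → Attains (P ++ F) f → Attains (star v (ends P) ++ F) f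
attains-lifts v []            p       = p
attains-lifts v ((a , b) ∷ P) {f = f} (s , p) = attains-lift v a b {f = f} (s , attains-lifts v P p)

record Lifts (p i : ℕ) (R : List (Edge ν)) (C : List (Fin ν)) : Set where
  constructor lifts
  field
    P      : List (Edge ν)
    L      : List (Fin ν)
    split  : C ↭ ends P ++ L
    #P     : length P ≡ p
    #L     : length L ≡ i
    sparse : Sparse (P ++ R)

no-lifts : ∀ {R : List (Edge ν)} {C i} → length C ≡ i → Sparse R → Lifts 0 i R C
no-lifts {C = C} #C sp = lifts [] C ↭.refl refl #C sp

-- Each lift lowers the permitted excess `p + i` by one and the number of ends, 2p + i, by two. Both
-- length conditions of `lift` hold as long as a pair remains to be lifted.
lift-all : ∀ p i (R : List (Edge ν)) C → Sparse R → Bounded (p + i) R C → length C ≡ p + (p + i) →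
           ¬ ¬ Lifts p i R C
lift-all zero    i R C sp bd #C k = k (no-lifts #C sp)
lift-all (suc p) i R C sp bd #C k =
  lift (p + i) R C sp bd
    (lin (length C ∷ p ∷ i ∷ []) (λ c p i → (c :≡ (con 1 :+ p) :+ (con 1 :+ (p :+ i))) ∷ [] ⊢
      c :≤ 2 :* (con 1 :+ (p :+ i))) #C)
    (lin (length C ∷ p ∷ i ∷ []) (λ c p i → (c :≡˘ (con 1 :+ p) :+ (con 1 :+ (p :+ i))) ∷ [] ⊢
      con 1 :+ (con 1 :+ (p :+ i)) :≤ c) #C)
  λ { (lifted {c} {c′} {C′} q sp′ bd′) →
      lift-all p i ((c , c′) ∷ R) C′ sp′ bd′
        (lin (length C ∷ length C′ ∷ p ∷ i ∷ [])
          (λ c c′ p i → (c :≡ (con 1 :+ p) :+ (con 1 :+ (p :+ i))) ∷ (c :≡˘ con 1 :+ (con 1 :+ c′)) ∷ [] ⊢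
            c′ :≡ p :+ (p :+ i)) (#C , ↭-length q))
      λ { (lifts P L q′ #P #L sp″) →
        k (lifts ((c , c′) ∷ P) L (↭-trans q (prep c (prep c′ q′))) (cong suc #P) #L
            (sparse-≋ (≋-sym (shift-≋ _ P)) sp″)) } }

count : Fin ν → List (Fin ν) → ℕ
count w = hits ⁅ w ⁆

count-∈ : ∀ {w : Fin ν} {C} → w ∈ C → 1 ≤ count w C
count-∈ {w = w} (here refl) rewrite ==-refl w = s≤s z≤n
count-∈ {w = w} {c ∷ C} (there i) = ≤-trans (count-∈ i) (m≤n+m _ ⟦ w == c ⟧)

∑ᵉ-++ : ∀ (w : Fin ν → Fin ν → ℕ) E F → ∑ᵉ w (E ++ F) ≡ ∑ᵉ w E + ∑ᵉ w F
∑ᵉ-++ w = ∑-++ _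

∑-≥ : ∀ (f : A → ℕ) {x l} → x ∈ l → f x ≤ ∑ f l
∑-≥ f (here refl) = m≤m+n _ _
∑-≥ f {l = y ∷ l} (there i) = ≤-trans (∑-≥ f i) (m≤n+m _ (f y))

degree-ends : ∀ (w : Fin ν) P → degree w P ≡ count w (ends P)
degree-ends w []            = refl
degree-ends w ((a , b) ∷ P) = trans (cong (⟦ w == a ⟧ + ⟦ w == b ⟧ +_) (degree-ends w P)) (+-assoc ⟦ w == a ⟧ _ _)

degree-star : ∀ {v w : Fin ν} C → w ≢ v → degree w (star v C) ≡ count w C
degree-star {v = v} {w} C w≢v = trans (∑ᵉ-star (touching w) v C)
  (∑-cong C λ c _ → cong (_+ ⟦ w == c ⟧) (⟦false⟧ (≢⇒== w≢v)))

degree-centre : ∀ {v : Fin ν} {C} → All (_≢ v) C → degree v (star v C) ≡ length C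
degree-centre {v = v} {C} av = trans (∑ᵉ-star (touching v) v C)
  (trans (∑-cong C λ c i → cong₂ _+_ (⟦true⟧ (==-refl v)) (⟦false⟧ (≢⇒== (All.lookup av i ∘ sym)))) (∑-1 C))

degree-avoids : ∀ {v : Fin ν} {R} → All (Avoids v) R → degree v R ≡ 0
degree-avoids {R = []} [] = refl
degree-avoids {v = v} {(a , b) ∷ R} ((a≢v , b≢v) ∷ av)
  rewrite ≢⇒== (a≢v ∘ sym) | ≢⇒== (b≢v ∘ sym) = degree-avoids av

Within : VSet ν → List (Edge ν) → Set
Within W = All λ e → W (proj₁ e) ≡ true × W (proj₂ e) ≡ true

all-≋ : ∀ {Q : Edge ν → Set} → (∀ {a b} → Q (a , b) → Q (b , a)) → ∀ {E F} → E ≋ F → All Q E → All Q F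
all-≋ r ≋-refl        h           = h
all-≋ r (≋-prep e p)  (x ∷ h)     = x ∷ all-≋ r p h
all-≋ r ≋-rev         (x ∷ h)     = r x ∷ h
all-≋ r ≋-swap        (x ∷ y ∷ h) = y ∷ x ∷ h
all-≋ r (≋-trans p q) h           = all-≋ r q (all-≋ r p h)

within-≋ : ∀ {W : VSet ν} {E F} → E ≋ F → Within W E → Within W F
within-≋ = all-≋ Prod.swap

avoids-≋ : ∀ {v : Fin ν} {E F} → E ≋ F → All (Avoids v) E → All (Avoids v) F
avoids-≋ = all-≋ Prod.swap

within-star : ∀ {W : VSet ν} {v} C → Within W (star v C) → All (λ c → W c ≡ true) C
within-star []      []            = []
within-star (c ∷ C) ((_ , x) ∷ h) = x ∷ within-star C h

within-ends : ∀ {W : VSet ν} P → All (λ c → W c ≡ true) (ends P) → Within W P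
within-ends []            []          = []
within-ends ((a , b) ∷ P) (x ∷ y ∷ h) = (x , y) ∷ within-ends P h

_−_ : VSet ν → Fin ν → VSet ν
W − v = W ∖ ⁅ v ⁆

infixl 6 _−_

card-− : ∀ {W : VSet ν} {v} → W v ≡ true → card W ≡ suc (card (W − v))
card-− {ν} {W} {v} v∈W = lin (card W ∷ card (W − v) ∷ card ⁅ v ⁆ ∷ [])
  (λ w x a → (w :≡ x :+ a) ∷ (a :≡ con 1) ∷ [] ⊢ w :≡ con 1 :+ x)
  (∑-lin (⟦_⟧ ∘ W ∷ ⟦_⟧ ∘ (W − v) ∷ ⟦_⟧ ∘ ⁅ v ⁆ ∷ []) (λ w x a → w :≡ x :+ a) (allFin ν) (λ w _ → step w) ,
   card-⁅⁆ v)
  where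
  step : ∀ w → ⟦ W w ⟧ ≡ ⟦ W w ∧ not (v == w) ⟧ + ⟦ v == w ⟧
  step w with v ≟ᶠ w
  ... | yes refl rewrite v∈W = refl
  ... | no _ = sym (trans (+-identityʳ _) (cong ⟦_⟧ (Bool.∧-identityʳ (W w))))

∈-− : ∀ {W : VSet ν} {v w} → W w ≡ true → w ≢ v → (W − v) w ≡ true
∈-− w∈W w≢v = cong₂ (λ a b → a ∧ not b) w∈W (≢⇒== (w≢v ∘ sym))

∈-−⁻ : ∀ (W : VSet ν) {v w} → (W − v) w ≡ true → W w ≡ true × w ≢ v
∈-−⁻ W {v} {w} h = ∧-trueˡ h , λ { refl → true≢false (∧-trueʳ {W w} h) (cong not (==-refl w)) }

card-∪-⁅⁆ : ∀ (X : VSet ν) v → card (X ∪ ⁅ v ⁆) ≤ suc (card X)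
card-∪-⁅⁆ {ν} X v = lin (card (X ∪ ⁅ v ⁆) ∷ card X ∷ card ⁅ v ⁆ ∷ [])
  (λ u x a → (u :≤ x :+ a) ∷ (a :≡ con 1) ∷ [] ⊢ u :≤ con 1 :+ x)
  (∑-lin (⟦_⟧ ∘ (X ∪ ⁅ v ⁆) ∷ ⟦_⟧ ∘ X ∷ ⟦_⟧ ∘ ⁅ v ⁆ ∷ []) (λ u x a → u :≤ x :+ a) (allFin ν)
     (λ w _ → taut (X w) (v == w)) ,
   card-⁅⁆ v)
  where
  taut : ∀ x y → ⟦ x ∨ y ⟧ ≤ ⟦ x ⟧ + ⟦ y ⟧
  taut = toWitness {a? = ∀ᵇ λ x → ∀ᵇ λ y → _ ≤? _} tt

e-mono : ∀ {X Y : VSet ν} → X ⊆ Y → ∀ E → e[ X ] E ≤ e[ Y ] E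
e-mono {X = X} {Y} X⊆Y E = ∑-mono E λ (a , b) _ →
  ⊆-⟦⟧ λ h → cong₂ _∧_ (X⊆Y a (∧-trueˡ h)) (X⊆Y b (∧-trueʳ {X a} h))

hits-mono : ∀ {X Y : VSet ν} → X ⊆ Y → ∀ C → hits X C ≤ hits Y C
hits-mono X⊆Y C = ∑-mono C λ c _ → ⊆-⟦⟧ (X⊆Y c)

⊆-∪ˡ : ∀ (X Y : VSet ν) → X ⊆ (X ∪ Y)
⊆-∪ˡ X Y v h = cong (_∨ Y v) h

∈-∪-⁅⁆ : ∀ (X : VSet ν) v → (X ∪ ⁅ v ⁆) v ≡ true
∈-∪-⁅⁆ X v = trans (cong (X v ∨_) (==-refl v)) (Bool.∨-zeroʳ (X v))

e-star : ∀ {X : VSet ν} {v} C → X v ≡ true → e[ X ] (star v C) ≡ hits X C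
e-star {X = X} {v} C v∈X = trans (∑ᵉ-star (inside X) v C)
  (∑-cong C λ c _ → cong (λ b → ⟦ b ∧ X c ⟧) v∈X)

no-loops : ∀ {v : Fin ν} {C R} → Sparse (star v C ++ R) → All (_≢ v) C
no-loops {v = v} {C} {R} sp = All.tabulate λ { {c} c∈C refl →
  lin⊥ (e[ ⁅ v ⁆ ] (star v C ++ R) ∷ e[ ⁅ v ⁆ ] (star v C) ∷ e[ ⁅ v ⁆ ] R ∷ hits ⁅ v ⁆ C ∷ card ⁅ v ⁆ ∷ [])
    (λ e s r h x → (e :+ con 3 :≤ 3 :* x) ∷ (e :≡˘ s :+ r) ∷ (s :≡˘ h) ∷ 3 ⨾ (x :≡ con 1) ∷ (con 1 :≤ h) ∷ [])
    (sp ⁅ v ⁆ (v , ==-refl v) , ∑ᵉ-++ (inside ⁅ v ⁆) (star v C) R , e-star C (==-refl v) , card-⁅⁆ v ,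
     count-∈ c∈C) }

sparse-++ʳ : ∀ (F : List (Edge ν)) {R} → Sparse (F ++ R) → Sparse R
sparse-++ʳ F {R} sp X ne = ≤-trans (+-monoˡ-≤ 3 (≤-trans (m≤n+m _ (e[ X ] F))
  (≤-reflexive (sym (∑ᵉ-++ (inside X) F R))))) (sp X ne)

-- Adding `v` to `X` turns the hits into spanned edges; the excess 3 is the price of one more
-- vertex.
bounded-star : ∀ {v : Fin ν} {C R} → Sparse (star v C ++ R) → Bounded 3 R C
bounded-star {v = v} {C} {R} sp X ne@(w , w∈X) =
  lin (e[ X ] R ∷ e[ Y ] R ∷ hits X C ∷ hits Y C ∷ e[ Y ] (star v C) ∷ e[ Y ] (star v C ++ R) ∷
       card X ∷ card Y ∷ [])
    (λ e e′ h h′ s t x y → (e :≤ e′) ∷ (h :≤ h′) ∷ (s :≡˘ h′) ∷ (t :≡˘ s :+ e′) ∷ (t :+ con 3 :≤ 3 :* y) ∷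
      3 ⨾ (y :≤ con 1 :+ x) ∷ [] ⊢ e :+ h :+ con 3 :≤ 3 :* x :+ con 3)
    (e-mono X⊆Y R , hits-mono X⊆Y C , e-star C (∈-∪-⁅⁆ X v) , ∑ᵉ-++ (inside Y) (star v C) R ,
     sp Y (v , ∈-∪-⁅⁆ X v) , card-∪-⁅⁆ X v)
  where
  Y = X ∪ ⁅ v ⁆
  X⊆Y = ⊆-∪ˡ X ⁅ v ⁆

-- Prescribed boundaries and the removal of one vertex

Good : Fin ν → List (Edge ν) → (Fin ν → ℤ₃) → Set
Good w E β = degree w E ≤ 5 ⊎ (degree w E ≤ 6 × β w ≡ 𝟘)

good-≤6 : ∀ {w : Fin ν} {E β} → Good w E β → degree w E ≤ 6
good-≤6 (inj₁ h)       = ≤-trans h (n≤1+n 5)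
good-≤6 (inj₂ (h , _)) = h

incident : ∀ (w a b : Fin ν) → 1 ≤ touching w a b ⊎ (w ≢ a × w ≢ b)
incident w a b with w ≟ᶠ a | w ≟ᶠ b
... | yes _ | _     = inj₁ (s≤s z≤n)
... | no _  | yes _ = inj₁ ≤-refl
... | no p  | no q  = inj₂ (p , q)

within-− : ∀ {W : VSet ν} {v R} → Within W R → All (Avoids v) R → Within (W − v) R
within-− {W = W} wi av = All.tabulate λ e∈R →
  ∈-− {W = W} (proj₁ (All.lookup wi e∈R)) (proj₁ (All.lookup av e∈R)) ,
  ∈-− {W = W} (proj₂ (All.lookup wi e∈R)) (proj₂ (All.lookup av e∈R))

count-zero : ∀ {w : Fin ν} {L} → count w L ≡ 0 → w ∉ L
count-zero h w∈L with () ← subst (1 ≤_) h (count-∈ w∈L)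

ends-avoid : ∀ {v : Fin ν} P → All (_≢ v) (ends P) → All (Avoids v) P
ends-avoid []            []          = []
ends-avoid ((a , b) ∷ P) (x ∷ y ∷ h) = (x , y) ∷ ends-avoid P h

module Rooted {ν} (z : Fin ν) where

  -- β prescribes the boundary at the vertices of W other than z. Sparsity is asked only of sets that
  -- miss a vertex of W, so that superfluous edges may be present.
  record Instance (W : VSet ν) (E : List (Edge ν)) (β : Fin ν → ℤ₃) : Set where
    field
      root   : W z ≡ true
      within : Within W E
      sparse : ∀ X → Nonempty X → ∀ w → W w ≡ true → X w ≡ false → e[ X ] E + 3 ≤ 3 * card X
      dense  : 3 * card W ≤ length E + 4
      good   : ∀ w → W w ≡ true → w ≢ z → Good w E β

  Solution : VSet ν → List (Edge ν) → (Fin ν → ℤ₃) → Set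
  Solution W E β = ∃ λ f → Attains E f × (∀ w → W w ≡ true → w ≢ z → f w ≡ β w)

  Below : List (Edge ν) → Set
  Below E = ∀ {W E′ β} → length E′ < length E → Instance W E′ β → ¬ ¬ Solution W E′ β

  drop-edge : ∀ {W e E β} → Instance W (e ∷ E) β → 3 * card W ≤ length E + 4 → Below (e ∷ E) →
              ¬ ¬ Solution W (e ∷ E) β
  drop-edge {W} {e@(a , b)} {E} {β} I dense′ below k = below ≤-refl I′ λ where
      (f , p , h) → k (_ , attains-∷ true e {f = f} p , λ w w∈W w≢z →
        trans (cong (_⊕ χ true e w) (h w w∈W w≢z)) (⊖-⊕ (β w) _))
    where
    open Instance I
    I′ : Instance W E (λ w → β w ⊖ χ true e w)
    I′ = record
      { root   = root
      ; within = All.tail within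
      ; sparse = λ X ne w w∈W w∉X → ≤-trans (+-monoˡ-≤ 3 (m≤n+m _ (inside X a b))) (sparse X ne w w∈W w∉X)
      ; dense  = dense′
      ; good   = good′
      }
      where
      good′ : ∀ w → W w ≡ true → w ≢ z → Good w E (λ w → β w ⊖ χ true e w)
      good′ w w∈W w≢z with incident w a b
      ... | inj₁ 1≤ = inj₁ (+-cancelˡ-≤ 1 _ _ (≤-trans (+-monoˡ-≤ (degree w E) 1≤)
                        (good-≤6 {w = w} {e ∷ E} {β} (good w w∈W w≢z))))
      ... | inj₂ (w≢a , w≢b) = case good w w∈W w≢z of λ where
        (inj₁ h)        → inj₁ (≤-trans (m≤n+m _ (touching w a b)) h)
        (inj₂ (h , βw)) → inj₂ (≤-trans (m≤n+m _ (touching w a b)) h ,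
          cong₂ _⊖_ βw (cong₂ _⊖_ (δ-≢ (w≢a ∘ sym)) (δ-≢ (w≢b ∘ sym))))

  -- The instances from which no edge can be spared. Sparsity now extends to the sets that contain
  -- `W`, as these span at most 3|W| - 4 edges.
  record Exact (W : VSet ν) (E : List (Edge ν)) (β : Fin ν → ℤ₃) : Set where
    field
      root   : W z ≡ true
      within : Within W E
      sparse : Sparse E
      exact  : 3 * card W ≡ length E + 4
      good   : ∀ w → W w ≡ true → w ≢ z → Good w E β

  record Decomposition (v : Fin ν) (E : List (Edge ν)) : Set where
    constructor decomposition
    field
      {C}     : List (Fin ν)
      {R}     : List (Edge ν)
      split   : E ≋ star v C ++ R
      avoids  : All (Avoids v) R
      off-centre : All (_≢ v) C

  decompose : ∀ {E} v → Sparse E → Decomposition v E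
  decompose v sp = let C , R , p , av = extract v _ in
    decomposition p av (no-loops (sparse-≋ p sp))

  module _ {v E} (D : Decomposition v E) where
    open Decomposition D

    degree-split : degree v E ≡ length C
    degree-split = trans (∑ᵉ-≋ (touching-sym v) split) (trans (∑ᵉ-++ (touching v) (star v C) R)
      (trans (cong₂ _+_ (degree-centre off-centre) (degree-avoids avoids)) (+-identityʳ _)))

    degree-other : ∀ {w} → w ≢ v → degree w E ≡ count w C + degree w R
    degree-other {w} w≢v = trans (∑ᵉ-≋ (touching-sym w) split) (trans (∑ᵉ-++ (touching w) (star v C) R)
      (cong (_+ degree w R) (degree-star C w≢v)))

    length-split : length E ≡ length C + length R
    length-split = trans (length-≋ split) (trans (List.length-++ (star v C))
      (cong (_+ length R) (List.length-map (v ,_) C)))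

  -- The i edges at v that are not lifted are oriented so that v gets the boundary t.
  remove-vertex : ∀ {W E β v p i t} → Exact W E β → W v ≡ true → v ≢ z →
    (D : Decomposition v E) → Lifts p i (Decomposition.R D) (Decomposition.C D) →
    p + i ≤ 3 → 1 ≤ p + i → Reachable i t → Below E →
    ¬ ¬ (∃ λ f → Attains E f × f v ≡ t × (∀ w → W w ≡ true → w ≢ z → w ≢ v → f w ≡ β w))
  remove-vertex {W} {E} {β} {v} {p} {i} {t} X v∈W v≢z D ls p+i≤3 1≤p+i reach below k =
    below shorter I λ where
      (f , at , h) →
        let f-v  = attains-avoids avoids-v at
            at₁  = attaining σ (attains-lifts v P at)
        in k (_ , attains-≋ whole at₁ ,
              trans (cong₂ _⊕_ f-v (at-centre σ)) refl ,
              λ w w∈W w≢z w≢v → trans (cong (_⊕ boundary σ w) (h w (∈-− {W = W} w∈W w≢v) w≢z)) (⊖-⊕ (β w) _))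
    where
    open Exact X
    open Decomposition D renaming (split to star-split)
    open Lifts ls renaming (split to C-split; sparse to sparse′)
    C⊆W : All (λ c → W c ≡ true) C
    C⊆W = within-star C (All.++⁻ˡ (star v C) (within-≋ star-split within))
    C-all : ∀ {Q : Fin ν → Set} → All Q C → All Q (ends P ++ L)
    C-all = All-resp-↭ C-split
    avoids-v : All (Avoids v) (P ++ R)
    avoids-v = All.++⁺ (ends-avoid P (All.++⁻ˡ (ends P) (C-all off-centre))) avoids
    σ : StarBoundary v L t
    σ = star-boundary L (All.++⁻ʳ (ends P) (C-all off-centre)) (subst (λ i → Reachable i t) (sym #L) reach)
    β′ : Fin ν → ℤ₃
    β′ w = β w ⊖ boundary σ w
    #C : length C ≡ p + p + i
    #C = trans (↭-length C-split) (trans (List.length-++ (ends P)) (cong₂ _+_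
      (trans (length-ends P) (cong₂ _+_ #P #P)) #L))
    #E′ : length (P ++ R) ≡ p + length R
    #E′ = trans (List.length-++ P) (cong (_+ length R) #P)
    shorter : length (P ++ R) < length E
    shorter = lin (length (P ++ R) ∷ length R ∷ length C ∷ length E ∷ p ∷ i ∷ [])
      (λ e′ r c e p i → (e′ :≡ p :+ r) ∷ (c :≡˘ p :+ p :+ i) ∷ (e :≡˘ c :+ r) ∷ (con 1 :≤ p :+ i) ∷ [] ⊢
        con 1 :+ e′ :≤ e) (#E′ , #C , length-split D , 1≤p+i)
    whole : E ≋ star v L ++ star v (ends P) ++ R
    whole = ≋-trans star-split (≋-trans (star-↭ v R (↭-trans C-split (++-comm (ends P) L)))
      (≡⇒≋ (trans (cong (_++ R) (List.map-++ (v ,_) L (ends P))) (List.++-assoc (star v L) _ R))))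
    I : Instance (W − v) (P ++ R) β′
    I = record
      { root   = ∈-− {W = W} root (v≢z ∘ sym)
      ; within = within-− (All.++⁺ (within-ends P (All.++⁻ˡ (ends P) (C-all C⊆W)))
                   (All.++⁻ʳ (star v C) (within-≋ star-split within))) avoids-v
      ; sparse = λ X ne _ _ _ → sparse′ X ne
      -- Of the 2p + i edges at `v`, p come back as lifted edges. The loss p + i ≤ 3 is paid for by
      -- the one vertex.
      ; dense  = lin (card W ∷ card (W − v) ∷ length (P ++ R) ∷ length R ∷ length C ∷ length E ∷ p ∷ i ∷ [])
          (λ w w′ e′ r c e p i → 3 ⨾ (w :≡˘ con 1 :+ w′) ∷ (e′ :≡˘ p :+ r) ∷ (c :≡ p :+ p :+ i) ∷
            (e :≡ c :+ r) ∷ (3 :* w :≡ e :+ con 4) ∷ (p :+ i :≤ con 3) ∷ [] ⊢ 3 :* w′ :≤ e′ :+ con 4)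
          (card-− {W = W} v∈W , #E′ , #C , length-split D , exact , p+i≤3)
      ; good   = good′
      }
      where
      good′ : ∀ w → (W − v) w ≡ true → w ≢ z → Good w (P ++ R) β′
      good′ w w∈ w≢z with ∈-−⁻ W w∈
      ... | w∈W , w≢v = finish (count w L) refl (good w w∈W w≢z)
        where
        new : degree w (P ++ R) ≡ count w (ends P) + degree w R
        new = trans (∑ᵉ-++ (touching w) P R) (cong (_+ degree w R) (degree-ends w P))
        total-count : count w C ≡ count w (ends P) + count w L
        total-count = trans (∑-↭ _ C-split) (∑-++ _ (ends P) L)
        compare : degree w E ≡ degree w (P ++ R) + count w L
        compare = lin (degree w E ∷ degree w (P ++ R) ∷ count w L ∷ count w C ∷ count w (ends P) ∷ degree w R ∷ [])
          (λ d d′ l c x r → (d :≡ c :+ r) ∷ (c :≡ x :+ l) ∷ (d′ :≡˘ x :+ r) ∷ [] ⊢ d :≡ d′ :+ l)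
          (degree-other D w≢v , total-count , new)
        smaller : ∀ {b} → degree w E ≤ b → degree w (P ++ R) ≤ b
        smaller = ≤-trans (≤-trans (m≤m+n _ (count w L)) (≤-reflexive (sym compare)))
        -- Lifting preserves the degrees of the ends. A vertex of degree 6 either loses an unlifted
        -- edge or is not reached by the star, and then its prescription stays 0.
        finish : ∀ l → count w L ≡ l → Good w E β → Good w (P ++ R) β′
        finish _       _  (inj₁ d≤5)        = inj₁ (smaller d≤5)
        finish zero    #l (inj₂ (d≤6 , βw)) = inj₂ (smaller d≤6 ,
          cong₂ _⊖_ βw (elsewhere σ w w≢v (count-zero #l)))
        finish (suc l) #l (inj₂ (d≤6 , _))  = inj₁
          (lin (degree w E ∷ degree w (P ++ R) ∷ count w L ∷ l ∷ [])
            (λ d d′ c l → (d :≤ con 6) ∷ (d :≡˘ d′ :+ c) ∷ (c :≡˘ con 1 :+ l) ∷ [] ⊢ d′ :≤ con 5)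
            (d≤6 , compare , #l))

-- Degrees and root edges in an unsolvable instance

mult-avoids : ∀ {x : Fin ν} y {R} → All (Avoids x) R → mult x y R ≡ 0
mult-avoids y [] = refl
mult-avoids {x = x} y {(a , b) ∷ R} ((a≢x , b≢x) ∷ av)
  rewrite ≢⇒== (a≢x ∘ sym) | ≢⇒== (b≢x ∘ sym) | Bool.∧-zeroʳ (y == a) = mult-avoids y av

mult-star : ∀ {x y : Fin ν} C → y ≢ x → mult x y (star x C) ≡ count y C
mult-star {x = x} {y} C y≢x = trans (∑ᵉ-star (joining x y) x C) (∑-cong C λ c _ → cong ⟦_⟧ (step c))
  where
  step : ∀ c → ((x == x) ∧ (y == c)) ∨ ((y == x) ∧ (x == c)) ≡ (y == c)
  step c rewrite ==-refl x | ≢⇒== y≢x = Bool.∨-identityʳ (y == c)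

pull-count : ∀ {w : Fin ν} C → 1 ≤ count w C → ∃ λ C′ → C ↭ w ∷ C′
pull-count {w = w} C h with pull ⁅ w ⁆ C h
... | c , C′ , p , w==c with refl ← ==⇒≡ {a = w} {c} w==c = C′ , p

pull-all : ∀ (w : Fin ν) C → ∃ λ C′ → C ↭ replicate (count w C) w ++ C′ × All (_≢ w) C′
pull-all w []      = [] , ↭.refl , []
pull-all w (c ∷ C) with pull-all w C | w ≟ᶠ c
... | C′ , p , h | yes refl = C′ , prep c p , h
... | C′ , p , h | no w≢c   = c ∷ C′ ,
  ↭-trans (prep c p) (↭-sym (shift c (replicate (count w C) w) C′)) , (w≢c ∘ sym) ∷ h

module Reductions {ν} (z : Fin ν) where

  open Rooted z

  mult-split : ∀ {v w E} (D : Decomposition v E) → w ≢ v → mult v w E ≡ count w (Decomposition.C D)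
  mult-split {v} {w} D w≢v = trans (∑ᵉ-≋ (joining-sym v w) split)
    (trans (∑ᵉ-++ (joining v w) (star v C) R)
      (trans (cong₂ _+_ (mult-star C w≢v) (mult-avoids w avoids)) (+-identityʳ _)))
    where open Decomposition D

  module _ {W E β} (X : Exact W E β) (below : Below E) (unsolved : ¬ Solution W E β) where
    open Exact X

    -- The edges that avoid `v` lie inside `W − v`, where sparsity admits at most 3|W| - 6 of the
    -- 3|W| - 4 edges.
    edges-at : ∀ {v} → W v ≡ true → v ≢ z → 2 ≤ degree v E
    edges-at {v} v∈W v≢z =
      lin (degree v E ∷ length C ∷ length R ∷ length E ∷ e[ V ] R ∷ e[ V ] (star v C) ∷ e[ V ] E ∷ card W ∷ card V ∷ [])
        (λ d c r l eR eS e w x → (d :≡˘ c) ∷ (l :≡ c :+ r) ∷ (eR :≡˘ r) ∷ (e :≡˘ eS :+ eR) ∷ (e :+ con 3 :≤ 3 :* x) ∷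
          3 ⨾ (w :≡˘ con 1 :+ x) ∷ (3 :* w :≡ l :+ con 4) ∷ [] ⊢ con 2 :≤ d)
        (degree-split D , length-split D , all-inside , trans (∑ᵉ-≋ (inside-sym V) split) (∑ᵉ-++ (inside V) (star v C) R) ,
         sparse V (z , ∈-− {W = W} root (v≢z ∘ sym)) , card-− {W = W} v∈W , exact)
      where
      D = decompose v sparse
      open Decomposition D
      V = W − v
      all-inside : e[ V ] R ≡ length R
      all-inside = trans (∑-cong R λ e e∈R → let a , b = All.lookup within-R e∈R in
        ⟦true⟧ (cong₂ _∧_ a b)) (∑-1 R)
        where
        within-R : Within V R
        within-R = within-− (All.++⁻ʳ (star v C) (within-≋ split within)) avoids

    lifts-at : ∀ {v} (D : Decomposition v E) p i → p + i ≡ 3 → degree v E ≡ p + (p + i) →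
               ¬ ¬ Lifts p i (Decomposition.R D) (Decomposition.C D)
    lifts-at {v} D p i p+i≡3 d = lift-all p i R C (sparse-++ʳ (star v C) (sparse-≋ split sparse))
      (subst (λ j → Bounded j R C) (sym p+i≡3) (bounded-star {v = v} {C} {R} (sparse-≋ split sparse)))
      (trans (sym (degree-split D)) d)
      where open Decomposition D

    -- For degree d the two equations mean p = d - 3 and i = 6 - d.
    settle : ∀ {v} → W v ≡ true → v ≢ z → ∀ p i → p + i ≡ 3 → degree v E ≡ p + (p + i) →
             Reachable i (β v) → ⊥
    settle {v} v∈W v≢z p i p+i≡3 d reach = lifts-at D p i p+i≡3 d λ ls →
        remove-vertex X v∈W v≢z D ls (≤-reflexive p+i≡3) (subst (1 ≤_) (sym p+i≡3) (s≤s z≤n)) reach below λ where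
          (f , at , f-v , h) → unsolved (f , at , λ w w∈W w≢z → case w ≟ᶠ v of λ where
            (yes refl) → f-v
            (no w≢v)   → h w w∈W w≢z w≢v)
      where D = decompose v sparse

    -- At degree 2 nothing is lifted. Deleting `v` loses two edges where three are permitted, and
    -- two signs reach every prescription.
    settle₂ : ∀ {v} → W v ≡ true → v ≢ z → degree v E ≡ 2 → ⊥
    settle₂ {v} v∈W v≢z d =
        remove-vertex X v∈W v≢z D (no-lifts (trans (sym (degree-split D)) d) (sparse-++ʳ (star v C) (sparse-≋ split sparse)))
          (s≤s (s≤s z≤n)) (s≤s z≤n) (reach₂₊ {t = β v}) below λ where
          (f , at , f-v , h) → unsolved (f , at , λ w w∈W w≢z → case w ≟ᶠ v of λ where
            (yes refl) → f-v
            (no w≢v)   → h w w∈W w≢z w≢v)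
      where
      D = decompose v sparse
      open Decomposition D

    degree≡5 : ∀ {v} → W v ≡ true → v ≢ z → degree v E ≡ 5 × β v ≡ 𝟘
    degree≡5 {v} v∈W v≢z = by-degree (degree v E) refl (edges-at v∈W v≢z) (good v v∈W v≢z)
      where
      by-degree : ∀ d → degree v E ≡ d → 2 ≤ d → Good v E β → degree v E ≡ 5 × β v ≡ 𝟘
      by-degree 1 _ (s≤s ()) _
      by-degree 2 d _ _ = ⊥-elim (settle₂ v∈W v≢z d)
      by-degree 3 d _ _ = ⊥-elim (settle v∈W v≢z 0 3 refl d reach₂₊)
      by-degree 4 d _ _ = ⊥-elim (settle v∈W v≢z 1 2 refl d reach₂₊)
      by-degree 5 d _ _ with β v in eq
      ... | 𝟘 = d , refl
      ... | 𝟙 = ⊥-elim (settle v∈W v≢z 2 1 refl d (subst (Reachable 1) (sym eq) reach₁⁺))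
      ... | 𝟚 = ⊥-elim (settle v∈W v≢z 2 1 refl d (subst (Reachable 1) (sym eq) reach₁⁻))
      by-degree (suc (suc (suc (suc (suc (suc d)))))) eq _ (inj₁ h) with () ← ≤⇒≯ h (subst (5 <_) (sym eq) (m≤m+n 6 d))
      by-degree 6 d _ (inj₂ (_ , βv)) = ⊥-elim (settle v∈W v≢z 3 0 refl d (subst (Reachable 0) (sym βv) reach₀))
      by-degree (suc (suc (suc (suc (suc (suc (suc d))))))) eq _ (inj₂ (h , _))
        with () ← ≤⇒≯ h (subst (6 <_) (sym eq) (m≤m+n 7 d))

    -- Two edges vz could be reoriented at the end to give v any boundary.
    root-mult≤1 : ∀ {v} → W v ≡ true → v ≢ z → mult v z E ≤ 1
    root-mult≤1 {v} v∈W v≢z = ≮⇒≥ λ 2≤ → double (subst (2 ≤_) (mult-split D (v≢z ∘ sym)) 2≤)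
      where
      D = decompose v sparse
      open Decomposition D
      double : 2 ≤ count z C → ⊥
      double 2≤ with pull-count C (≤-trans (s≤s z≤n) 2≤)
      ... | C₁ , p with pull-count C₁ (+-cancelˡ-≤ 1 _ _ (subst (2 ≤_)
                (trans (∑-↭ _ p) (cong (_+ count z C₁) (⟦true⟧ (==-refl z)))) 2≤))
      -- The boundary 𝟙 at `v` is provisional: a single unlifted edge can reach it. The two edges to
      -- `z` then correct it to `β v`, and the effect on `z` is harmless.
      ... | C₂ , q = lifts-at D 2 1 refl (proj₁ (degree≡5 v∈W v≢z)) λ ls →
        remove-vertex X v∈W v≢z D ls ≤-refl (s≤s z≤n) reach₁⁺ below λ where
          (f , at , _ , h) → let g , sh , g-v = parallel-shift v≢z (attains-≋ (≋-sym twice) {f = f} at) (β v) in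
            unsolved (g , attains-≋ twice (attains sh) , λ w w∈W w≢z → case w ≟ᶠ v of λ where
              (yes refl) → g-v
              (no w≢v)   → trans (off sh w w≢v w≢z) (h w w∈W w≢z w≢v))
        where
        twice : E ≋ (v , z) ∷ (v , z) ∷ (star v C₂ ++ R)
        twice = ≋-trans split (star-↭ v R (↭-trans p (prep z q)))

-- Parallel edges away from the root

star-++ : ∀ (v : Fin ν) C D → star v (C ++ D) ≡ star v C ++ star v D
star-++ v C D = List.map-++ (v ,_) C D

add-parallel : ∀ {x y : Fin ν} {F f} → x ≢ y → Attains F f → ∃ (Shifted x y ((x , y) ∷ F) f)
add-parallel {x = x} {y} {f = f} x≢y p = (λ w → f w ⊕ χ true (x , y) w) , shifted
  (attains-∷ true (x , y) {f = f} p)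
  (regroup (f x) (f y) _ _ (χ-pair true x≢y))
  (λ w w≢x w≢y → trans (cong (f w ⊕_) (χ-off true w≢x w≢y)) (⊕-identityʳ (f w)))
  where
  regroup : ∀ a b c d → c ⊕ d ≡ 𝟘 → a ⊕ c ⊕ (b ⊕ d) ≡ a ⊕ b
  regroup = toWitness {a? = ∀₃ λ a → ∀₃ λ b → ∀₃ λ c → ∀₃ λ d → (_ ≟₃ _) →-dec (_ ≟₃ _)} tt

add-parallels : ∀ {x y : Fin ν} m {F f} → x ≢ y → Attains F f → ∃ (Shifted x y (star x (replicate m y) ++ F) f)
add-parallels zero    x≢y p = _ , shifted-refl p
add-parallels (suc m) x≢y p = let g , q = add-parallels m x≢y p ; h , r = add-parallel x≢y (attains q) in
  h , shifted-trans q r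

hits-replicate : ∀ (X : VSet ν) m {y} → X y ≡ true → hits X (replicate m y) ≡ m
hits-replicate X zero    y∈X = refl
hits-replicate X (suc m) y∈X = cong₂ _+_ (⟦true⟧ y∈X) (hits-replicate X m y∈X)

mult-≤-inside : ∀ (x y : Fin ν) E → mult x y E ≤ e[ ⁅ x ⁆ ∪ ⁅ y ⁆ ] E
mult-≤-inside x y E = ∑-mono E λ (a , b) _ → taut (x == a) (x == b) (y == a) (y == b)
  where
  taut : ∀ p q r s → ⟦ (p ∧ s) ∨ (r ∧ q) ⟧ ≤ ⟦ (p ∨ r) ∧ (q ∨ s) ⟧
  taut = toWitness {a? = ∀ᵇ λ p → ∀ᵇ λ q → ∀ᵇ λ r → ∀ᵇ λ s → _ ≤? _} tt

module Parallel {ν} (z : Fin ν) where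

  open Rooted z
  open Reductions z

  module _ {W E β} (X : Exact W E β) (below : Below E) (unsolved : ¬ Solution W E β)
           (deg5 : ∀ {v} → W v ≡ true → v ≢ z → degree v E ≡ 5 × β v ≡ 𝟘) where
    open Exact X

    -- Two parallel edges xy absorb any boundary, so x and y are removed together; of the edges
    -- leaving {x, y} all but two are lifted, as if x and y were one vertex.
    parallel≤1 : ∀ {x y} → W x ≡ true → W y ≡ true → x ≢ z → y ≢ z → x ≢ y → mult x y E ≤ 1
    parallel≤1 {x} {y} x∈W y∈W x≢z y≢z x≢y = ≮⇒≥ λ 2≤m → by-mult (mult x y E) refl 2≤m
      -- Two vertices span at most 3 · 2 - 3 = 3 edges.
      (lin (mult x y E ∷ e[ ⁅ x ⁆ ∪ ⁅ y ⁆ ] E ∷ card (⁅ x ⁆ ∪ ⁅ y ⁆) ∷ card ⁅ x ⁆ ∷ [])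
        (λ m e c a → (m :≤ e) ∷ (e :+ con 3 :≤ 3 :* c) ∷ 3 ⨾ (c :≤ con 1 :+ a) ∷ 3 ⨾ (a :≡ con 1) ∷ [] ⊢ m :≤ con 3)
        (mult-≤-inside x y E , sparse (⁅ x ⁆ ∪ ⁅ y ⁆) (x , cong (_∨ (y == x)) (==-refl x)) ,
         card-∪-⁅⁆ ⁅ x ⁆ y , card-⁅⁆ x))
      where
      D₁ = decompose x sparse
      open Decomposition D₁ using () renaming (C to Cx; R to R₁; split to split₁; avoids to avoids₁; off-centre to off-centre₁)
      sparse₁ : Sparse R₁
      sparse₁ = sparse-++ʳ (star x Cx) (sparse-≋ split₁ sparse)
      D₂ = decompose y sparse₁
      open Decomposition D₂ using (R) renaming (C to Cy; split to split₂; avoids to avoids₂; off-centre to off-centre₂)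
      m = count y Cx
      Cx′ = proj₁ (pull-all y Cx)
      Cx-split : Cx ↭ replicate m y ++ Cx′
      Cx-split = proj₁ (proj₂ (pull-all y Cx))
      C = Cx′ ++ Cy
      #m : mult x y E ≡ m
      #m = mult-split D₁ (x≢y ∘ sym)
      avoids-x : All (Avoids x) (star y Cy ++ R)
      avoids-x = avoids-≋ split₂ avoids₁
      C≢x : All (_≢ x) C
      C≢x = All.++⁺ (All.++⁻ʳ (replicate m y) (All-resp-↭ Cx-split off-centre₁))
        (All.map proj₂ (All.map⁻ (All.++⁻ˡ (star y Cy) avoids-x)))
      C≢y : All (_≢ y) C
      C≢y = All.++⁺ (proj₂ (proj₂ (pull-all y Cx))) off-centre₂
      C⊆W : All (λ c → W c ≡ true) C
      C⊆W = All.++⁺ (All.++⁻ʳ (replicate m y) (All-resp-↭ Cx-split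
                      (within-star Cx (All.++⁻ˡ (star x Cx) (within-≋ split₁ within)))))
                    (within-star Cy (All.++⁻ˡ (star y Cy) (within-≋ split₂ within-R₁)))
        where within-R₁ = All.++⁻ʳ (star x Cx) (within-≋ split₁ within)
      R⊆W : Within W R
      R⊆W = All.++⁻ʳ (star y Cy) (within-≋ split₂ (All.++⁻ʳ (star x Cx) (within-≋ split₁ within)))
      hits-Cx : ∀ V → hits V Cx ≡ hits V (replicate m y) + hits V Cx′
      hits-Cx V = trans (∑-↭ (⟦_⟧ ∘ V) Cx-split) (∑-++ (⟦_⟧ ∘ V) (replicate m y) Cx′)
      #Cx : length Cx ≡ m + length Cx′
      #Cx = trans (↭-length Cx-split) (trans (List.length-++ (replicate m y))
        (cong (_+ length Cx′) (List.length-replicate m)))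
      -- The two degrees sum to 10 and count each of the `m` parallel edges twice.
      #C : length C + 2 * m ≡ 10
      #C = lin (length C ∷ length Cx′ ∷ length Cy ∷ length Cx ∷ m ∷ degree x E ∷ degree y E ∷ degree y R₁ ∷ [])
        (λ c c₁ c₂ cx m dx dy dr → (c :≡ c₁ :+ c₂) ∷ (cx :≡˘ m :+ c₁) ∷ (dx :≡˘ cx) ∷ (dy :≡˘ m :+ dr) ∷
          (dr :≡˘ c₂) ∷ (dx :≡ con 5) ∷ (dy :≡ con 5) ∷ [] ⊢ c :+ 2 :* m :≡ con 10)
        (List.length-++ Cx′ , #Cx , degree-split D₁ , degree-other D₁ (x≢y ∘ sym) ,
         degree-split D₂ , proj₁ (deg5 x∈W x≢z) , proj₁ (deg5 y∈W y≢z))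
      #E : length E ≡ m + length C + length R
      #E = lin (length E ∷ length Cx ∷ length R₁ ∷ m ∷ length Cx′ ∷ length Cy ∷ length C ∷ length R ∷ [])
        (λ e cx r₁ m c₁ c₂ c r → (e :≡ cx :+ r₁) ∷ (cx :≡ m :+ c₁) ∷ (r₁ :≡ c₂ :+ r) ∷ (c :≡˘ c₁ :+ c₂) ∷ [] ⊢
          e :≡ m :+ c :+ r)
        (length-split D₁ , #Cx , length-split D₂ , List.length-++ Cx′)

      -- Adding `x` and `y` to `V` costs 6, and the enlarged set also spans the `m` parallel edges;
      -- 6 - m = p + 2.
      bounded : ∀ p → p + m ≡ 4 → Bounded (p + 2) R C
      bounded p p+m V ne =
        lin (e[ V ] R ∷ e[ Y ] R ∷ hits V C ∷ hits Y C ∷ hits Y Cx′ ∷ hits Y Cy ∷ hits Y Cx ∷ hits Y (replicate m y) ∷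
             e[ Y ] R₁ ∷ e[ Y ] E ∷ m ∷ card V ∷ card (V ∪ ⁅ x ⁆) ∷ card Y ∷ p ∷ [])
          (λ e e′ h h′ h₁ h₂ hx hr e₁ eE m v v₁ y p → (e :≤ e′) ∷ (h :≤ h′) ∷ (h′ :≡ h₁ :+ h₂) ∷ (hx :≡˘ hr :+ h₁) ∷
            (hr :≡˘ m) ∷ (e₁ :≡˘ h₂ :+ e′) ∷ (eE :≡˘ hx :+ e₁) ∷ (eE :+ con 3 :≤ 3 :* y) ∷
            3 ⨾ (y :≤ con 1 :+ v₁) ∷ 3 ⨾ (v₁ :≤ con 1 :+ v) ∷ (p :+ m :≡˘ con 4) ∷ [] ⊢
            e :+ h :+ con 3 :≤ 3 :* v :+ (p :+ con 2))
          (e-mono V⊆Y R , hits-mono V⊆Y C , ∑-++ (⟦_⟧ ∘ Y) Cx′ Cy , hits-Cx Y , hits-replicate Y m y∈Y ,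
           trans (∑ᵉ-≋ (inside-sym Y) split₂) (trans (∑ᵉ-++ (inside Y) (star y Cy) R) (cong (_+ e[ Y ] R) (e-star Cy y∈Y))) ,
           trans (∑ᵉ-≋ (inside-sym Y) split₁) (trans (∑ᵉ-++ (inside Y) (star x Cx) R₁) (cong (_+ e[ Y ] R₁) (e-star Cx x∈Y))) ,
           sparse Y (x , x∈Y) , card-∪-⁅⁆ (V ∪ ⁅ x ⁆) y , card-∪-⁅⁆ V x , p+m)
        where
        Y = V ∪ ⁅ x ⁆ ∪ ⁅ y ⁆
        y∈Y : Y y ≡ true
        y∈Y = ∈-∪-⁅⁆ (V ∪ ⁅ x ⁆) y
        x∈Y : Y x ≡ true
        x∈Y = ⊆-∪ˡ (V ∪ ⁅ x ⁆) ⁅ y ⁆ x (∈-∪-⁅⁆ V x)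
        V⊆Y : V ⊆ Y
        V⊆Y v h = ⊆-∪ˡ (V ∪ ⁅ x ⁆) ⁅ y ⁆ v (⊆-∪ˡ V ⁅ x ⁆ v h)

      -- Deleting `x` and `y` removes 10 - m edges and the lifts return p. The condition p + m = 4
      -- makes the loss 6, as two vertices require, and leaves 10 - 2m - 2p = 2 edges unlifted.
      remove : ∀ p → p + m ≡ 4 → 2 ≤ m → Lifts p 2 R C → ⊥
      remove p p+m 2≤m (lifts P L C-split #P #L sparse′) = below shorter I solved
        where
        C-all : ∀ {Q : Fin ν → Set} → All Q C → All Q (ends P ++ L)
        C-all = All-resp-↭ C-split
        -- At first only the total at `x` and `y` is arranged; two unlifted edges reach any value.
        t = β x ⊕ β y
        σ : StarBoundary x L t
        σ = star-boundary L (All.++⁻ʳ (ends P) (C-all C≢x)) (subst (λ i → Reachable i t) (sym #L) reach₂₊)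
        W′ = W − x − y
        β′ : Fin ν → ℤ₃
        β′ w = β w ⊖ boundary σ w
        #E′ : length (P ++ R) ≡ p + length R
        #E′ = trans (List.length-++ P) (cong (_+ length R) #P)
        shorter : length (P ++ R) < length E
        shorter = lin (length (P ++ R) ∷ length R ∷ length C ∷ length E ∷ p ∷ m ∷ [])
          (λ e′ r c e p m → (e′ :≡ p :+ r) ∷ (e :≡˘ m :+ c :+ r) ∷ (c :+ 2 :* m :≡˘ con 10) ∷ (p :+ m :≡ con 4) ∷ [] ⊢
            con 1 :+ e′ :≤ e)
          (#E′ , #E , #C , p+m)
        avoids-x′ : All (Avoids x) (P ++ R)
        avoids-x′ = All.++⁺ (ends-avoid P (All.++⁻ˡ (ends P) (C-all C≢x))) (All.++⁻ʳ (star y Cy) avoids-x)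
        avoids-y′ : All (Avoids y) (P ++ R)
        avoids-y′ = All.++⁺ (ends-avoid P (All.++⁻ˡ (ends P) (C-all C≢y))) avoids₂
        y∈W−x : (W − x) y ≡ true
        y∈W−x = ∈-− {W = W} y∈W (x≢y ∘ sym)
        I : Instance W′ (P ++ R) β′
        I = record
          { root   = ∈-− {W = W − x} (∈-− {W = W} root (x≢z ∘ sym)) (y≢z ∘ sym)
          ; within = within-− {W = W − x} (within-− {W = W} (All.++⁺ (within-ends P (All.++⁻ˡ (ends P) (C-all C⊆W))) R⊆W) avoids-x′) avoids-y′
          ; sparse = λ V ne _ _ _ → sparse′ V ne
          ; dense  = lin (card W ∷ card (W − x) ∷ card W′ ∷ length (P ++ R) ∷ length R ∷ length C ∷ length E ∷ p ∷ m ∷ [])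
              (λ w w₁ w′ e′ r c e p m → 3 ⨾ (w :≡˘ con 1 :+ w₁) ∷ 3 ⨾ (w₁ :≡˘ con 1 :+ w′) ∷ (e′ :≡˘ p :+ r) ∷
                (e :≡ m :+ c :+ r) ∷ (3 :* w :≡ e :+ con 4) ∷ (c :+ 2 :* m :≡ con 10) ∷ (p :+ m :≡˘ con 4) ∷ [] ⊢
                3 :* w′ :≤ e′ :+ con 4)
              (card-− {W = W} x∈W , card-− {W = W − x} y∈W−x , #E′ , #E , exact , #C , p+m)
          ; good   = λ w w∈ w≢z → let w∈₁ , w≢y = ∈-−⁻ (W − x) w∈ ; w∈W , w≢x = ∈-−⁻ W w∈₁ in
              inj₁ (lin (degree w (P ++ R) ∷ count w (ends P) ∷ degree w P ∷ degree w R ∷ count w L ∷ count w C ∷ count w Cx′ ∷ count w Cy ∷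
                         count w Cx ∷ count w (replicate m y) ∷ degree w R₁ ∷ degree w E ∷ [])
                (λ d′ a dP r l c c₁ c₂ cx cr r₁ d → (d′ :≡ dP :+ r) ∷ (dP :≡ a) ∷ (c :≡˘ a :+ l) ∷ (c :≡ c₁ :+ c₂) ∷
                  (cx :≡˘ cr :+ c₁) ∷ (r₁ :≡˘ c₂ :+ r) ∷ (d :≡˘ cx :+ r₁) ∷ (d :≡ con 5) ∷ [] ⊢ d′ :≤ con 5)
                (∑ᵉ-++ (touching w) P R , degree-ends w P , trans (∑-↭ _ C-split) (∑-++ _ (ends P) L) ,
                 ∑-++ _ Cx′ Cy , hits-Cx ⁅ w ⁆ , degree-other D₂ w≢y , degree-other D₁ w≢x ,
                 proj₁ (deg5 w∈W w≢z)))
          }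
        reorder : star x L ++ star x (ends P) ++ R ≋ star x Cy ++ star x Cx′ ++ R
        reorder = ≋-trans (≡⇒≋ (trans (sym (List.++-assoc (star x L) _ R)) (cong (_++ R) (sym (star-++ x L (ends P))))))
          (≋-trans (star-↭ x R (↭-trans (++-comm L (ends P)) (↭-trans (↭-sym C-split) (++-comm Cx′ Cy))))
            (≡⇒≋ (trans (cong (_++ R) (star-++ x Cy Cx′)) (List.++-assoc (star x Cy) _ R))))
        regroup : star y Cy ++ star x Cx′ ++ R ≋ star x Cx′ ++ R₁
        regroup = ≋-trans (≡⇒≋ (sym (List.++-assoc (star y Cy) (star x Cx′) R)))
          (≋-trans (↭⇒≋ (++⁺ʳ R (++-comm (star y Cy) (star x Cx′))))
            (≋-trans (≡⇒≋ (List.++-assoc (star x Cx′) (star y Cy) R)) (++⁺ʳ-≋ (star x Cx′) (≋-sym split₂))))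
        whole : ∀ k → m ≡ 2 + k → E ≋ (x , y) ∷ (x , y) ∷ star x (replicate k y) ++ (star x Cx′ ++ R₁)
        whole k m≡ = ≋-trans split₁ (≋-trans (star-↭ x R₁ Cx-split)
          (≡⇒≋ (trans (cong (_++ R₁) (star-++ x (replicate m y) Cx′))
            (trans (List.++-assoc (star x (replicate m y)) _ R₁)
              (cong (λ m → star x (replicate m y) ++ star x Cx′ ++ R₁) m≡)))))
        solved : Solution W′ (P ++ R) β′ → ⊥
        solved (f , at , h) with m≤n⇒∃[o]m+o≡n 2≤m
        ... | k , 2+k≡m = unsolved (g₄ , attains-≋ (whole k (sym 2+k≡m)) (attains sh₄) , correct)
          where
          f₁ : Fin ν → ℤ₃
          f₁ w = f w ⊕ boundary σ w
          at₁ : Attains (star x Cy ++ star x Cx′ ++ R) f₁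
          at₁ = attains-≋ (≋-sym reorder) (attaining σ (attains-lifts x P at))
          -- So far all edges were treated as edges at `x`. Returning those of `y`, inserting the
          -- parallel edges and reorienting two of them only transfers boundary between `x` and `y`,
          -- so the total stays `t` and correctness at `x` implies correctness at `y`.
          moved = move-star Cy x≢y at₁
          sh₂ = proj₂ moved
          f₂ = proj₁ moved
          added = add-parallels (2 + k) x≢y (attains-≋ (≋-sym regroup) {f = f₂} (attains sh₂))
          f₃ = proj₁ added
          sh₃ = proj₂ added
          final = parallel-shift {f = f₃} x≢y (attains sh₃) (β x)
          g₄ = proj₁ final
          sh₄ = proj₁ (proj₂ final)
          y∉L : y ∉ L
          y∉L y∈L = All.lookup (All.++⁻ʳ (ends P) (C-all C≢y)) y∈L refl
          conserved : g₄ x ⊕ g₄ y ≡ β x ⊕ β y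
          conserved = begin
            g₄ x ⊕ g₄ y ≡⟨ trans (balanced sh₄) (trans (balanced sh₃) (balanced sh₂)) ⟩
            f₁ x ⊕ f₁ y ≡⟨ cong₂ _⊕_ (cong₂ _⊕_ (attains-avoids avoids-x′ at) (at-centre σ))
                              (cong₂ _⊕_ (attains-avoids avoids-y′ at) (elsewhere σ y (x≢y ∘ sym) y∉L)) ⟩
            t ⊕ 𝟘       ≡⟨ ⊕-identityʳ t ⟩
            t           ∎
            where open ≡-Reasoning
          cancel : ∀ a b c d → a ≡ c → a ⊕ b ≡ c ⊕ d → b ≡ d
          cancel = toWitness {a? = ∀₃ λ a → ∀₃ λ b → ∀₃ λ c → ∀₃ λ d → (_ ≟₃ _) →-dec ((_ ≟₃ _) →-dec (_ ≟₃ _))} tt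
          at-x : g₄ x ≡ β x
          at-x = proj₂ (proj₂ final)
          at-y : g₄ y ≡ β y
          at-y = cancel (g₄ x) (g₄ y) (β x) (β y) at-x conserved
          elsewhere′ : ∀ w → W w ≡ true → w ≢ z → w ≢ x → w ≢ y → g₄ w ≡ β w
          elsewhere′ w w∈W w≢z w≢x w≢y = begin
            g₄ w                          ≡⟨ trans (off sh₄ w w≢x w≢y) (trans (off sh₃ w w≢x w≢y) (off sh₂ w w≢x w≢y)) ⟩
            f w ⊕ boundary σ w            ≡⟨ cong (_⊕ boundary σ w) (h w (∈-− {W = W − x} (∈-− {W = W} w∈W w≢x) w≢y) w≢z) ⟩
            β w ⊖ boundary σ w ⊕ boundary σ w ≡⟨ ⊖-⊕ (β w) _ ⟩
            β w                           ∎
            where open ≡-Reasoning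
          correct : ∀ w → W w ≡ true → w ≢ z → g₄ w ≡ β w
          correct w w∈W w≢z = by-cases (w ≟ᶠ x) (w ≟ᶠ y)
            where
            by-cases : Dec (w ≡ x) → Dec (w ≡ y) → g₄ w ≡ β w
            by-cases (yes w≡x) _         = subst (λ w → g₄ w ≡ β w) (sym w≡x) at-x
            by-cases (no _)    (yes w≡y) = subst (λ w → g₄ w ≡ β w) (sym w≡y) at-y
            by-cases (no w≢x)  (no w≢y)  = elsewhere′ w w∈W w≢z w≢x w≢y

      attempt : ∀ p → p + m ≡ 4 → 2 ≤ m → ⊥
      attempt p p+m 2≤m = lift-all p 2 R C (sparse-++ʳ (star y Cy) (sparse-≋ split₂ sparse₁)) (bounded p p+m)
        (lin (length C ∷ m ∷ p ∷ []) (λ c m p → (c :+ 2 :* m :≡ con 10) ∷ 2 ⨾ (p :+ m :≡˘ con 4) ∷ [] ⊢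
          c :≡ p :+ (p :+ con 2)) (#C , p+m))
        (remove p p+m 2≤m)

      by-mult : ∀ k → mult x y E ≡ k → 2 ≤ k → k ≤ 3 → ⊥
      by-mult 1 _  (s≤s ()) _
      by-mult 2 eq _ _ = attempt 2 (cong (2 +_) (trans (sym #m) eq)) (≤-reflexive (sym (trans (sym #m) eq)))
      by-mult 3 eq _ _ = attempt 1 (cong (1 +_) (trans (sym #m) eq))
        (≤-trans (n≤1+n 2) (≤-reflexive (sym (trans (sym #m) eq))))
      by-mult (suc (suc (suc (suc k)))) _ _ (s≤s (s≤s (s≤s ())))

-- Cuts in the graph without the root

crossing : (xa xb za zb : Bool) → ℕ
crossing xa xb za zb = ⟦ ((xa ∧ not xb) ∨ (xb ∧ not xa)) ∧ (not za ∧ not zb) ⟧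

not-even : ∀ a b → 1 + 2 * a ≡ 2 * b → ⊥
not-even zero    (suc zero)    ()
not-even zero    (suc (suc b)) ()
not-even (suc a) (suc b) eq = not-even a b (+-cancelˡ-≡ 2 _ _
  (lin (a ∷ b ∷ []) (λ a b → (con 1 :+ 2 :* (con 1 :+ a) :≡ 2 :* (con 1 :+ b)) ∷ [] ⊢
    con 2 :+ (con 1 :+ 2 :* a) :≡ con 2 :+ 2 :* b) eq))

edge-ends-≢ : ∀ {E : List (Edge ν)} → Sparse E → ∀ {a b} → (a , b) ∈ E → a ≢ b
edge-ends-≢ {E = E} sp {a} e∈E refl = lin⊥ (inside ⁅ a ⁆ a a ∷ e[ ⁅ a ⁆ ] E ∷ card ⁅ a ⁆ ∷ [])
  (λ i e c → (con 1 :≤ i) ∷ (i :≤ e) ∷ (e :+ con 3 :≤ 3 :* c) ∷ 3 ⨾ (c :≡ con 1) ∷ [])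
  (≤-reflexive (sym (⟦true⟧ (cong₂ _∧_ (==-refl a) (==-refl a)))) , ∑-≥ _ e∈E , sp ⁅ a ⁆ (a , ==-refl a) , card-⁅⁆ a)

double-count : ∀ (X : VSet ν) (f : Fin ν → A → ℕ) l →
  ∑ (λ v → ⟦ X v ⟧ * ∑ (f v) l) (allFin ν) ≡ ∑ (λ x → ∑ (λ v → ⟦ X v ⟧ * f v x) (allFin ν)) l
double-count X f l = trans (∑-cong (allFin _) λ v _ → sym (∑-* ⟦ X v ⟧ (f v) l)) (∑-swap (λ v x → ⟦ X v ⟧ * f v x) (allFin _) l)

∑-pick : ∀ (X : VSet ν) a → ∑ (λ v → ⟦ X v ⟧ * ⟦ v == a ⟧) (allFin ν) ≡ ⟦ X a ⟧
∑-pick X a = trans (∑-cong (allFin _) λ v _ →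
  trans (*-comm ⟦ X v ⟧ _) (cong (λ b → ⟦ b ⟧ * ⟦ X v ⟧) (==-sym v a))) (∑-δ a (⟦_⟧ ∘ X))

hits-count : ∀ (X : VSet ν) C → hits X C ≡ ∑ (λ v → ⟦ X v ⟧ * count v C) (allFin ν)
hits-count X C = sym (trans (double-count X (λ v c → ⟦ v == c ⟧) C) (∑-cong C λ c _ → ∑-pick X c))

-- Allows a fact about the members of a set to be used in a sum over all vertices that is weighted
-- by membership.
scale : ∀ b {c k} → (b ≡ true → c ≡ k) → c * ⟦ b ⟧ ≡ ⟦ b ⟧ * k
scale true  {c} h = trans (*-comm c 1) (cong (1 *_) (h refl))
scale false {c} h = *-zeroʳ c

guard : ∀ b {c k} → (b ≡ true → ⟦ c ⟧ ≡ k) → ⟦ b ∧ c ⟧ ≡ ⟦ b ⟧ * k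
guard true  h = trans (h refl) (sym (+-identityʳ _))
guard false h = refl

true-≤ᵇ : ∀ {m ν} → (m ≤ᵇ ν) ≡ true → m ≤ ν
true-≤ᵇ {m} {ν} h = ≤ᵇ⇒≤ m ν (subst T (sym h) tt)

module Cuts {ν} (z : Fin ν) (W : VSet ν) (E : List (Edge ν)) where

  U : VSet ν
  U = W − z

  -- d counts the edges leaving X in the graph without z, r those from X to z.
  d[_] : VSet ν → ℕ
  d[ X ] = ∑ᵉ (λ a b → crossing (X a) (X b) (z == a) (z == b)) E

  r[_] : VSet ν → ℕ
  r[ X ] = ∑ᵉ (λ a b → ⟦ X a ∧ (z == b) ⟧ + ⟦ X b ∧ (z == a) ⟧) E

  N : VSet ν
  N v = 1 ≤ᵇ mult v z E

  m[_] : VSet ν → ℕ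
  m[ X ] = card (X ∖ N)

  module Counting
    (root   : W z ≡ true)
    (within : Within W E)
    (sparse : Sparse E)
    (exact  : 3 * card W ≡ length E + 4)
    (deg5   : ∀ {v} → W v ≡ true → v ≢ z → degree v E ≡ 5)
    (root≤1 : ∀ {v} → W v ≡ true → v ≢ z → mult v z E ≤ 1)
    where

    U-z : ∀ {X} → X ⊆ U → X z ≡ false
    U-z {X} X⊆U with bool (X z)
    ... | inj₁ h = ⊥-elim (proj₂ (∈-−⁻ W (X⊆U z h)) refl)
    ... | inj₂ h = h

    off-root : ∀ {X} → X ⊆ U → ∀ a → X a ∧ (z == a) ≡ false
    off-root {X} X⊆U a with z ≟ᶠ a
    ... | yes refl = trans (Bool.∧-identityʳ (X a)) (U-z X⊆U)
    ... | no _     = Bool.∧-zeroʳ (X a)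

    degree-sum : ∀ {X} → X ⊆ U → 5 * card X ≡ 2 * e[ X ] E + d[ X ] + r[ X ]
    degree-sum {X} X⊆U = begin
      5 * card X                                      ≡⟨ ∑-* 5 (⟦_⟧ ∘ X) (allFin ν) ⟨
      ∑ (λ v → 5 * ⟦ X v ⟧) (allFin ν)                ≡⟨ ∑-cong (allFin ν) (λ v _ → five v) ⟩
      ∑ (λ v → ⟦ X v ⟧ * degree v E) (allFin ν)       ≡⟨ double-count X (λ v e → touching v (proj₁ e) (proj₂ e)) E ⟩
      ∑ (λ e → ∑ (λ v → ⟦ X v ⟧ * touching v (proj₁ e) (proj₂ e)) (allFin ν)) E
                                                      ≡⟨ ∑-cong E (λ (a , b) _ → inner a b) ⟩
      ∑ᵉ (λ a b → ⟦ X a ⟧ + ⟦ X b ⟧) E                ≡⟨ ∑-lin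
        (on (λ a b → ⟦ X a ⟧ + ⟦ X b ⟧) ∷ on (inside X) ∷ on (λ a b → crossing (X a) (X b) (z == a) (z == b)) ∷
         on (λ a b → ⟦ X a ∧ (z == b) ⟧ + ⟦ X b ∧ (z == a) ⟧) ∷ [])
        (λ s i c r → s :≡ 2 :* i :+ c :+ r) E
        (λ (a , b) _ → taut (X a) (X b) (z == a) (z == b) (off-root X⊆U a) (off-root X⊆U b)) ⟩
      2 * e[ X ] E + d[ X ] + r[ X ]                  ∎
      where
      open ≡-Reasoning
      on : (Fin ν → Fin ν → ℕ) → Edge ν → ℕ
      on w e = w (proj₁ e) (proj₂ e)
      five : ∀ v → 5 * ⟦ X v ⟧ ≡ ⟦ X v ⟧ * degree v E
      five v = scale (X v) λ v∈X → let v∈W , v≢z = ∈-−⁻ W (X⊆U v v∈X) in sym (deg5 v∈W v≢z)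
      inner : ∀ a b → ∑ (λ v → ⟦ X v ⟧ * touching v a b) (allFin ν) ≡ ⟦ X a ⟧ + ⟦ X b ⟧
      inner a b = trans (∑-cong (allFin ν) λ v _ → *-distribˡ-+ ⟦ X v ⟧ ⟦ v == a ⟧ ⟦ v == b ⟧)
        (trans (∑-+ _ _ (allFin ν)) (cong₂ _+_ (∑-pick X a) (∑-pick X b)))
      taut : ∀ xa xb za zb → xa ∧ za ≡ false → xb ∧ zb ≡ false →
        ⟦ xa ⟧ + ⟦ xb ⟧ ≡ 2 * ⟦ xa ∧ xb ⟧ + crossing xa xb za zb + (⟦ xa ∧ zb ⟧ + ⟦ xb ∧ za ⟧)
      taut = toWitness {a? = ∀ᵇ λ xa → ∀ᵇ λ xb → ∀ᵇ λ za → ∀ᵇ λ zb →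
        (_ Bool.≟ _) →-dec ((_ Bool.≟ _) →-dec (_ ≟ _))} tt

    -- No vertex has two edges to `z`, so counting edges to `z` and counting neighbours of `z`
    -- agree.
    root-sum : ∀ {X} → X ⊆ U → r[ X ] ≡ card (X ∩ N)
    root-sum {X} X⊆U = sym (begin
      card (X ∩ N)                                     ≡⟨ ∑-cong (allFin ν) (λ v _ → neighbour v) ⟩
      ∑ (λ v → ⟦ X v ⟧ * mult v z E) (allFin ν)        ≡⟨ double-count X (λ v e → joining v z (proj₁ e) (proj₂ e)) E ⟩
      ∑ (λ e → ∑ (λ v → ⟦ X v ⟧ * joining v z (proj₁ e) (proj₂ e)) (allFin ν)) E
                                                       ≡⟨ ∑-cong E (λ (a , b) _ → inner a b) ⟩
      r[ X ]                                           ∎)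
      where
      open ≡-Reasoning
      small : ∀ k → k ≤ 1 → ⟦ 1 ≤ᵇ k ⟧ ≡ k
      small 0 _ = refl
      small 1 _ = refl
      small (suc (suc k)) (s≤s ())
      neighbour : ∀ v → ⟦ X v ∧ N v ⟧ ≡ ⟦ X v ⟧ * mult v z E
      neighbour v = guard (X v) λ v∈X → let v∈W , v≢z = ∈-−⁻ W (X⊆U v v∈X) in
        small (mult v z E) (root≤1 v∈W v≢z)
      taut : ∀ x va vb zv za zb → x ∧ zv ≡ false → (va ≡ true → za ≡ zv) → (vb ≡ true → zb ≡ zv) →
        ⟦ x ⟧ * ⟦ (va ∧ zb) ∨ (za ∧ vb) ⟧ ≡ ⟦ x ⟧ * ⟦ va ⟧ * ⟦ zb ⟧ + ⟦ x ⟧ * ⟦ vb ⟧ * ⟦ za ⟧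
      taut = toWitness {a? = ∀ᵇ λ x → ∀ᵇ λ va → ∀ᵇ λ vb → ∀ᵇ λ zv → ∀ᵇ λ za → ∀ᵇ λ zb →
        (_ Bool.≟ _) →-dec (((_ Bool.≟ _) →-dec (_ Bool.≟ _)) →-dec (((_ Bool.≟ _) →-dec (_ Bool.≟ _)) →-dec (_ ≟ _)))} tt
      inner : ∀ a b → ∑ (λ v → ⟦ X v ⟧ * joining v z a b) (allFin ν) ≡ ⟦ X a ∧ (z == b) ⟧ + ⟦ X b ∧ (z == a) ⟧
      inner a b = begin
        ∑ (λ v → ⟦ X v ⟧ * joining v z a b) (allFin ν)
          ≡⟨ ∑-cong (allFin ν) (λ v _ → taut (X v) (v == a) (v == b) (z == v) (z == a) (z == b) (off-root X⊆U v)
               (λ h → cong (z ==_) (sym (==⇒≡ {a = v} {a} h))) (λ h → cong (z ==_) (sym (==⇒≡ {a = v} {b} h)))) ⟩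
        ∑ (λ v → ⟦ X v ⟧ * ⟦ v == a ⟧ * ⟦ z == b ⟧ + ⟦ X v ⟧ * ⟦ v == b ⟧ * ⟦ z == a ⟧) (allFin ν)
          ≡⟨ ∑-+ _ _ (allFin ν) ⟩
        ∑ (λ v → ⟦ X v ⟧ * ⟦ v == a ⟧ * ⟦ z == b ⟧) (allFin ν) + ∑ (λ v → ⟦ X v ⟧ * ⟦ v == b ⟧ * ⟦ z == a ⟧) (allFin ν)
          ≡⟨ cong₂ _+_ (pick a (z == b)) (pick b (z == a)) ⟩
        ⟦ X a ∧ (z == b) ⟧ + ⟦ X b ∧ (z == a) ⟧ ∎
        where
        ⟦∧⟧ : ∀ x y → ⟦ y ⟧ * ⟦ x ⟧ ≡ ⟦ x ∧ y ⟧
        ⟦∧⟧ = toWitness {a? = ∀ᵇ λ x → ∀ᵇ λ y → _ ≟ _} tt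
        pick : ∀ c y → ∑ (λ v → ⟦ X v ⟧ * ⟦ v == c ⟧ * ⟦ y ⟧) (allFin ν) ≡ ⟦ X c ∧ y ⟧
        pick c y = trans (∑-cong (allFin ν) λ v _ → *-comm (⟦ X v ⟧ * ⟦ v == c ⟧) ⟦ y ⟧)
          (trans (∑-* ⟦ y ⟧ _ (allFin ν)) (trans (cong (⟦ y ⟧ *_) (∑-pick X c)) (⟦∧⟧ (X c) y)))

    card-split : ∀ X → card X ≡ card (X ∩ N) + m[ X ]
    card-split X = ∑-lin (⟦_⟧ ∘ X ∷ ⟦_⟧ ∘ (X ∩ N) ∷ ⟦_⟧ ∘ (X ∖ N) ∷ []) (λ x a b → x :≡ a :+ b) (allFin ν)
      λ v _ → taut (X v) (N v)
      where
      taut : ∀ x y → ⟦ x ⟧ ≡ ⟦ x ∧ y ⟧ + ⟦ x ∧ not y ⟧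
      taut = toWitness {a? = ∀ᵇ λ x → ∀ᵇ λ y → _ ≟ _} tt

    -- Without `z`, its neighbours have degree 4 and the other vertices degree 5. In particular
    -- `d[ X ]` and `m[ X ]` have the same parity, which is the source of `odd-cut`.
    balance : ∀ {X} → X ⊆ U → 5 * m[ X ] + 4 * card (X ∩ N) ≡ 2 * e[ X ] E + d[ X ]
    balance {X} X⊆U = lin (card X ∷ e[ X ] E ∷ d[ X ] ∷ r[ X ] ∷ card (X ∩ N) ∷ m[ X ] ∷ [])
      (λ x e d r c m → (5 :* x :≡ 2 :* e :+ d :+ r) ∷ (r :≡ c) ∷ 5 ⨾ (x :≡˘ c :+ m) ∷ [] ⊢
        5 :* m :+ 4 :* c :≡ 2 :* e :+ d)
      (degree-sum X⊆U , root-sum X⊆U , card-split X)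

    U⊆U : U ⊆ U
    U⊆U v h = h

    -- Doubling |E| = 3|U| - 1 and comparing with the degree sum 5|U| leaves at least |U| - 2 edges
    -- at `z`.
    m[U]≤2 : m[ U ] ≤ 2
    m[U]≤2 = lin (card W ∷ card U ∷ length E ∷ e[ U ] E ∷ d[ U ] ∷ r[ U ] ∷ card (U ∩ N) ∷ m[ U ] ∷ [])
      (λ w u l e d r c m → 6 ⨾ (w :≡˘ con 1 :+ u) ∷ 2 ⨾ (3 :* w :≡ l :+ con 4) ∷ 2 ⨾ (l :≤ e :+ r) ∷
        (5 :* u :≡˘ 2 :* e :+ d :+ r) ∷ (r :≡ c) ∷ (u :≡˘ c :+ m) ∷ [] ⊢ m :≤ con 2)
      (card-− {W = W} root , exact , all-edges , degree-sum U⊆U , root-sum U⊆U , card-split U)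
      where
      all-edges : length E ≤ e[ U ] E + r[ U ]
      all-edges = subst (_≤ e[ U ] E + r[ U ]) (∑-1 E) (∑-lin
        ((λ _ → 1) ∷ (λ e → inside U (proj₁ e) (proj₂ e)) ∷
         (λ e → ⟦ U (proj₁ e) ∧ (z == proj₂ e) ⟧ + ⟦ U (proj₂ e) ∧ (z == proj₁ e) ⟧) ∷ [])
        (λ o i r → o :≤ i :+ r) E λ (a , b) e∈E → step a b e∈E)
        where
        step : ∀ a b → (a , b) ∈ E → 1 ≤ inside U a b + (⟦ U a ∧ (z == b) ⟧ + ⟦ U b ∧ (z == a) ⟧)
        step a b e∈E = let a∈W , b∈W = All.lookup within e∈E in
          taut (W a) (W b) (z == a) (z == b) a∈W b∈W λ za zb →
            edge-ends-≢ sparse e∈E (trans (sym (==⇒≡ {a = z} {a} za)) (==⇒≡ {a = z} {b} zb))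
          where
          taut : ∀ wa wb za zb → wa ≡ true → wb ≡ true → (za ≡ true → zb ≡ true → ⊥) →
            1 ≤ ⟦ (wa ∧ not za) ∧ (wb ∧ not zb) ⟧ + (⟦ (wa ∧ not za) ∧ zb ⟧ + ⟦ (wb ∧ not zb) ∧ za ⟧)
          taut true true true  true  _ _ h = ⊥-elim (h refl refl)
          taut true true true  false _ _ _ = ≤-refl
          taut true true false true  _ _ _ = ≤-refl
          taut true true false false _ _ _ = ≤-refl

    d[U]≡0 : d[ U ] ≡ 0
    d[U]≡0 = trans (∑-cong E λ (a , b) e∈E → let a∈W , b∈W = All.lookup within e∈E in
      taut (W a) (W b) (z == a) (z == b) a∈W b∈W) (∑-0 E)
      where
      taut : ∀ wa wb za zb → wa ≡ true → wb ≡ true → crossing (wa ∧ not za) (wb ∧ not zb) za zb ≡ 0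
      taut = toWitness {a? = ∀ᵇ λ wa → ∀ᵇ λ wb → ∀ᵇ λ za → ∀ᵇ λ zb →
        (_ Bool.≟ _) →-dec ((_ Bool.≟ _) →-dec (_ ≟ _))} tt

    m-mono : ∀ {X Y} → X ⊆ Y → m[ X ] ≤ m[ Y ]
    m-mono {X} X⊆Y = card-mono λ v h → cong₂ _∧_ (X⊆Y v (∧-trueˡ h)) (∧-trueʳ {X v} h)

    -- U itself, or a smallest set with at most two leaving edges and at most one non-neighbour of z.
    record Block (A : VSet ν) : Set where
      field
        A⊆U      : A ⊆ U
        nonempty : Nonempty A
        small    : m[ A ] + d[ A ] ≤ 3
        small-d  : d[ A ] ≤ 2
        inner    : ∀ B → B ⊆ A → Nonempty B → ∀ v → A v ≡ true → B v ≡ false → 3 ≤ d[ B ]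

    block : Nonempty U → ¬ ¬ (∃ Block)
    block neU k = em {∃ Candidate} λ where
        (inj₁ (A , cA)) → minimal Candidate A cA λ where
          (A₀ , (A⊆U , ne , d≤2 , m≤1) , least) → k (A₀ , record
            { A⊆U = A⊆U ; nonempty = ne ; small = +-mono-≤ m≤1 d≤2 ; small-d = d≤2
            ; inner = λ B B⊆A neB v v∈A v∉B → ≰⇒> λ dB≤2 → contradiction
                (least B ((λ w → A⊆U w ∘ B⊆A w) , neB , dB≤2 , ≤-trans (m-mono B⊆A) m≤1))
                (<⇒≱ (card-strict {X = B} B⊆A v v∉B v∈A)) })
        (inj₂ no-candidate) → k (U , record
          { A⊆U = U⊆U ; nonempty = neU
          ; small = ≤-trans (+-mono-≤ m[U]≤2 (≤-reflexive d[U]≡0)) (n≤1+n 2)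
          ; small-d = ≤-trans (≤-reflexive d[U]≡0) z≤n
          ; inner = λ B B⊆U neB v v∈U v∉B → ≰⇒> λ dB≤2 → no-candidate (either B B⊆U neB v v∈U v∉B dB≤2 (m[ B ] ≤? 1)) })
      where
      Candidate : VSet ν → Set
      Candidate A = A ⊆ U × Nonempty A × d[ A ] ≤ 2 × m[ A ] ≤ 1
      -- There are at most two non-neighbours of `z`, so `B` or its complement in `U` contains at
      -- most one; the complement has no more leaving edges than `B`.
      either : ∀ B → B ⊆ U → Nonempty B → ∀ v → U v ≡ true → B v ≡ false → d[ B ] ≤ 2 → Dec (m[ B ] ≤ 1) → ∃ Candidate
      either B B⊆U neB v v∈U v∉B dB≤2 (yes mB≤1) = B , B⊆U , neB , dB≤2 , mB≤1
      either B B⊆U neB v v∈U v∉B dB≤2 (no mB≰1) = U ∖ B , (λ w → ∧-trueˡ) ,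
        (v , cong₂ (λ a b → a ∧ not b) v∈U v∉B) ,
        ≤-trans (∑-mono E λ (a , b) e∈E → let a∈W , b∈W = All.lookup within e∈E in
          taut (W a) (W b) (z == a) (z == b) (B a) (B b) a∈W b∈W) dB≤2 ,
        lin (m[ U ∖ B ] ∷ m[ B ] ∷ m[ U ] ∷ [])
          (λ c b u → (c :+ b :≤ u) ∷ (u :≤ con 2) ∷ (con 2 :≤ b) ∷ [] ⊢ c :≤ con 1)
          (∑-lin (⟦_⟧ ∘ (U ∖ B ∖ N) ∷ ⟦_⟧ ∘ (B ∖ N) ∷ ⟦_⟧ ∘ (U ∖ N) ∷ []) (λ c b u → c :+ b :≤ u) (allFin ν)
            (λ w _ → taut₂ (U w) (B w) (N w) (B⊆U w)) , m[U]≤2 , ≰⇒> mB≰1)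
        where
        taut : ∀ wa wb za zb ba bb → wa ≡ true → wb ≡ true →
          crossing ((wa ∧ not za) ∧ not ba) ((wb ∧ not zb) ∧ not bb) za zb ≤ crossing ba bb za zb
        taut = toWitness {a? = ∀ᵇ λ wa → ∀ᵇ λ wb → ∀ᵇ λ za → ∀ᵇ λ zb → ∀ᵇ λ ba → ∀ᵇ λ bb →
          (_ Bool.≟ _) →-dec ((_ Bool.≟ _) →-dec (_ ≤? _))} tt
        taut₂ : ∀ u b c → (b ≡ true → u ≡ true) → ⟦ (u ∧ not b) ∧ not c ⟧ + ⟦ b ∧ not c ⟧ ≤ ⟦ u ∧ not c ⟧
        taut₂ = toWitness {a? = ∀ᵇ λ u → ∀ᵇ λ b → ∀ᵇ λ c → ((_ Bool.≟ _) →-dec (_ Bool.≟ _)) →-dec (_ ≤? _)} tt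

    odd-cut : ∀ {X k} → X ⊆ U → d[ X ] ≡ 1 + 2 * k → 1 ≤ m[ X ]
    odd-cut {X} {k} X⊆U d = ≮⇒≥ λ m<1 → not-even (e[ X ] E + k) (2 * card (X ∩ N))
      (lin (m[ X ] ∷ card (X ∩ N) ∷ e[ X ] E ∷ d[ X ] ∷ k ∷ [])
        (λ m c e d k → (5 :* m :+ 4 :* c :≡˘ 2 :* e :+ d) ∷ 5 ⨾ (m :≡ con 0) ∷ (d :≡˘ con 1 :+ 2 :* k) ∷ [] ⊢
          con 1 :+ 2 :* (e :+ k) :≡ 2 :* (2 :* c))
        (balance X⊆U , n<1⇒n≡0 m<1 , d))

    -- Uncrossing: otherwise A would be cut into two parts of boundary 3, each containing one of the
    -- two non-neighbours of z, and the rest of U into two parts with empty boundary.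
    no-small-cut : ∀ {A} → Block A → ∀ {u v} → A u ≡ true → A v ≡ true →
      ∀ B → B ⊆ U → B v ≡ true → B u ≡ false → 3 ≤ d[ B ]
    no-small-cut {A} bl {u} {v} u∈A v∈A B B⊆U v∈B u∉B = ≮⇒≥ λ dB<3 → separated (≤-pred dB<3)
      where
      open Block bl
      A₁ A₂ B₁ B₂ : VSet ν
      A₁ = A ∩ B
      A₂ = A ∖ B
      B₁ = B ∖ A
      B₂ = U ∖ (A ∪ B)
      3≤d₁ : 3 ≤ d[ A₁ ]
      3≤d₁ = inner A₁ (λ w → ∧-trueˡ) (v , cong₂ _∧_ v∈A v∈B) u u∈A (cong₂ _∧_ u∈A u∉B)
      3≤d₂ : 3 ≤ d[ A₂ ]
      3≤d₂ = inner A₂ (λ w → ∧-trueˡ) (u , cong₂ (λ a b → a ∧ not b) u∈A u∉B) v v∈A (cong₂ (λ a b → a ∧ not b) v∈A v∈B)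
      cut-of : VSet ν → Edge ν → ℕ
      cut-of X (a , b) = crossing (X a) (X b) (z == a) (z == b)
      taut : ∀ wa wb za zb xa xb ya yb → wa ≡ true → wb ≡ true →
        let c : (Bool → Bool → Bool → Bool → Bool) → ℕ
            c f = crossing (f wa za xa ya) (f wb zb xb yb) za zb
            cA  = c λ w z x y → x
            cB  = c λ w z x y → y
            cA₁ = c λ w z x y → x ∧ y
            cA₂ = c λ w z x y → x ∧ not y
            cB₁ = c λ w z x y → y ∧ not x
            cB₂ = c λ w z x y → (w ∧ not z) ∧ not (x ∨ y)
        in cA₁ + cA₂ ≤ cA + 2 * cB × cA ≤ cB₁ + cB₂ × cA₁ + cB₂ ≤ cA + cB × cA₂ + cB₁ ≤ cA + cB
      taut = toWitness {a? = ∀ᵇ λ wa → ∀ᵇ λ wb → ∀ᵇ λ za → ∀ᵇ λ zb → ∀ᵇ λ xa → ∀ᵇ λ xb → ∀ᵇ λ ya → ∀ᵇ λ yb →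
        (_ Bool.≟ _) →-dec ((_ Bool.≟ _) →-dec ((_ ≤? _) ×-dec ((_ ≤? _) ×-dec ((_ ≤? _) ×-dec (_ ≤? _)))))} tt
      facts : ∀ e → e ∈ E → _
      facts (a , b) e∈E = let a∈W , b∈W = All.lookup within e∈E in
        taut (W a) (W b) (z == a) (z == b) (A a) (A b) (B a) (B b) a∈W b∈W
      i₁ : d[ A₁ ] + d[ A₂ ] ≤ d[ A ] + 2 * d[ B ]
      i₁ = ∑-lin (cut-of A₁ ∷ cut-of A₂ ∷ cut-of A ∷ cut-of B ∷ []) (λ p q r s → p :+ q :≤ r :+ 2 :* s) E
        λ e i → proj₁ (facts e i)
      i₂ : d[ A ] ≤ d[ B₁ ] + d[ B₂ ]
      i₂ = ∑-lin (cut-of A ∷ cut-of B₁ ∷ cut-of B₂ ∷ []) (λ p q r → p :≤ q :+ r) E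
        λ e i → proj₁ (proj₂ (facts e i))
      i₃ : d[ A₁ ] + d[ B₂ ] ≤ d[ A ] + d[ B ]
      i₃ = ∑-lin (cut-of A₁ ∷ cut-of B₂ ∷ cut-of A ∷ cut-of B ∷ []) (λ p q r s → p :+ q :≤ r :+ s) E
        λ e i → proj₁ (proj₂ (proj₂ (facts e i)))
      i₄ : d[ A₂ ] + d[ B₁ ] ≤ d[ A ] + d[ B ]
      i₄ = ∑-lin (cut-of A₂ ∷ cut-of B₁ ∷ cut-of A ∷ cut-of B ∷ []) (λ p q r s → p :+ q :≤ r :+ s) E
        λ e i → proj₂ (proj₂ (proj₂ (facts e i)))
      parts : m[ A₁ ] + m[ A₂ ] + (m[ B₁ ] + m[ B₂ ]) ≤ m[ U ]
      parts = ∑-lin (⟦_⟧ ∘ (A₁ ∖ N) ∷ ⟦_⟧ ∘ (A₂ ∖ N) ∷ ⟦_⟧ ∘ (B₁ ∖ N) ∷ ⟦_⟧ ∘ (B₂ ∖ N) ∷ ⟦_⟧ ∘ (U ∖ N) ∷ [])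
        (λ p q r s t → p :+ q :+ (r :+ s) :≤ t) (allFin ν)
        λ w _ → taut₂ (A w) (B w) (U w) (N w) (A⊆U w) (B⊆U w)
        where
        taut₂ : ∀ x y u c → (x ≡ true → u ≡ true) → (y ≡ true → u ≡ true) →
          ⟦ (x ∧ y) ∧ not c ⟧ + ⟦ (x ∧ not y) ∧ not c ⟧ + (⟦ (y ∧ not x) ∧ not c ⟧ + ⟦ (u ∧ not (x ∨ y)) ∧ not c ⟧) ≤ ⟦ u ∧ not c ⟧
        taut₂ = toWitness {a? = ∀ᵇ λ x → ∀ᵇ λ y → ∀ᵇ λ u → ∀ᵇ λ c →
          ((_ Bool.≟ _) →-dec (_ Bool.≟ _)) →-dec (((_ Bool.≟ _) →-dec (_ Bool.≟ _)) →-dec (_ ≤? _))} tt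
      ≤1 : ∀ {k} → k ≤ 1 → k ≢ 1 → k ≡ 0
      ≤1 z≤n _ = refl
      ≤1 (s≤s z≤n) h = ⊥-elim (h refl)
      separated : d[ B ] ≤ 2 → ⊥
      separated dB≤2 = lin⊥ (d[ A ] ∷ d[ B ] ∷ d[ A₁ ] ∷ d[ A₂ ] ∷ d[ B₁ ] ∷ d[ B₂ ] ∷ [])
          (λ a b a₁ a₂ b₁ b₂ → (a₁ :+ a₂ :≤ a :+ 2 :* b) ∷ (con 3 :≤ a₁) ∷ (con 3 :≤ a₂) ∷ 2 ⨾ (b :≤ con 2) ∷
            2 ⨾ (a :≤ b₁ :+ b₂) ∷ 2 ⨾ (b₁ :≡ con 0) ∷ 2 ⨾ (b₂ :≡ con 0) ∷ [])
          (i₁ , 3≤d₁ , 3≤d₂ , dB≤2 , i₂ , d-B₁ , d-B₂)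
        where
        ρ = d[ A ] ∷ d[ B ] ∷ d[ A₁ ] ∷ d[ A₂ ] ∷ d[ B₁ ] ∷ d[ B₂ ] ∷ []
        -- The inequality `i₁` reads 3 + 3 ≤ 2 + 2 · 2 in the extreme case, so both parts have
        -- boundary exactly 3. As 3 is odd, each part contains a non-neighbour of `z`.
        d₁≡3 : d[ A₁ ] ≡ 3
        d₁≡3 = ≤-antisym (lin ρ (λ a b a₁ a₂ b₁ b₂ → (a₁ :+ a₂ :≤ a :+ 2 :* b) ∷ (con 3 :≤ a₂) ∷ 2 ⨾ (b :≤ con 2) ∷ (a :≤ con 2) ∷ [] ⊢ a₁ :≤ con 3)
          (i₁ , 3≤d₂ , dB≤2 , small-d)) 3≤d₁
        d₂≡3 : d[ A₂ ] ≡ 3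
        d₂≡3 = ≤-antisym (lin ρ (λ a b a₁ a₂ b₁ b₂ → (a₁ :+ a₂ :≤ a :+ 2 :* b) ∷ (con 3 :≤ a₁) ∷ 2 ⨾ (b :≤ con 2) ∷ (a :≤ con 2) ∷ [] ⊢ a₂ :≤ con 3)
          (i₁ , 3≤d₁ , dB≤2 , small-d)) 3≤d₂
        1≤m₁ : 1 ≤ m[ A₁ ]
        1≤m₁ = odd-cut {k = 1} (λ w → A⊆U w ∘ ∧-trueˡ) d₁≡3
        1≤m₂ : 1 ≤ m[ A₂ ]
        1≤m₂ = odd-cut {k = 1} (λ w → A⊆U w ∘ ∧-trueˡ) d₂≡3
        -- By `i₄` the boundary is at most 1, and the odd value 1 would require a third
        -- non-neighbour of `z`. The same argument with `i₃` applies to `B₂`.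
        d-B₁ : d[ B₁ ] ≡ 0
        d-B₁ = ≤1 (lin ρ (λ a b a₁ a₂ b₁ b₂ → (a₂ :+ b₁ :≤ a :+ b) ∷ (con 3 :≤ a₂) ∷ (b :≤ con 2) ∷ (a :≤ con 2) ∷ [] ⊢ b₁ :≤ con 1)
            (i₄ , 3≤d₂ , dB≤2 , small-d))
          λ d≡1 → lin⊥ (m[ A₁ ] ∷ m[ A₂ ] ∷ m[ B₁ ] ∷ m[ B₂ ] ∷ m[ U ] ∷ [])
            (λ p q r s t → (p :+ q :+ (r :+ s) :≤ t) ∷ (t :≤ con 2) ∷ (con 1 :≤ p) ∷ (con 1 :≤ q) ∷ (con 1 :≤ r) ∷ [])
            (parts , m[U]≤2 , 1≤m₁ , 1≤m₂ , odd-cut {k = 0} (λ w → B⊆U w ∘ ∧-trueˡ) d≡1)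
        d-B₂ : d[ B₂ ] ≡ 0
        d-B₂ = ≤1 (lin ρ (λ a b a₁ a₂ b₁ b₂ → (a₁ :+ b₂ :≤ a :+ b) ∷ (con 3 :≤ a₁) ∷ (b :≤ con 2) ∷ (a :≤ con 2) ∷ [] ⊢ b₂ :≤ con 1)
            (i₃ , 3≤d₁ , dB≤2 , small-d))
          λ d≡1 → lin⊥ (m[ A₁ ] ∷ m[ A₂ ] ∷ m[ B₁ ] ∷ m[ B₂ ] ∷ m[ U ] ∷ [])
            (λ p q r s t → (p :+ q :+ (r :+ s) :≤ t) ∷ (t :≤ con 2) ∷ (con 1 :≤ p) ∷ (con 1 :≤ q) ∷ (con 1 :≤ s) ∷ [])
            (parts , m[U]≤2 , 1≤m₁ , 1≤m₂ , odd-cut {k = 0} (λ w → ∧-trueˡ) d≡1)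

    -- The complement `X` of `Y` in `W` contains `v` but not `u`, so it has boundary at least 3
    -- apart from its edges to `z`. Hence more than 3|X| edges meet `X`, which leaves at most 3|Y| -
    -- 5 for `Y`: two below sparsity, the reserve used up when `u` is merged into `z`.
    very-sparse : ∀ {A} → Block A → ∀ {u v} → A u ≡ true → A v ≡ true →
      ∀ Y → Y z ≡ true → Y u ≡ true → Y v ≡ false → e[ Y ] E + 5 ≤ 3 * card Y
    very-sparse {A} bl {u} {v} u∈A v∈A Y z∈Y u∈Y v∉Y =
      lin (e[ Y ] E ∷ e[ X ] E ∷ d[ X ] ∷ r[ X ] ∷ length E ∷ card W ∷ card X ∷ card Y ∷ [])
        (λ eY eX d r l w x y → (eY :+ (eX :+ d :+ r) :≤ l) ∷ (3 :* w :≡˘ l :+ con 4) ∷ 3 ⨾ (w :≤ x :+ y) ∷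
          (con 1 :+ 3 :* x :≤ eX :+ d :+ r) ∷ [] ⊢ eY :+ con 5 :≤ 3 :* y)
        (disjoint-edges , exact , cover , many-edges)
      where
      open Block bl
      X : VSet ν
      X = W ∖ Y
      X⊆U : X ⊆ U
      X⊆U w h = ∈-− {W = W} {z} (∧-trueˡ h) λ { refl → true≢false (∧-trueʳ {W w} h) (cong not z∈Y) }
      v∈X : X v ≡ true
      v∈X = cong₂ (λ a b → a ∧ not b) (∧-trueˡ (A⊆U v v∈A)) v∉Y
      u∉X : X u ≡ false
      u∉X = trans (cong (λ b → W u ∧ not b) u∈Y) (Bool.∧-zeroʳ (W u))
      cover : card W ≤ card X + card Y
      cover = ∑-lin (⟦_⟧ ∘ W ∷ ⟦_⟧ ∘ X ∷ ⟦_⟧ ∘ Y ∷ []) (λ w x y → w :≤ x :+ y) (allFin ν)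
        λ w _ → taut (W w) (Y w)
        where
        taut : ∀ w y → ⟦ w ⟧ ≤ ⟦ w ∧ not y ⟧ + ⟦ y ⟧
        taut = toWitness {a? = ∀ᵇ λ w → ∀ᵇ λ y → _ ≤? _} tt
      -- Twice the right side is 5|X| + d + r, with d ≥ 3 and r ≥ |X| - 2, hence more than 6|X|.
      many-edges : 1 + 3 * card X ≤ e[ X ] E + d[ X ] + r[ X ]
      many-edges = ≰⇒> λ few →
        lin⊥ (e[ X ] E ∷ d[ X ] ∷ r[ X ] ∷ card X ∷ card (X ∩ N) ∷ m[ X ] ∷ [])
          (λ e d r x c m → 2 ⨾ (e :+ d :+ r :≤ 3 :* x) ∷ (5 :* x :≡ 2 :* e :+ d :+ r) ∷ (con 3 :≤ d) ∷
            (r :≡˘ c) ∷ (x :≡ c :+ m) ∷ (m :≤ con 2) ∷ [])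
          (few , degree-sum X⊆U , no-small-cut bl u∈A v∈A X X⊆U v∈X u∉X , root-sum X⊆U , card-split X ,
           ≤-trans (m-mono X⊆U) m[U]≤2)
      disjoint-edges : e[ Y ] E + (e[ X ] E + d[ X ] + r[ X ]) ≤ length E
      disjoint-edges = subst (e[ Y ] E + (e[ X ] E + d[ X ] + r[ X ]) ≤_) (∑-1 E) (∑-lin
        ((λ e → inside Y (proj₁ e) (proj₂ e)) ∷ (λ e → inside X (proj₁ e) (proj₂ e)) ∷
         (λ e → crossing (X (proj₁ e)) (X (proj₂ e)) (z == proj₁ e) (z == proj₂ e)) ∷
         (λ e → ⟦ X (proj₁ e) ∧ (z == proj₂ e) ⟧ + ⟦ X (proj₂ e) ∧ (z == proj₁ e) ⟧) ∷ (λ _ → 1) ∷ [])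
        (λ y x d r o → y :+ (x :+ d :+ r) :≤ o) E
        λ (a , b) _ → taut (W a) (W b) (Y a) (Y b) (z == a) (z == b) (root-in a) (root-in b))
        where
        root-in : ∀ a → (z == a) ≡ true → Y a ≡ true
        root-in a h = subst (λ a → Y a ≡ true) (==⇒≡ {a = z} {a} h) z∈Y
        taut : ∀ wa wb ya yb za zb → (za ≡ true → ya ≡ true) → (zb ≡ true → yb ≡ true) →
          ⟦ ya ∧ yb ⟧ + (⟦ (wa ∧ not ya) ∧ (wb ∧ not yb) ⟧ + crossing (wa ∧ not ya) (wb ∧ not yb) za zb
            + (⟦ (wa ∧ not ya) ∧ zb ⟧ + ⟦ (wb ∧ not yb) ∧ za ⟧)) ≤ 1
        taut = toWitness {a? = ∀ᵇ λ wa → ∀ᵇ λ wb → ∀ᵇ λ ya → ∀ᵇ λ yb → ∀ᵇ λ za → ∀ᵇ λ zb →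
          ((_ Bool.≟ _) →-dec (_ Bool.≟ _)) →-dec (((_ Bool.≟ _) →-dec (_ Bool.≟ _)) →-dec (_ ≤? _))} tt

-- Triangles through the root

count-absent : ∀ {w : Fin ν} {C} → All (_≢ w) C → count w C ≡ 0
count-absent {w = w} {C} h = trans (∑-cong C λ c i → ⟦false⟧ (≢⇒== (All.lookup h i ∘ sym))) (∑-0 C)

mult-star-off : ∀ {x y v : Fin ν} C → x ≢ v → y ≢ v → mult x y (star v C) ≡ 0
mult-star-off {x = x} {y} {v} C x≢v y≢v = trans (∑ᵉ-star (joining x y) v C) (trans (∑-cong C λ c _ → cong ⟦_⟧ (step c)) (∑-0 C))
  where
  step : ∀ c → ((x == v) ∧ (y == c)) ∨ ((y == v) ∧ (x == c)) ≡ false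
  step c rewrite ≢⇒== x≢v | ≢⇒== y≢v = refl

record TriangleBoundary (v u z : Fin ν) (L : List (Fin ν)) (F : List (Edge ν)) (f : Fin ν → ℤ₃)
                        (σ : StarBoundary v L 𝟘) : Set where
  constructor triangleBoundary
  field
    g    : Fin ν → ℤ₃
    at-g : Attains ((v , z) ∷ (v , u) ∷ star v L ++ (u , z) ∷ F) g
    g-u  : g u ≡ 𝟘
    g-v  : g v ≡ 𝟘
    rest : ∀ w → w ≢ z → w ≢ u → w ≢ v → g w ≡ f w ⊕ boundary σ w

-- The rest of the star contributes 0 at `v`, so the edges `vu` and `vz` must cancel there. The
-- direction of `vu` is still free, and together with that of `uz` it reaches every residue at `u`.
close-triangle : ∀ {v u z : Fin ν} {L F f} → v ≢ z → u ≢ z → v ≢ u → (σ : StarBoundary v L 𝟘) → u ∉ L →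
                 f v ≡ 𝟘 → Attains F f → TriangleBoundary v u z L F f σ
close-triangle {ν} {v} {u} {z} {L} {F} {f} v≢z u≢z v≢u σ u∉L f-v at = triangleBoundary g
  (attains-∷ (not s₂) (v , z) {f = f₄} (attains-∷ s₂ (v , u) {f = f₃}
    (attaining σ {f = f₂} (attains-∷ s₁ (u , z) {f = f} at)))) g-u g-v rest
  where
  signs : ∀ s → Σ[ b ∈ Bool × Bool ] s ⊕ (if proj₁ b then 𝟙 else 𝟚) ⊖ (if proj₂ b then 𝟙 else 𝟚) ≡ 𝟘
  signs 𝟘 = (true  , true)  , refl
  signs 𝟙 = (true  , false) , refl
  signs 𝟚 = (false , true)  , refl
  s₁ s₂ : Bool
  s₁ = proj₁ (proj₁ (signs (f u)))
  s₂ = proj₂ (proj₁ (signs (f u)))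
  f₂ f₃ f₄ g : Fin ν → ℤ₃
  f₂ w = f w ⊕ χ s₁ (u , z) w
  f₃ w = f₂ w ⊕ boundary σ w
  f₄ w = f₃ w ⊕ χ s₂ (v , u) w
  g  w = f₄ w ⊕ χ (not s₂) (v , z) w
  g-u : g u ≡ 𝟘
  g-u = begin
    f u ⊕ χ s₁ (u , z) u ⊕ boundary σ u ⊕ χ s₂ (v , u) u ⊕ χ (not s₂) (v , z) u
      ≡⟨ cong₂ _⊕_ (cong₂ _⊕_ (cong₂ _⊕_ (cong (f u ⊕_) (χ-tail s₁ u≢z)) (elsewhere σ u (v≢u ∘ sym) u∉L))
           (χ-head s₂ v≢u)) (χ-off (not s₂) (v≢u ∘ sym) u≢z) ⟩
    f u ⊕ (if s₁ then 𝟙 else 𝟚) ⊕ 𝟘 ⊖ (if s₂ then 𝟙 else 𝟚) ⊕ 𝟘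
      ≡⟨ trans (⊕-identityʳ _) (cong (_⊖ (if s₂ then 𝟙 else 𝟚)) (⊕-identityʳ (f u ⊕ (if s₁ then 𝟙 else 𝟚)))) ⟩
    f u ⊕ (if s₁ then 𝟙 else 𝟚) ⊖ (if s₂ then 𝟙 else 𝟚)
      ≡⟨ proj₂ (signs (f u)) ⟩
    𝟘 ∎
    where open ≡-Reasoning
  opposite : ∀ s → (if s then 𝟙 else 𝟚) ⊕ (if not s then 𝟙 else 𝟚) ≡ 𝟘
  opposite true  = refl
  opposite false = refl
  g-v : g v ≡ 𝟘
  g-v = trans (cong₂ _⊕_ (cong₂ _⊕_ (cong₂ _⊕_ (cong₂ _⊕_ f-v
           (χ-off s₁ v≢u v≢z)) (at-centre σ)) (χ-tail s₂ v≢u)) (χ-tail (not s₂) v≢z)) (opposite s₂)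
  rest : ∀ w → w ≢ z → w ≢ u → w ≢ v → g w ≡ f w ⊕ boundary σ w
  rest w w≢z w≢u w≢v = begin
    f w ⊕ χ s₁ (u , z) w ⊕ boundary σ w ⊕ χ s₂ (v , u) w ⊕ χ (not s₂) (v , z) w
      ≡⟨ cong₂ _⊕_ (cong₂ _⊕_ (cong (_⊕ boundary σ w) (cong (f w ⊕_)
           (χ-off s₁ w≢u w≢z))) (χ-off s₂ w≢v w≢u)) (χ-off (not s₂) w≢v w≢z) ⟩
    f w ⊕ 𝟘 ⊕ boundary σ w ⊕ 𝟘 ⊕ 𝟘
      ≡⟨ collapse (f w) (boundary σ w) ⟩
    f w ⊕ boundary σ w ∎
    where
    open ≡-Reasoning
    collapse : ∀ a b → a ⊕ 𝟘 ⊕ b ⊕ 𝟘 ⊕ 𝟘 ≡ a ⊕ b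
    collapse = toWitness {a? = ∀₃ λ a → ∀₃ λ b → _ ≟₃ _} tt

module Triangles {ν} (z : Fin ν) where

  open Rooted z
  open Reductions z

  module _ {W E β} (X : Exact W E β) (below : Below E) (unsolved : ¬ Solution W E β)
           (deg5   : ∀ {v} → W v ≡ true → v ≢ z → degree v E ≡ 5 × β v ≡ 𝟘)
           (root≤1 : ∀ {v} → W v ≡ true → v ≢ z → mult v z E ≤ 1)
           (simple : ∀ {x y} → W x ≡ true → W y ≡ true → x ≢ z → y ≢ z → x ≢ y → mult x y E ≤ 1)
    where
    open Exact X
    open Cuts z W E
    open Counting root within sparse exact (λ v∈W v≢z → proj₁ (deg5 v∈W v≢z)) root≤1

    -- A vertex `v` of `A ∩ N` has five edges: at most one goes to `z`, at most `d[ A ]` leave `A`,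
    -- and at most `m[ A ]` go to non-neighbours of `z` in `A`. The last two numbers sum to at most
    -- 3, so an edge into `A ∩ N` remains.
    adjacent-pair : ∀ {A} → Block A →
      (∀ {v u} → A v ≡ true → N v ≡ true → A u ≡ true → N u ≡ true → v ≢ u → 1 ≤ mult v u E → ⊥) → ⊥
    adjacent-pair {A} bl found = em {Nonempty (A ∩ N)} λ where
        (inj₂ none)      → no-neighbours λ v → [ (λ h → ⊥-elim (none (v , h))) , id ]′ (bool ((A ∩ N) v))
        (inj₁ (v , v∈))  → from v (∧-trueˡ v∈) (∧-trueʳ {A v} v∈)
      where
      open Block bl
      -- Without neighbours of `z` in `A`, 5|A| = 2e + d ≤ 6|A| - 6 + d would give |A| + d ≥ 6,
      -- against `small`.
      no-neighbours : (∀ v → (A ∩ N) v ≡ false) → ⊥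
      no-neighbours none = lin⊥ (card A ∷ e[ A ] E ∷ d[ A ] ∷ card (A ∩ N) ∷ m[ A ] ∷ [])
        (λ a e d c m → (5 :* m :+ 4 :* c :≡ 2 :* e :+ d) ∷ 2 ⨾ (e :+ con 3 :≤ 3 :* a) ∷ 6 ⨾ (a :≡ c :+ m) ∷
          2 ⨾ (c :≡ con 0) ∷ (m :+ d :≤ con 3) ∷ [])
        (balance A⊆U , sparse A nonempty , card-split A ,
         trans (∑-cong (allFin ν) λ v _ → ⟦false⟧ (none v)) (∑-0 (allFin ν)) , small)

      from : ∀ v → A v ≡ true → N v ≡ true → ⊥
      from v v∈A v∈N = by-hits (1 ≤? hits (A ∩ N) C)
        where
        v∈W = proj₁ (∈-−⁻ W {z} (A⊆U v v∈A))
        v≢z = proj₂ (∈-−⁻ W {z} (A⊆U v v∈A))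
        D : Decomposition v E
        D = decompose v sparse
        open Decomposition D
        once : ∀ w → A w ≡ true → count w C ≤ 1
        once w w∈A = by-eq (w ≟ᶠ v)
          where
          by-eq : Dec (w ≡ v) → count w C ≤ 1
          by-eq (yes refl) = ≤-trans (≤-reflexive (count-absent off-centre)) z≤n
          by-eq (no w≢v)   = subst (_≤ 1) (mult-split D w≢v)
            (simple v∈W (proj₁ (∈-−⁻ W {z} (A⊆U w w∈A))) v≢z (proj₂ (∈-−⁻ W {z} (A⊆U w w∈A))) (w≢v ∘ sym))
        far : hits (A ∖ N) C ≤ m[ A ]
        far = subst (_≤ m[ A ]) (sym (hits-count (A ∖ N) C)) (∑-mono (allFin ν) λ w _ →
          at-most (A w) (N w) (once w))
          where
          at-most : ∀ a b {k} → (a ≡ true → k ≤ 1) → ⟦ a ∧ not b ⟧ * k ≤ ⟦ a ∧ not b ⟧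
          at-most true  true  h = z≤n
          at-most true  false {k} h = ≤-trans (≤-reflexive (+-identityʳ k)) (h refl)
          at-most false b     h = z≤n
        leaving : hits (∁ A − z) C ≤ d[ A ]
        leaving = ≤-trans (≤-trans (≤-reflexive (sym (trans (∑ᵉ-star _ v C) (∑-cong C λ c _ → cross c))))
            (≤-trans (m≤m+n _ _) (≤-reflexive (sym (∑ᵉ-++ _ (star v C) R)))))
          (≤-reflexive (sym (∑ᵉ-≋ (λ a b → cross-sym (A a) (A b) (z == a) (z == b)) split)))
          where
          cross : ∀ c → crossing (A v) (A c) (z == v) (z == c) ≡ ⟦ not (A c) ∧ not (z == c) ⟧
          cross c = taut (A v) (A c) (z == v) (z == c) v∈A (≢⇒== (v≢z ∘ sym))
            where
            taut : ∀ av ac zv zc → av ≡ true → zv ≡ false → crossing av ac zv zc ≡ ⟦ not ac ∧ not zc ⟧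
            taut = toWitness {a? = ∀ᵇ λ av → ∀ᵇ λ ac → ∀ᵇ λ zv → ∀ᵇ λ zc →
              (_ Bool.≟ _) →-dec ((_ Bool.≟ _) →-dec (_ ≟ _))} tt
          cross-sym : ∀ xa xb za zb → crossing xa xb za zb ≡ crossing xb xa zb za
          cross-sym = toWitness {a? = ∀ᵇ λ xa → ∀ᵇ λ xb → ∀ᵇ λ za → ∀ᵇ λ zb → _ ≟ _} tt
        by-hits : Dec (1 ≤ hits (A ∩ N) C) → ⊥
        by-hits (yes 1≤) = let u , C′ , p , u∈ = pull (A ∩ N) C 1≤
                               u≢v = All.head (All-resp-↭ p off-centre) in
          found v∈A v∈N (∧-trueˡ u∈) (∧-trueʳ {A u} u∈) (u≢v ∘ sym)
            (subst (1 ≤_) (sym (mult-split D u≢v)) (count-∈ (∈-resp-↭ (↭-sym p) (here refl))))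
        by-hits (no ¬1≤) = lin⊥ (length C ∷ degree v E ∷ count z C ∷ mult v z E ∷ hits (∁ A − z) C ∷ hits (A ∖ N) C ∷ hits (A ∩ N) C ∷ d[ A ] ∷ m[ A ] ∷ [])
          (λ l g c t x y i d m → (l :≤ c :+ x :+ y :+ i) ∷ (g :≡ l) ∷ (g :≡˘ con 5) ∷ (c :≤ con 1) ∷
            (x :≤ d) ∷ (y :≤ m) ∷ (con 1 :+ i :≤ con 1) ∷ (m :+ d :≤ con 3) ∷ [])
          (cover , degree-split D , proj₁ (deg5 v∈W v≢z) ,
           subst (_≤ 1) (mult-split D (v≢z ∘ sym)) (root≤1 v∈W v≢z) , leaving , far , ≰⇒> ¬1≤ , small)
          where
          cover : length C ≤ count z C + hits (∁ A − z) C + hits (A ∖ N) C + hits (A ∩ N) C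
          cover = subst (_≤ count z C + hits (∁ A − z) C + hits (A ∖ N) C + hits (A ∩ N) C) (∑-1 C) (∑-lin ((λ _ → 1) ∷ ⟦_⟧ ∘ ⁅ z ⁆ ∷ ⟦_⟧ ∘ (∁ A − z) ∷ ⟦_⟧ ∘ (A ∖ N) ∷ ⟦_⟧ ∘ (A ∩ N) ∷ [])
            (λ o c x y i → o :≤ c :+ x :+ y :+ i) C λ c _ → taut (A c) (z == c) (N c))
            where
            taut : ∀ a z ν → 1 ≤ ⟦ z ⟧ + ⟦ not a ∧ not z ⟧ + ⟦ a ∧ not ν ⟧ + ⟦ a ∧ ν ⟧
            taut = toWitness {a? = ∀ᵇ λ a → ∀ᵇ λ z → ∀ᵇ λ ν → _ ≤? _} tt

    -- In a triangle zuv, u is merged into z and v is deleted.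
    triangle : ∀ {A} → Block A → ∀ {v u} → A v ≡ true → N v ≡ true → A u ≡ true → N u ≡ true → v ≢ u →
               1 ≤ mult v u E → ⊥
    triangle {A} bl {v} {u} v∈A v∈N u∈A u∈N v≢u vu = go
      (pull-count Cv (subst (1 ≤_) (mult-split D₁ (v≢z ∘ sym)) (true-≤ᵇ v∈N)))
      where
      open Block bl
      v∈W = proj₁ (∈-−⁻ W {z} (A⊆U v v∈A))
      v≢z = proj₂ (∈-−⁻ W {z} (A⊆U v v∈A))
      u∈W = proj₁ (∈-−⁻ W {z} (A⊆U u u∈A))
      u≢z = proj₂ (∈-−⁻ W {z} (A⊆U u u∈A))
      D₁ : Decomposition v E
      D₁ = decompose v sparse
      open Decomposition D₁ using () renaming (C to Cv; R to R₁; split to split₁; avoids to avoids₁; off-centre to off-centre₁)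
      sparse₁ : Sparse R₁
      sparse₁ = sparse-++ʳ (star v Cv) (sparse-≋ split₁ sparse)
      D₂ = decompose u sparse₁
      open Decomposition D₂ using (R) renaming (C to Cu; split to split₂; avoids to avoids₂; off-centre to off-centre₂)

      count-u : count u Cv ≡ 1
      count-u = ≤-antisym (subst (_≤ 1) (mult-split D₁ (v≢u ∘ sym)) (simple v∈W u∈W v≢z u≢z v≢u))
        (subst (1 ≤_) (mult-split D₁ (v≢u ∘ sym)) vu)

      z-in-Cu : 1 ≤ count z Cu
      z-in-Cu = subst (1 ≤_) (begin
        mult u z E                       ≡⟨ ∑ᵉ-≋ (joining-sym u z) split₁ ⟩
        mult u z (star v Cv ++ R₁)       ≡⟨ ∑ᵉ-++ (joining u z) (star v Cv) R₁ ⟩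
        mult u z (star v Cv) + mult u z R₁ ≡⟨ cong₂ _+_ (mult-star-off Cv (v≢u ∘ sym) (v≢z ∘ sym)) (mult-split D₂ (u≢z ∘ sym)) ⟩
        count z Cu                       ∎) (true-≤ᵇ u∈N)
        where open ≡-Reasoning

      go : (∃ λ C′ → Cv ↭ z ∷ C′) → ⊥
      go (C₁ , p) = go′ (pull-count C₁ (≤-reflexive (sym count-u′))) (pull-count Cu z-in-Cu)
        where
        count-u′ : count u C₁ ≡ 1
        count-u′ = trans (sym (trans (∑-↭ _ p) (cong (_+ count u C₁) (⟦false⟧ (≢⇒== u≢z))))) count-u

        go′ : (∃ λ L → C₁ ↭ u ∷ L) → (∃ λ Xu → Cu ↭ z ∷ Xu) → ⊥
        go′ (L , q) (Xu , r) = below shorter I solved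
          where
          Cv-split : Cv ↭ z ∷ u ∷ L
          Cv-split = ↭-trans p (prep z q)
          #L : length L ≡ 3
          #L = lin (length L ∷ length Cv ∷ degree v E ∷ [])
            (λ l c d → (c :≡˘ con 1 :+ (con 1 :+ l)) ∷ (d :≡˘ c) ∷ (d :≡ con 5) ∷ [] ⊢ l :≡ con 3)
            (↭-length Cv-split , degree-split D₁ , proj₁ (deg5 v∈W v≢z))
          #Xu : length Xu ≡ 3
          #Xu = lin (length Xu ∷ length Cu ∷ count u Cv ∷ degree u R₁ ∷ degree u E ∷ [])
            (λ x c k r d → (c :≡˘ con 1 :+ x) ∷ (d :≡˘ k :+ r) ∷ (r :≡˘ c) ∷ (d :≡ con 5) ∷ (k :≡˘ con 1) ∷ [] ⊢ x :≡ con 3)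
            (↭-length r , degree-other D₁ (v≢u ∘ sym) , degree-split D₂ , proj₁ (deg5 u∈W u≢z) , count-u)
          u∉L : u ∉ L
          u∉L = count-zero (lin (count u L ∷ count u C₁ ∷ ⟦ u == u ⟧ ∷ [])
            (λ l c i → (c :≡˘ i :+ l) ∷ (c :≡ con 1) ∷ (i :≡˘ con 1) ∷ [] ⊢ l :≡ con 0)
            (∑-↭ _ q , count-u′ , ⟦true⟧ (==-refl u)))
          avoids-v : All (Avoids v) (star u Cu ++ R)
          avoids-v = avoids-≋ split₂ avoids₁
          Xu≢v : All (_≢ v) Xu
          Xu≢v = All.tail (All-resp-↭ r (All.map proj₂ (All.map⁻ (All.++⁻ˡ (star u Cu) avoids-v))))
          Xu≢u : All (_≢ u) Xu
          Xu≢u = All.tail (All-resp-↭ r off-centre₂)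
          within₂ : Within W (star u Cu ++ R)
          within₂ = within-≋ split₂ (All.++⁻ʳ (star v Cv) (within-≋ split₁ within))
          Xu⊆W : All (λ c → W c ≡ true) Xu
          Xu⊆W = All.tail (All-resp-↭ r (within-star Cu (All.++⁻ˡ (star u Cu) within₂)))
          E′ = star z Xu ++ R
          avoids-star : ∀ {w} → z ≢ w → All (_≢ w) Xu → All (Avoids w) (star z Xu)
          avoids-star z≢w h = All.map⁺ (All.map (z≢w ,_) h)
          avoids-v′ : All (Avoids v) E′
          avoids-v′ = All.++⁺ (avoids-star (v≢z ∘ sym) Xu≢v) (All.++⁻ʳ (star u Cu) avoids-v)
          avoids-u′ : All (Avoids u) E′
          avoids-u′ = All.++⁺ (avoids-star (u≢z ∘ sym) Xu≢u) avoids₂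
          #E′ : length E′ ≡ 3 + length R
          #E′ = trans (List.length-++ (star z Xu)) (cong (_+ length R) (trans (List.length-map (z ,_) Xu) #Xu))
          #E : length E ≡ 9 + length R
          #E = lin (length E ∷ length Cv ∷ length R₁ ∷ length L ∷ length Cu ∷ length Xu ∷ length R ∷ [])
            (λ e cv r₁ l cu x r → (e :≡ cv :+ r₁) ∷ (cv :≡ con 1 :+ (con 1 :+ l)) ∷ (l :≡ con 3) ∷ (r₁ :≡ cu :+ r) ∷
              (cu :≡ con 1 :+ x) ∷ (x :≡ con 3) ∷ [] ⊢ e :≡ con 9 :+ r)
            (length-split D₁ , ↭-length Cv-split , #L , length-split D₂ , ↭-length r , #Xu)
          shorter : length E′ < length E
          shorter = lin (length E′ ∷ length E ∷ length R ∷ [])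
            (λ e′ e r → (e′ :≡ con 3 :+ r) ∷ (e :≡˘ con 9 :+ r) ∷ [] ⊢ con 1 :+ e′ :≤ e) (#E′ , #E)

          σ : StarBoundary v L 𝟘
          σ = star-boundary L (All.tail (All.tail (All-resp-↭ Cv-split off-centre₁)))
            (subst (λ i → Reachable i 𝟘) (sym #L) reach₂₊)
          β′ : Fin ν → ℤ₃
          β′ w = β w ⊖ boundary σ w
          W′ = W − v − u
          u∈W−v : (W − v) u ≡ true
          u∈W−v = ∈-− {W = W} u∈W (v≢u ∘ sym)

          sparse′ : Sparse E′
          sparse′ V ne = by-root (bool (V z))
            where
            e-E : ∀ Y → e[ Y ] E ≡ e[ Y ] (star v Cv) + (e[ Y ] (star u Cu) + e[ Y ] R)
            e-E Y = trans (∑ᵉ-≋ (inside-sym Y) split₁) (trans (∑ᵉ-++ (inside Y) (star v Cv) R₁)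
              (cong (e[ Y ] (star v Cv) +_) (trans (∑ᵉ-≋ (inside-sym Y) split₂) (∑ᵉ-++ (inside Y) (star u Cu) R))))
            by-root : V z ≡ true ⊎ V z ≡ false → e[ V ] E′ + 3 ≤ 3 * card V
            by-root (inj₂ z∉V) = lin (e[ V ] E′ ∷ e[ V ] (star z Xu) ∷ e[ V ] R ∷ e[ V ] E ∷
                e[ V ] (star v Cv) ∷ e[ V ] (star u Cu) ∷ card V ∷ [])
              (λ e′ s r e a b c → (e′ :≡ s :+ r) ∷ (s :≡ con 0) ∷ (e :≡˘ a :+ (b :+ r)) ∷ (e :+ con 3 :≤ 3 :* c) ∷ [] ⊢
                e′ :+ con 3 :≤ 3 :* c)
              (∑ᵉ-++ (inside V) (star z Xu) R ,
               trans (∑ᵉ-star (inside V) z Xu) (trans (∑-cong Xu λ c _ → ⟦false⟧ (cong (_∧ V c) z∉V)) (∑-0 Xu)) ,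
               e-E V , sparse V ne)
            -- The set `Y` contains `u` but not `v`, so `very-sparse` applies. It spans all that `V`
            -- spans in `E′`, and the edge `uz` besides: 3(|V| + 1) - 5 - 1 = 3|V| - 3.
            by-root (inj₁ z∈V) = lin (e[ V ] E′ ∷ e[ V ] (star z Xu) ∷ e[ V ] R ∷ hits V Xu ∷ hits Y Xu ∷ hits Y Cu ∷ ⟦ Y z ⟧ ∷ e[ Y ] E ∷
                e[ Y ] (star v Cv) ∷ e[ Y ] (star u Cu) ∷ e[ Y ] R ∷ card V ∷ card (V ∪ ⁅ u ⁆) ∷ card Y ∷ [])
              (λ e′ s r h h′ k i e a b r′ c c′ y → (e′ :≡ s :+ r) ∷ (s :≡ h) ∷ (h :≤ h′) ∷ (k :≡˘ i :+ h′) ∷ (i :≡˘ con 1) ∷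
                (b :≡˘ k) ∷ (r :≤ r′) ∷ (e :≡˘ a :+ (b :+ r′)) ∷ (e :+ con 5 :≤ 3 :* y) ∷ 3 ⨾ (y :≤ c′) ∷ 3 ⨾ (c′ :≤ con 1 :+ c) ∷ [] ⊢
                e′ :+ con 3 :≤ 3 :* c)
              (∑ᵉ-++ (inside V) (star z Xu) R , e-star Xu z∈V ,
               ∑-mono Xu (λ c c∈ → ⊆-⟦⟧ (V⊆Y c (All.lookup Xu≢v c∈))) ,
               ∑-↭ (⟦_⟧ ∘ Y) r , ⟦true⟧ z∈Y , e-star Cu u∈Y ,
               ∑-mono R (λ (a , b) ab∈ → let a≢v , b≢v = All.lookup (All.++⁻ʳ (star u Cu) avoids-v) ab∈ in
                 ⊆-⟦⟧ λ h → cong₂ _∧_ (V⊆Y a a≢v (∧-trueˡ h)) (V⊆Y b b≢v (∧-trueʳ {V a} h))) ,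
               e-E Y , very-sparse bl u∈A v∈A Y z∈Y u∈Y v∉Y , card-mono {X = Y} (λ w → ∧-trueˡ) , card-∪-⁅⁆ V u)
              where
              Y : VSet ν
              Y = V ∪ ⁅ u ⁆ − v
              V⊆Y : ∀ c → c ≢ v → V c ≡ true → Y c ≡ true
              V⊆Y c c≢v h = ∈-− {W = V ∪ ⁅ u ⁆} (⊆-∪ˡ V ⁅ u ⁆ c h) c≢v
              z∈Y : Y z ≡ true
              z∈Y = V⊆Y z (v≢z ∘ sym) z∈V
              u∈Y : Y u ≡ true
              u∈Y = ∈-− {W = V ∪ ⁅ u ⁆} (∈-∪-⁅⁆ V u) (v≢u ∘ sym)
              v∉Y : Y v ≡ false
              v∉Y = trans (cong (λ b → (V ∪ ⁅ u ⁆) v ∧ not b) (==-refl v)) (Bool.∧-zeroʳ _)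

          I : Instance W′ E′ β′
          I = record
            { root   = ∈-− {W = W − v} (∈-− {W = W} root (v≢z ∘ sym)) (u≢z ∘ sym)
            ; within = within-− {W = W − v} (within-− {W = W} (All.++⁺ (All.map⁺ (All.map (root ,_) Xu⊆W))
                         (All.++⁻ʳ (star u Cu) within₂)) avoids-v′) avoids-u′
            ; sparse = λ V ne _ _ _ → sparse′ V ne
            ; dense  = lin (card W ∷ card (W − v) ∷ card W′ ∷ length E′ ∷ length E ∷ length R ∷ [])
                (λ w w₁ w′ e′ e r → 3 ⨾ (w :≡˘ con 1 :+ w₁) ∷ 3 ⨾ (w₁ :≡˘ con 1 :+ w′) ∷ (e′ :≡˘ con 3 :+ r) ∷
                  (e :≡ con 9 :+ r) ∷ (3 :* w :≡ e :+ con 4) ∷ [] ⊢ 3 :* w′ :≤ e′ :+ con 4)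
                (card-− {W = W} v∈W , card-− {W = W − v} u∈W−v , #E′ , #E , exact)
            ; good   = λ w w∈ w≢z → let w∈₁ , w≢u = ∈-−⁻ (W − v) w∈ ; w∈W , w≢v = ∈-−⁻ W w∈₁ in
                inj₁ (lin (degree w E′ ∷ degree w (star z Xu) ∷ count w Xu ∷ degree w R ∷ count w Cu ∷ ⟦ w == z ⟧ ∷
                           degree w R₁ ∷ count w Cv ∷ degree w E ∷ [])
                  (λ d′ s x r cu i r₁ cv d → (d′ :≡ s :+ r) ∷ (s :≡ x) ∷ (cu :≡˘ i :+ x) ∷ (r₁ :≡˘ cu :+ r) ∷
                    (d :≡˘ cv :+ r₁) ∷ (d :≡ con 5) ∷ [] ⊢ d′ :≤ con 5)
                  (∑ᵉ-++ (touching w) (star z Xu) R , degree-star Xu w≢z , ∑-↭ _ r , degree-other D₂ w≢u ,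
                   degree-other D₁ w≢v , proj₁ (deg5 w∈W w≢z)))
            }

          whole : E ≋ (v , z) ∷ (v , u) ∷ star v L ++ (u , z) ∷ star u Xu ++ R
          whole = ≋-trans split₁ (≋-trans (star-↭ v R₁ Cv-split)
            (++⁺ʳ-≋ (star v (z ∷ u ∷ L)) (≋-trans split₂ (star-↭ u R r))))

          solved : Solution W′ E′ β′ → ⊥
          solved (f , at , h) = conclude (move-star Xu {f = f} (u≢z ∘ sym) at)
            where
            conclude : ∃ (Shifted z u (star u Xu ++ R) f) → ⊥
            -- Splitting `u` from `z` again leaves an uncontrolled boundary at `u`. The triangle
            -- corrects it, and whatever this does to `z` is permitted.
            conclude (f₁ , sh) = finish (close-triangle v≢z u≢z v≢u σ u∉L
                (trans (off sh v v≢z v≢u) (attains-avoids avoids-v′ at)) (attains sh))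
              where
              finish : TriangleBoundary v u z L (star u Xu ++ R) f₁ σ → ⊥
              finish (triangleBoundary g at-g g-u g-v other) = unsolved (g , attains-≋ whole at-g , correct)
                where
                elsewhere′ : ∀ w → W w ≡ true → w ≢ z → w ≢ u → w ≢ v → g w ≡ β w
                elsewhere′ w w∈W w≢z w≢u w≢v = begin
                  g w                               ≡⟨ other w w≢z w≢u w≢v ⟩
                  f₁ w ⊕ boundary σ w               ≡⟨ cong (_⊕ boundary σ w) (trans (off sh w w≢z w≢u)
                    (h w (∈-− {W = W − v} (∈-− {W = W} w∈W w≢v) w≢u) w≢z)) ⟩
                  β w ⊖ boundary σ w ⊕ boundary σ w ≡⟨ ⊖-⊕ (β w) _ ⟩
                  β w                               ∎
                  where open ≡-Reasoning
                correct : ∀ w → W w ≡ true → w ≢ z → g w ≡ β w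
                correct w w∈W w≢z = by-cases (w ≟ᶠ u) (w ≟ᶠ v)
                  where
                  by-cases : Dec (w ≡ u) → Dec (w ≡ v) → g w ≡ β w
                  by-cases (yes w≡u) _         = subst (λ w → g w ≡ β w) (sym w≡u) (trans g-u (sym (proj₂ (deg5 u∈W u≢z))))
                  by-cases (no _)    (yes w≡v) = subst (λ w → g w ≡ β w) (sym w≡v) (trans g-v (sym (proj₂ (deg5 v∈W v≢z))))
                  by-cases (no w≢u)  (no w≢v)  = elsewhere′ w w∈W w≢z w≢u w≢v

    impossible : Nonempty U → ⊥
    impossible ne = block ne λ (A , bl) → adjacent-pair bl (triangle bl)

-- The induction on the number of edges

module Main {ν} (z : Fin ν) where

  open Rooted z
  open Reductions z
  open Parallel z
  open Triangles z

  solve : ∀ k {W E β} → length E < k → Instance W E β → ¬ ¬ Solution W E β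
  solve (suc k) {W} {E} {β} lt I unsolved = em {∃ λ v → W v ≡ true × v ≢ z} λ where
      -- If `W` contains only the root, nothing is prescribed and every orientation is a solution.
      (inj₂ none) → unsolved (proj₁ (attains-some E) , proj₂ (attains-some E) ,
        λ w w∈W w≢z → ⊥-elim (none (w , w∈W , w≢z)))
      (inj₁ (v , v∈W , v≢z)) → by-density v v∈W v≢z (3 * card W ≤? length E + 3)
    where
    open Instance I
    below : Below E
    below lt′ = solve k (≤-trans lt′ (≤-pred lt))

    by-density : ∀ v → W v ≡ true → v ≢ z → Dec (3 * card W ≤ length E + 3) → ⊥
    by-density v v∈W v≢z (yes more) = drop E I unsolved below more
      where
      two : 2 ≤ card W
      two = subst (2 ≤_) (sym (card-− {W = W} root)) (s≤s (subst (_≤ card (W − z)) (card-⁅⁆ v)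
        (card-mono λ w h → subst (λ w → (W − z) w ≡ true) (==⇒≡ {a = v} {w} h) (∈-− {W = W} v∈W v≢z))))
      drop : ∀ E → Instance W E β → ¬ Solution W E β → Below E → 3 * card W ≤ length E + 3 → ⊥
      drop []      _ _ _ h = lin⊥ (card W ∷ []) (λ w → (3 :* w :≤ con 3) ∷ 3 ⨾ (con 2 :≤ w) ∷ []) (h , two)
      drop (e ∷ E) I unsolved below h = drop-edge I (≤-trans h (≤-reflexive (sym (+-suc (length E) 3)))) below unsolved
    by-density v v∈W v≢z (no ¬more) = impossible X below unsolved deg5 (root-mult≤1 X below unsolved)
        (parallel≤1 X below unsolved deg5) (v , ∈-− {W = W} v∈W v≢z)
      where
      exact : 3 * card W ≡ length E + 4
      exact = ≤-antisym dense (≤-trans (≤-reflexive (+-suc (length E) 3)) (≰⇒> ¬more))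
      sparse′ : Sparse E
      sparse′ V ne = stable-≤ λ dense-V → em {∃ λ w → W w ≡ true × V w ≡ false} λ where
        (inj₁ (w , w∈W , w∉V)) → dense-V (sparse V ne w w∈W w∉V)
        (inj₂ none) → dense-V (lin (e[ V ] E ∷ length E ∷ card W ∷ card V ∷ [])
          (λ e l w c → (e :≤ l) ∷ (3 :* w :≡˘ l :+ con 4) ∷ 3 ⨾ (w :≤ c) ∷ [] ⊢ e :+ con 3 :≤ 3 :* c)
          (subst (e[ V ] E ≤_) (∑-1 E) (∑-mono E λ _ _ → ⟦⟧≤1 _) , exact ,
           card-mono λ w w∈W → [ id , (λ w∉V → ⊥-elim (none (w , w∈W , w∉V))) ]′ (bool (V w))))
      X : Exact W E β
      X = record { root = root ; within = within ; sparse = sparse′ ; exact = exact ; good = good }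
      deg5 : ∀ {v} → W v ≡ true → v ≢ z → degree v E ≡ 5 × β v ≡ 𝟘
      deg5 = degree≡5 X below unsolved

-- Flows and quotients

mod₃ : ℕ → ℤ₃
mod₃ zero    = 𝟘
mod₃ (suc m) = 𝟙 ⊕ mod₃ m

residue : ℤ₃ → ℕ
residue 𝟘 = 0
residue 𝟙 = 1
residue 𝟚 = 2

residue-injective : ∀ x y → residue x ≡ residue y → x ≡ y
residue-injective = toWitness {a? = ∀₃ λ x → ∀₃ λ y → (_ ≟ _) →-dec (_ ≟₃ _)} tt

residue-mod₃ : ∀ m → residue (mod₃ m) ≡ m % 3
residue-mod₃ 0 = refl
residue-mod₃ 1 = refl
residue-mod₃ 2 = refl
residue-mod₃ (suc (suc (suc m))) = trans (cong residue (three (mod₃ m))) (residue-mod₃ m)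
  where
  three : ∀ x → 𝟙 ⊕ (𝟙 ⊕ (𝟙 ⊕ x)) ≡ x
  three = toWitness {a? = ∀₃ λ x → _ ≟₃ _} tt

mod₃-≡ : ∀ a b → a % 3 ≡ b % 3 → mod₃ a ≡ mod₃ b
mod₃-≡ a b h = residue-injective (mod₃ a) (mod₃ b) (trans (residue-mod₃ a) (trans h (sym (residue-mod₃ b))))

≡-mod₃ : ∀ a b → mod₃ a ≡ mod₃ b → a % 3 ≡ b % 3
≡-mod₃ a b h = trans (sym (residue-mod₃ a)) (trans (cong residue h) (residue-mod₃ b))

net : List (Edge ν) → Fin ν → ℤ₃
net D v = mod₃ (outdeg D v) ⊖ mod₃ (indeg D v)

net-∷ : ∀ (a b : Fin ν) D v → net ((a , b) ∷ D) v ≡ net D v ⊕ χ true (a , b) v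
net-∷ a b D v with a ≟ᶠ v | b ≟ᶠ v
... | yes _ | yes _ = both (mod₃ (outdeg D v)) (mod₃ (indeg D v))
  where
  both : ∀ x y → (𝟙 ⊕ x) ⊖ (𝟙 ⊕ y) ≡ x ⊖ y ⊕ (𝟙 ⊖ 𝟙)
  both = toWitness {a? = ∀₃ λ x → ∀₃ λ y → _ ≟₃ _} tt
... | yes _ | no _  = out (mod₃ (outdeg D v)) (mod₃ (indeg D v))
  where
  out : ∀ x y → (𝟙 ⊕ x) ⊖ y ≡ x ⊖ y ⊕ (𝟙 ⊖ 𝟘)
  out = toWitness {a? = ∀₃ λ x → ∀₃ λ y → _ ≟₃ _} tt
... | no _  | yes _ = in′ (mod₃ (outdeg D v)) (mod₃ (indeg D v))
  where
  in′ : ∀ x y → x ⊖ (𝟙 ⊕ y) ≡ x ⊖ y ⊕ (𝟘 ⊖ 𝟙)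
  in′ = toWitness {a? = ∀₃ λ x → ∀₃ λ y → _ ≟₃ _} tt
... | no _  | no _  = sym (⊕-identityʳ _)

oriented⇒attains : ∀ {E D : List (Edge ν)} → Orientation E D → Attains E (net D)
oriented⇒attains [] = λ v → refl
oriented⇒attains {E = (a , b) ∷ E} {_ ∷ D} (inj₁ refl ∷ o) = true ,
  attains-cong E (λ v → sym (trans (cong (_⊖ χ true (a , b) v) (net-∷ a b D v)) (⊕-⊖ (net D v) _))) (oriented⇒attains o)
oriented⇒attains {E = (a , b) ∷ E} {_ ∷ D} (inj₂ refl ∷ o) = false ,
  attains-cong E (λ v → sym (trans (cong (_⊖ χ true (b , a) v) (net-∷ b a D v)) (⊕-⊖ (net D v) _))) (oriented⇒attains o)

attains⇒oriented : ∀ (E : List (Edge ν)) {f} → Attains E f → ∃ λ D → Orientation E D × (∀ v → net D v ≡ f v)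
attains⇒oriented [] p = [] , [] , λ v → sym (p v)
attains⇒oriented ((a , b) ∷ E) {f} (true , p) = let D , o , h = attains⇒oriented E p in
  (a , b) ∷ D , inj₁ refl ∷ o , λ v → trans (net-∷ a b D v) (trans (cong (_⊕ _) (h v)) (⊖-⊕ (f v) _))
attains⇒oriented ((a , b) ∷ E) {f} (false , p) = let D , o , h = attains⇒oriented E p in
  (b , a) ∷ D , inj₂ refl ∷ o , λ v → trans (net-∷ b a D v) (trans (cong (_⊕ _) (h v)) (⊖-⊕ (f v) _))

flow⇒attains : ∀ {E : List (Edge ν)} → HasNZ3Flow ν E → Attains E (λ _ → 𝟘)
flow⇒attains {E = E} (D , o , bal) = attains-cong E
  (λ v → trans (cong (_⊖ mod₃ (indeg D v)) (mod₃-≡ (outdeg D v) (indeg D v) (bal v))) (cancel (mod₃ (indeg D v)))) (oriented⇒attains o)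
  where
  cancel : ∀ x → x ⊖ x ≡ 𝟘
  cancel = toWitness {a? = ∀₃ λ x → _ ≟₃ _} tt

attains⇒flow : ∀ {E : List (Edge ν)} {f} → (∀ v → f v ≡ 𝟘) → Attains E f → HasNZ3Flow ν E
attains⇒flow {E = E} f≡𝟘 p = let D , o , h = attains⇒oriented E p in
  D , o , λ v → ≡-mod₃ (outdeg D v) (indeg D v) (equal (mod₃ (outdeg D v)) (mod₃ (indeg D v)) (trans (h v) (f≡𝟘 v)))
  where
  equal : ∀ x y → x ⊖ y ≡ 𝟘 → x ≡ y
  equal = toWitness {a? = ∀₃ λ x → ∀₃ λ y → (_ ≟₃ _) →-dec (_ ≟₃ _)} tt

length-filter : ∀ (f : A → Fin ν) v l → length (filter (λ x → f x ≟ᶠ v) l) ≡ ∑ (λ x → ⟦ v == f x ⟧) l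
length-filter f v [] = refl
length-filter f v (x ∷ l) rewrite ==-sym v (f x) with f x ≟ᶠ v
... | yes _ = cong suc (length-filter f v l)
... | no _  = length-filter f v l

deg-degree : ∀ (G : Graph) v → deg G v ≡ degree v (edges G)
deg-degree G v = trans (cong₂ _+_ (length-filter proj₁ v (edges G)) (length-filter proj₂ v (edges G)))
  (sym (∑-+ _ _ (edges G)))

Σ₃ : ∀ {ν} → (Fin ν → ℤ₃) → ℤ₃
Σ₃ {zero}  f = 𝟘
Σ₃ {suc ν} f = f zero ⊕ Σ₃ (f ∘ suc)

Σ₃-⊖ : ∀ {ν} (f g : Fin ν → ℤ₃) → Σ₃ (λ v → f v ⊖ g v) ≡ Σ₃ f ⊖ Σ₃ g
Σ₃-⊖ {zero}  f g = refl
Σ₃-⊖ {suc ν} f g = trans (cong (f zero ⊖ g zero ⊕_) (Σ₃-⊖ (f ∘ suc) (g ∘ suc))) (exchange (f zero) (g zero) _ _)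
  where
  exchange : ∀ a b c d → a ⊖ b ⊕ (c ⊖ d) ≡ a ⊕ c ⊖ (b ⊕ d)
  exchange = toWitness {a? = ∀₃ λ a → ∀₃ λ b → ∀₃ λ c → ∀₃ λ d → _ ≟₃ _} tt

Σ₃-cong : ∀ {ν} {f g : Fin ν → ℤ₃} → (∀ v → f v ≡ g v) → Σ₃ f ≡ Σ₃ g
Σ₃-cong {zero}  h = refl
Σ₃-cong {suc ν} h = cong₂ _⊕_ (h zero) (Σ₃-cong (h ∘ suc))

Σ₃-𝟘 : ∀ ν → Σ₃ {ν} (λ _ → 𝟘) ≡ 𝟘
Σ₃-𝟘 zero    = refl
Σ₃-𝟘 (suc ν) = Σ₃-𝟘 ν

Σ₃-δ : ∀ {ν} (a : Fin ν) → Σ₃ (δ a) ≡ 𝟙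
Σ₃-δ {suc ν} zero    = cong (𝟙 ⊕_) (Σ₃-𝟘 ν)
Σ₃-δ {suc ν} (suc a) = Σ₃-δ a

Σ₃-attains : ∀ {E : List (Edge ν)} {f} → Attains E f → Σ₃ f ≡ 𝟘
Σ₃-attains {ν} {[]} p = trans (Σ₃-cong p) (Σ₃-𝟘 ν)
Σ₃-attains {E = (a , b) ∷ E} {f} (s , p) = begin
  Σ₃ f                            ≡⟨ trans (cong (Σ₃ f ⊖_) (Σ₃-χ s)) (⊕-identityʳ _) ⟨
  Σ₃ f ⊖ Σ₃ (χ s (a , b))         ≡⟨ Σ₃-⊖ f (χ s (a , b)) ⟨
  Σ₃ (λ v → f v ⊖ χ s (a , b) v)  ≡⟨ Σ₃-attains p ⟩
  𝟘                               ∎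
  where
  open ≡-Reasoning
  Σ₃-χ : ∀ s → Σ₃ (χ s (a , b)) ≡ 𝟘
  Σ₃-χ true  = trans (Σ₃-⊖ (δ a) (δ b)) (cong₂ _⊖_ (Σ₃-δ a) (Σ₃-δ b))
  Σ₃-χ false = trans (Σ₃-⊖ (δ b) (δ a)) (cong₂ _⊖_ (Σ₃-δ b) (Σ₃-δ a))

-- The values of a boundary sum to 0, so it cannot be nonzero at exactly one vertex. This is why no
-- prescription at the root is needed.
vanishes-at-root : ∀ {E : List (Edge ν)} {f} (z : Fin ν) → Attains E f → (∀ w → w ≢ z → f w ≡ 𝟘) → f z ≡ 𝟘
vanishes-at-root {ν} {E} {f} z p h = by-value (f z) refl
  where
  by-value : ∀ x → f z ≡ x → f z ≡ 𝟘
  by-value 𝟘 eq = eq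
  by-value 𝟙 eq = case trans (sym (Σ₃-attains p)) (trans (Σ₃-cong same) (Σ₃-δ z)) of λ ()
    where
    same : ∀ w → f w ≡ δ z w
    same w with w ≟ᶠ z
    ... | yes refl = trans eq (sym (δ-refl z))
    ... | no w≢z   = trans (h w w≢z) (sym (δ-≢ (w≢z ∘ sym)))
  by-value 𝟚 eq = case trans (sym (Σ₃-attains p)) (trans (Σ₃-cong same)
      (trans (Σ₃-⊖ (λ _ → 𝟘) (δ z)) (cong₂ _⊖_ (Σ₃-𝟘 ν) (Σ₃-δ z)))) of λ ()
    where
    same : ∀ w → f w ≡ 𝟘 ⊖ δ z w
    same w with w ≟ᶠ z
    ... | yes refl = trans eq (cong (𝟘 ⊖_) (sym (δ-refl z)))
    ... | no w≢z   = trans (h w w≢z) (cong (𝟘 ⊖_) (sym (δ-≢ (w≢z ∘ sym))))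

lookup-injective : ∀ {l : List A} → Unique l → ∀ i j → List.lookup l i ≡ List.lookup l j → i ≡ j
lookup-injective (x ∷ u) zero    zero    _  = refl
lookup-injective (x ∷ u) zero    (suc j) eq = ⊥-elim (All.lookup x (∈-lookup j) eq)
lookup-injective (x ∷ u) (suc i) zero    eq = ⊥-elim (All.lookup x (∈-lookup i) (sym eq))
lookup-injective (x ∷ u) (suc i) (suc j) eq = cong suc (lookup-injective u i j eq)

record Quotient (f : Fin ν → Fin ν) : Set where
  field
    k          : ℕ
    p          : Fin ν → Fin k
    surjective : Surjective _≡_ _≡_ p
    identifies : ∀ {x y} → f x ≡ f y → p x ≡ p y
    separates  : ∀ {x y} → p x ≡ p y → f x ≡ f y

-- The parts are the fibres of `f`. Their representatives are its fixed points, numbered by their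
-- positions in the list of all fixed points to obtain a surjection onto some `Fin k`.
quotient : ∀ (f : Fin ν → Fin ν) → (∀ x → f (f x) ≡ f x) → Quotient f
quotient {ν} f idem = record
  { k = length L ; p = p ; surjective = surj
  ; identifies = λ {x} {y} eq → injective (trans (look x) (trans eq (sym (look y))))
  ; separates  = λ {x} {y} eq → trans (sym (look x)) (trans (cong (List.lookup L) eq) (look y)) }
  where
  fixed? : ∀ x → Dec (f x ≡ x)
  fixed? x = f x ≟ᶠ x
  L : List (Fin ν)
  L = filter fixed? (allFin ν)
  injective : ∀ {i j} → List.lookup L i ≡ List.lookup L j → i ≡ j
  injective {i} {j} = lookup-injective (Unique.filter⁺ fixed? (Unique.allFin⁺ ν)) i j
  member : ∀ x → f x ∈ L
  member x = ∈-filter⁺ fixed? (∈-allFin (f x)) (idem x)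
  p : Fin ν → Fin (length L)
  p x = Any.index (member x)
  look : ∀ x → List.lookup L (p x) ≡ f x
  look x = sym (lookup-index (member x))
  surj : Surjective _≡_ _≡_ p
  surj i = List.lookup L i , λ { refl → injective (trans (look _)
    (proj₂ (∈-filter⁻ fixed? {xs = allFin ν} (∈-lookup i)))) }

-- Vertices outside `X` are parts by themselves and keep their boundary. An edge that became a loop
-- gets an arbitrary direction: having distinct ends in one part, or being a loop, it contributes
-- nothing outside `X`.
unquotient : ∀ {k} (p : Fin ν → Fin k) (X : VSet ν) → (∀ {x v} → X v ≡ false → p x ≡ p v → x ≡ v) →
  ∀ E {g} → Attains (quotientEdges p E) g → ∃ λ f → Attains E f × (∀ v → X v ≡ false → f v ≡ g (p v))
unquotient p X alone [] {g} q = (λ _ → 𝟘) , (λ _ → refl) , λ v _ → sym (q (p v))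
unquotient {ν} p X alone ((a , b) ∷ E) {g} q with p a ≟ᶠ p b
... | yes pa≡pb = let f , at , h = unquotient p X alone E q in
  _ , attains-∷ true (a , b) {f = f} at , λ v v∉X → trans (cong₂ _⊕_ (h v v∉X) (loop v v∉X)) (⊕-identityʳ _)
  where
  loop : ∀ v → X v ≡ false → χ true (a , b) v ≡ 𝟘
  loop v v∉X with a ≟ᶠ v | b ≟ᶠ v
  ... | yes _    | yes _    = refl
  ... | no _     | no _     = refl
  ... | yes refl | no b≢v   = ⊥-elim (b≢v (alone v∉X (sym pa≡pb)))
  ... | no a≢v   | yes refl = ⊥-elim (a≢v (alone v∉X pa≡pb))
... | no _ = let s , q′ = q ; f , at , h = unquotient p X alone E q′ in
  _ , attains-∷ s (a , b) {f = f} at , λ v v∉X →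
    trans (cong₂ _⊕_ (h v v∉X) (sym (χ-p s v v∉X))) (⊖-⊕ (g (p v)) _)
  where
  δ-p : ∀ c v → X v ≡ false → δ (p c) (p v) ≡ δ c v
  δ-p c v v∉X with c ≟ᶠ v
  ... | yes refl = δ-refl (p c)
  ... | no c≢v   = δ-≢ (c≢v ∘ alone v∉X)
  χ-p : ∀ s v → X v ≡ false → χ s (p a , p b) (p v) ≡ χ s (a , b) v
  χ-p true  v v∉X = cong₂ _⊖_ (δ-p a v v∉X) (δ-p b v v∉X)
  χ-p false v v∉X = cong₂ _⊖_ (δ-p b v v∉X) (δ-p a v v∉X)

attains-++⁺ : ∀ {E F : List (Edge ν)} {f g} → Attains E f → Attains F g → Attains (E ++ F) (λ v → f v ⊕ g v)
attains-++⁺ {E = []} {F} {f} {g} p q = attains-cong F (λ v → sym (cong (_⊕ g v) (p v))) q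
attains-++⁺ {E = e ∷ E} {F} {f} {g} (s , p) q = s , attains-cong (E ++ F)
  (λ v → exchange (f v) (χ s e v) (g v)) (attains-++⁺ {E = E} p q)
  where
  exchange : ∀ a b c → a ⊖ b ⊕ c ≡ a ⊕ c ⊖ b
  exchange = toWitness {a? = ∀₃ λ a → ∀₃ λ b → ∀₃ λ c → _ ≟₃ _} tt

attains-++⁻ : ∀ (E : List (Edge ν)) {F h} → Attains (E ++ F) h →
  ∃₂ λ f g → Attains E f × Attains F g × (∀ v → f v ⊕ g v ≡ h v)
attains-++⁻ [] {F} {h} p = (λ _ → 𝟘) , h , (λ _ → refl) , p , λ _ → refl
attains-++⁻ (e ∷ E) {F} {h} (s , p) = let f , g , pf , pg , eq = attains-++⁻ E p in
  (λ v → f v ⊕ χ s e v) , g , attains-∷ s e {f = f} pf , pg , λ v → regroup (f v) (χ s e v) (g v) (h v) (eq v)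
  where
  regroup : ∀ a b c d → a ⊕ c ≡ d ⊖ b → a ⊕ b ⊕ c ≡ d
  regroup = toWitness {a? = ∀₃ λ a → ∀₃ λ b → ∀₃ λ c → ∀₃ λ d → (_ ≟₃ _) →-dec (_ ≟₃ _)} tt

separate-inside : ∀ (X : VSet ν) E → ∃₂ λ F R → E ≋ F ++ R × Within X F ×
  All (λ e → X (proj₁ e) ∧ X (proj₂ e) ≡ false) R
separate-inside X [] = [] , [] , ≋-refl , [] , []
separate-inside X ((a , b) ∷ E) with separate-inside X E | bool (X a ∧ X b)
... | F , R , p , i , o | inj₁ h = (a , b) ∷ F , R , ≋-prep _ p , (∧-trueˡ h , ∧-trueʳ {X a} h) ∷ i , o
... | F , R , p , i , o | inj₂ h = F , (a , b) ∷ R , ≋-trans (≋-prep _ p) (shift-≋ _ F) , i , h ∷ o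

degree-zero : ∀ {v : Fin ν} {E} → degree v E ≡ 0 → All (Avoids v) E
degree-zero {v = v} {E} h = All.tabulate λ { {a , b} e∈E →
  [ (λ 1≤ → ⊥-elim (<⇒≱ 1≤ (≤-trans (∑-≥ _ e∈E) (≤-reflexive h)))) ,
    (λ (p , q) → (p ∘ sym) , (q ∘ sym)) ]′ (incident v a b) }

nonempty-card : ∀ {X : VSet ν} → Nonempty X → 1 ≤ card X
nonempty-card {X = X} (v , v∈X) = subst (_≤ card X) (card-⁅⁆ v)
  (card-mono λ w h → subst (λ w → X w ≡ true) (==⇒≡ {a = v} {w} h) v∈X)

distinct-card : ∀ {X : VSet ν} {a b} → X a ≡ true → X b ≡ true → a ≢ b → 2 ≤ card X
distinct-card {X = X} {a} {b} a∈X b∈X a≢b = subst (_< card X) (card-⁅⁆ a)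
  (card-strict (λ w h → subst (λ w → X w ≡ true) (==⇒≡ {a = a} {w} h) a∈X) b (≢⇒== a≢b) b∈X)

-- Flow-critical graphs

module Critical (G : Graph) (critical : FlowCritical G)
  (one-big : ∀ (u v : Fin (n G)) → 7 ≤ deg G u → 7 ≤ deg G v → u ≡ v) where

  V : ℕ
  V = n G

  E : List (Edge V)
  E = edges G

  -- Single vertices satisfy the inequality, as 3 ≤ 0 + 4, so they have to be excluded; two vertices
  -- also make the contraction of `B` non-trivial.
  Dense : VSet V → Set
  Dense B = 2 ≤ card B × 3 * card B ≤ e[ B ] E + 4

  full : VSet V
  full _ = true

  no-edges : ∀ {X : VSet V} → card X ≤ 1 → e[ X ] E ≡ 0
  no-edges {X} small = trans (∑-cong E λ (a , b) e∈E → ⟦false⟧ (case bool (X a ∧ X b) of λ where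
      (inj₂ h) → h
      (inj₁ h) → ⊥-elim (<⇒≱ (distinct-card {X = X} (∧-trueˡ h) (∧-trueʳ {X a} h) (All.lookup (loopless G) e∈E)) small)))
    (∑-0 E)

  e-full : e[ full ] E ≡ length E
  e-full = ∑-1 E

  card-full : card full ≡ V
  card-full = trans (∑-1 (allFin V)) (List.length-tabulate id)

  full-dense : 3 * V ≤ length E + 4 → Dense full
  full-dense h = two-vertices E refl (loopless G) , subst₂ (λ c e → 3 * c ≤ e + 4) (sym card-full) (sym e-full) h
    where
    two-vertices : ∀ F → F ≡ E → All (λ e → proj₁ e ≢ proj₂ e) F → 2 ≤ card full
    -- Without edges the empty orientation would be a flow.
    two-vertices [] eq _ = ⊥-elim (proj₁ critical (subst (HasNZ3Flow V) eq ([] , [] , λ _ → refl)))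
    two-vertices ((a , b) ∷ F) _ (a≢b ∷ _) = distinct-card {X = full} refl refl a≢b

  module Minimal {B} (dense-B : Dense B) (least : ∀ X → Dense X → card B ≤ card X)
                 {z} (z∈B : B z ≡ true) (low : ∀ v → B v ≡ true → v ≢ z → deg G v ≤ 6) where

    merge : Fin V → Fin V
    merge x = if B x then z else x

    merge-in : ∀ {x} → B x ≡ true → merge x ≡ z
    merge-in h rewrite h = refl

    merge-out : ∀ {x} → B x ≡ false → merge x ≡ x
    merge-out h rewrite h = refl

    merge-idem : ∀ x → merge (merge x) ≡ merge x
    merge-idem x with bool (B x)
    ... | inj₁ h = trans (cong merge (merge-in h)) (trans (merge-in z∈B) (sym (merge-in h)))
    ... | inj₂ h = cong merge (merge-out h)

    Q = quotient merge merge-idem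
    open Quotient Q

    alone : ∀ {x v} → B v ≡ false → p x ≡ p v → x ≡ v
    alone {x} {v} v∉B eq with bool (B x) | trans (separates eq) (merge-out v∉B)
    ... | inj₂ h | eq′ = trans (sym (merge-out h)) eq′
    ... | inj₁ h | eq′ = ⊥-elim (true≢false z∈B (subst (λ v → B v ≡ false) (trans (sym eq′) (merge-in h)) v∉B))

    nontrivial : NonTrivial p
    nontrivial = let c , C , _ , c∈ = pull (B − z) (allFin V) another ; c∈B , c≢z = ∈-−⁻ B c∈ in
      z , c , (c≢z ∘ sym) , identifies (trans (merge-in z∈B) (sym (merge-in c∈B)))
      where
      another : 1 ≤ card (B − z)
      another = ≤-pred (subst (2 ≤_) (card-− {W = B} z∈B) (proj₁ dense-B))

    outer : ∃ λ h → Attains E h × (∀ v → B v ≡ false → h v ≡ 𝟘)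
    outer = unquotient p B alone E (flow⇒attains (proj₂ critical k p surjective nontrivial))

    module Inner (F R : List (Edge V)) (split : E ≋ F ++ R) (inside-B : Within B F)
                 (outside-B : All (λ e → B (proj₁ e) ∧ B (proj₂ e) ≡ false) R)
                 (fB fo : Fin V → ℤ₃) (at-F : Attains F fB) (at-R : Attains R fo)
                 (balanced-outside : ∀ v → B v ≡ false → fB v ⊕ fo v ≡ 𝟘) where

      open Rooted z
      open Main z

      e-split : ∀ X → e[ X ] E ≡ e[ X ] F + e[ X ] R
      e-split X = trans (∑ᵉ-≋ (inside-sym X) split) (∑ᵉ-++ (inside X) F R)

      degree-F+R : ∀ w → degree w E ≡ degree w F + degree w R
      degree-F+R w = trans (∑ᵉ-≋ (touching-sym w) split) (∑ᵉ-++ (touching w) F R)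

      -- Minimality of `B` yields even 3|Y| - 5 if `Y` has at least two vertices. For smaller `Y`
      -- there are no edges at all, and 3|X| - 3 ≥ 0 for nonempty `X`.
      sparse : ∀ X → Nonempty X → ∀ w → B w ≡ true → X w ≡ false → e[ X ] F + 3 ≤ 3 * card X
      sparse X ne w w∈B w∉X = by-size (2 ≤? card Y)
        where
        Y : VSet V
        Y = X ∩ B
        X-in-Y : e[ X ] F ≤ e[ Y ] E
        X-in-Y = ≤-trans (≤-trans (∑-mono F λ (a , b) i → let a∈B , b∈B = All.lookup inside-B i in
            ⊆-⟦⟧ λ h → cong₂ _∧_ (cong₂ _∧_ (∧-trueˡ {X a} h) a∈B) (cong₂ _∧_ (∧-trueʳ {X a} h) b∈B))
          (m≤m+n (e[ Y ] F) (e[ Y ] R))) (≤-reflexive (sym (e-split Y)))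
        smaller : card Y < card B
        smaller = card-strict {X = Y} (λ v → ∧-trueʳ {X v}) w (cong (_∧ B w) w∉X) w∈B
        by-size : Dec (2 ≤ card Y) → e[ X ] F + 3 ≤ 3 * card X
        by-size (yes 2≤) = lin (e[ X ] F ∷ e[ Y ] E ∷ card Y ∷ card X ∷ [])
          (λ f e y x → (f :≤ e) ∷ (con 1 :+ (e :+ con 4) :≤ 3 :* y) ∷ 3 ⨾ (y :≤ x) ∷ [] ⊢ f :+ con 3 :≤ 3 :* x)
          (X-in-Y , ≰⇒> (λ d → <⇒≱ smaller (least Y (2≤ , d))) , card-mono {X = Y} (λ v → ∧-trueˡ))
        by-size (no 2≰) = lin (e[ X ] F ∷ e[ Y ] E ∷ card X ∷ [])
          (λ f e x → (f :≤ e) ∷ (e :≡ con 0) ∷ 3 ⨾ (con 1 :≤ x) ∷ [] ⊢ f :+ con 3 :≤ 3 :* x)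
          (X-in-Y , no-edges {Y} (≤-pred (≰⇒> 2≰)) , nonempty-card {X = X} ne)

      -- The edges not inside `B` keep the direction they have in the flow of the quotient; those
      -- inside must cancel their contribution.
      β : Fin V → ℤ₃
      β w = neg (fo w)

      -- Since the degree in `G` is at most 6, a vertex with an edge outside `F` has degree at most
      -- 5 in `F`; without such an edge its prescription is 0.
      good : ∀ w → B w ≡ true → w ≢ z → Good w F β
      good w w∈B w≢z = by-outer (degree w R) refl
        where
        ≤6 : degree w F + degree w R ≤ 6
        ≤6 = subst (_≤ 6) (trans (deg-degree G w) (degree-F+R w)) (low w w∈B w≢z)
        by-outer : ∀ d → degree w R ≡ d → Good w F β
        by-outer zero    eq = inj₂ (≤-trans (m≤m+n _ _) ≤6 , cong neg (attains-avoids (degree-zero eq) at-R))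
        by-outer (suc d) eq = inj₁ (lin (degree w F ∷ degree w R ∷ d ∷ [])
          (λ a b d → (a :+ b :≤ con 6) ∷ (b :≡˘ con 1 :+ d) ∷ [] ⊢ a :≤ con 5) (≤6 , eq))

      I : Instance B F β
      I = record
        { root = z∈B ; within = inside-B ; sparse = sparse ; good = good
        ; dense = lin (card B ∷ e[ B ] E ∷ e[ B ] F ∷ e[ B ] R ∷ length F ∷ [])
            (λ c e f r l → (3 :* c :≤ e :+ con 4) ∷ (e :≡ f :+ r) ∷ (r :≡ con 0) ∷ (f :≤ l) ∷ [] ⊢ 3 :* c :≤ l :+ con 4)
            (proj₂ dense-B , e-split B ,
             trans (∑-cong R λ e i → ⟦false⟧ (All.lookup outside-B i)) (∑-0 R) ,
             subst (e[ B ] F ≤_) (∑-1 F) (∑-mono F λ _ _ → ⟦⟧≤1 _))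
        }

      combine : Solution B F β → HasNZ3Flow V E
      combine (f , at , agrees) = attains⇒flow {f = λ v → f v ⊕ fo v} zero-everywhere at-E
        where
        at-E : Attains E (λ v → f v ⊕ fo v)
        at-E = attains-≋ split (attains-++⁺ at at-R)
        avoids : ∀ v → B v ≡ false → All (Avoids v) F
        avoids v v∉B = All.map (λ (a∈ , b∈) →
          (λ { refl → true≢false a∈ v∉B }) , (λ { refl → true≢false b∈ v∉B })) inside-B
        inverse : ∀ x → neg x ⊕ x ≡ 𝟘
        inverse = toWitness {a? = ∀₃ λ x → _ ≟₃ _} tt
        off-root : ∀ v → v ≢ z → f v ⊕ fo v ≡ 𝟘
        off-root v v≢z = by-side (bool (B v))
          where
          by-side : B v ≡ true ⊎ B v ≡ false → f v ⊕ fo v ≡ 𝟘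
          by-side (inj₁ v∈B) = trans (cong (_⊕ fo v) (agrees v v∈B v≢z)) (inverse (fo v))
          by-side (inj₂ v∉B) = begin
            f v ⊕ fo v  ≡⟨ cong (_⊕ fo v) (trans (attains-avoids (avoids v v∉B) at) (sym (attains-avoids (avoids v v∉B) at-F))) ⟩
            fB v ⊕ fo v ≡⟨ balanced-outside v v∉B ⟩
            𝟘           ∎
            where open ≡-Reasoning
        zero-everywhere : ∀ v → f v ⊕ fo v ≡ 𝟘
        zero-everywhere v = by-eq (v ≟ᶠ z)
          where
          by-eq : Dec (v ≡ z) → f v ⊕ fo v ≡ 𝟘
          by-eq (no v≢z)  = off-root v v≢z
          by-eq (yes v≡z) = subst (λ v → f v ⊕ fo v ≡ 𝟘) (sym v≡z) (vanishes-at-root z at-E off-root)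

      impossible′ : ⊥
      impossible′ = solve (suc (length F)) ≤-refl I λ s → proj₁ critical (combine s)

    absurd : ⊥
    absurd = from-outer outer (separate-inside B E)
      where
      from-outer : (∃ λ h → Attains E h × (∀ v → B v ≡ false → h v ≡ 𝟘)) →
        (∃₂ λ F R → E ≋ F ++ R × Within B F × All (λ e → B (proj₁ e) ∧ B (proj₂ e) ≡ false) R) → ⊥
      from-outer (h , at , zero-outside) (F , R , split , i , o) =
        from-parts (attains-++⁻ F (attains-≋ (≋-sym split) at))
        where
        from-parts : (∃₂ λ f g → Attains F f × Attains R g × (∀ v → f v ⊕ g v ≡ h v)) → ⊥
        from-parts (fB , fo , at-F , at-R , sum) =
          Inner.impossible′ F R split i o fB fo at-F at-R λ v v∉B → trans (sum v) (zero-outside v v∉B)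

  bound : length E + 5 ≤ 3 * V
  bound = stable-≤ λ fail → minimal Dense full (full-dense (dense fail)) λ where
      (B , dB , least) → em {∃ λ z → B z ≡ true × 7 ≤ deg G z} λ where
        (inj₁ (z , z∈B , 7≤)) → Minimal.absurd dB least z∈B
          λ v v∈B v≢z → ≤-pred (≰⇒> λ 7≤v → v≢z (one-big v z 7≤v 7≤))
        -- If `B` has no vertex of degree at least 7, any of its vertices can be the root.
        (inj₂ none) → let z , _ , _ , z∈B = pull B (allFin V) (≤-trans (n≤1+n 1) (proj₁ dB)) in
          Minimal.absurd dB least z∈B λ v v∈B _ → ≤-pred (≰⇒> λ 7≤v → none (v , v∈B , 7≤v))
    where
    dense : ¬ (length E + 5 ≤ 3 * V) → 3 * V ≤ length E + 4
    dense fail = ≤-pred (≤-trans (≰⇒> fail) (≤-reflexive (+-suc (length E) 4)))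

mainTheorem1 : (G : Graph) → FlowCritical G →
    (∀ (u v : Fin (n G)) → 7 ≤ deg G u → 7 ≤ deg G v → u ≡ v) →
    length (edges G) + 5 ≤ 3 * n G
mainTheorem1 = Critical.bound
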